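{- For every $\eta>0$ there is an admissible strategy $a\in\mathcal A$ (independent of $d$) such that for all integers $d\ge1$, $$\mathbb E[\mathcal T_d(a)]=O\left(d^{2+\eta}\right),$$ i.e. there is a constant $C=C(\eta)$, not depending on $d$, with $\mathbb E[\mathcal T_d(a)]\le C\,d^{2+\eta}$ for all integers $d\ge 1$.
   Context: An admissible strategy is a sequence $a=(a_i)_{i\ge 0}$ with $a_i\in[0,1]$ and $a_0=\tfrac12$; $\mathcal A$ is the set of admissible strategies. Extend $a$ to a signed sequence $(b_i)_{i\in\mathbb Z}$ by $b_i=a_i$ for $i\ge0$ and $b_i=1-a_{ -i}$ for $i<0$. Two independent Markov chains $(X_t)_{t\ge0},(Y_t)_{t\ge 0}$ on $\mathbb Z$ start at $X_0=Y_0=0$; each moves from $k$ to $k+1$ with probability $b_k$ and to $k-1$ with probability $1-b_k$. (These are the displacements of two agents from their starting points $-d$ and $d$.) For an integer $d\ge1$ the rendezvous time is $\mathcal T_d(a)=\inf\{t\ge0: X_t=Y_t+2d\}$ (with value $\infty$ if there is no such $t$). -}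

module Defs where

open import Data.Nat as ℕ using (ℕ; zero; suc)
import Data.Nat.Properties as ℕ
import Data.Nat.DivMod as ℕ
import Data.Nat.Tactic.RingSolver as ℕ-solver
open import Data.Integer as ℤ using (ℤ; +_; -[1+_])
import Data.Integer.Properties as ℤ
open import Data.Rational as ℚ using (ℚ; 0ℚ; 1ℚ; ½; ↥_; ↧ₙ_)
import Data.Rational.Properties as ℚ
import Data.Rational.Unnormalised as ℚᵘ
import Data.Rational.Unnormalised.Properties as ℚᵘ
open import Data.Rational.Solver using (module +-*-Solver)
open import Data.Product using (∃-syntax; _×_; _,_; proj₁; proj₂)
open import Data.Sum using (inj₁; inj₂)
open import Data.Vec using (Vec; []; _∷_)
open import Function using (_∘_)
open import Relation.Nullary using (yes; no; contradiction)
open import Relation.Binary.PropositionalEquality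
  using (_≡_; refl; sym; trans; cong; cong₂; subst; subst₂)

------------------------------------------------------------------------
-- Cauchy sequences of rational numbers

IsCauchy : (ℕ → ℚ) → Set
IsCauchy x = ∀ ε → 0ℚ ℚ.< ε →
  ∃[ N ] (∀ m n → N ℕ.≤ m → N ℕ.≤ n → ℚ.∣ x m ℚ.- x n ∣ ℚ.≤ ε)

module CauchyProperties where

  open import Data.Rational using (_+_; _*_; -_; _-_; ∣_∣; _<_; _≤_)
  open import Data.Rational.Properties using (module ≤-Reasoning)
  open ≤-Reasoning
  open +-*-Solver using (solve; _:+_; _:*_; :-_; _:-_; _:=_)

  half-sum : ∀ ε → ½ * ε + ½ * ε ≡ ε
  half-sum ε = trans (sym (ℚ.*-distribʳ-+ ε ½ ½)) (ℚ.*-identityˡ ε)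

  0<*0< : ∀ {p q} → 0ℚ < p → 0ℚ < q → 0ℚ < p * q
  0<*0< {p} {q} 0<p 0<q = ℚ.positive⁻¹ (p * q)
    {{ℚ.pos*pos⇒pos p {{ℚ.positive 0<p}} q {{ℚ.positive 0<q}}}}

  0<half : ∀ {ε} → 0ℚ < ε → 0ℚ < ½ * ε
  0<half = 0<*0< (ℚ.positive⁻¹ ½)

  p≤∣p∣ : ∀ p → p ≤ ∣ p ∣
  p≤∣p∣ p with ℚ.≤-total 0ℚ p
  ... | inj₁ 0≤p = ℚ.≤-reflexive (sym (ℚ.0≤p⇒∣p∣≡p 0≤p))
  ... | inj₂ p≤0 = ℚ.≤-trans p≤0 (ℚ.0≤∣p∣ p)

  ∣p∣≤ : ∀ {p ε} → p ≤ ε → - p ≤ ε → ∣ p ∣ ≤ ε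
  ∣p∣≤ {p} {ε} p≤ε -p≤ε with ℚ.∣p∣≡p∨∣p∣≡-p p
  ... | inj₁ eq = subst (_≤ ε) (sym eq) p≤ε
  ... | inj₂ eq = subst (_≤ ε) (sym eq) -p≤ε

  ∣p-q∣≤⇒p≤q+ : ∀ {p q ε} → ∣ p - q ∣ ≤ ε → p ≤ q + ε
  ∣p-q∣≤⇒p≤q+ {p} {q} {ε} h = begin
    p            ≡⟨ solve 2 (λ p q → p := q :+ (p :- q)) refl p q ⟩
    q + (p - q)  ≤⟨ ℚ.+-monoʳ-≤ q (ℚ.≤-trans (p≤∣p∣ (p - q)) h) ⟩
    q + ε        ∎

  p≤q+⇒p-q≤ : ∀ {p q ε} → p ≤ q + ε → p - q ≤ ε
  p≤q+⇒p-q≤ {p} {q} {ε} h = begin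
    p - q      ≤⟨ ℚ.+-monoˡ-≤ (- q) h ⟩
    q + ε - q  ≡⟨ solve 2 (λ q ε → q :+ ε :- q := ε) refl q ε ⟩
    ε          ∎

  p≤q+∧q≤p+⇒∣p-q∣≤ : ∀ {p q ε} → p ≤ q + ε → q ≤ p + ε → ∣ p - q ∣ ≤ ε
  p≤q+∧q≤p+⇒∣p-q∣≤ {p} {q} {ε} h₁ h₂ = ∣p∣≤ (p≤q+⇒p-q≤ h₁) (begin
    - (p - q)  ≡⟨ solve 2 (λ p q → :- (p :- q) := q :- p) refl p q ⟩
    q - p      ≤⟨ p≤q+⇒p-q≤ h₂ ⟩
    ε          ∎)

  const-cauchy : ∀ q → IsCauchy (λ _ → q)
  const-cauchy q ε 0<ε = 0 , λ _ _ _ _ → begin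
    ∣ q - q ∣  ≡⟨ cong ∣_∣ (ℚ.+-inverseʳ q) ⟩
    0ℚ         ≤⟨ ℚ.<⇒≤ 0<ε ⟩
    ε          ∎

  neg-cauchy : ∀ x → IsCauchy x → IsCauchy (λ n → - x n)
  neg-cauchy x cx ε 0<ε with cx ε 0<ε
  ... | N , h = N , λ m n N≤m N≤n → begin
    ∣ - x m - - x n ∣  ≡⟨ cong ∣_∣ (solve 2 (λ p q → :- p :- :- q := q :- p) refl (x m) (x n)) ⟩
    ∣ x n - x m ∣      ≤⟨ h n m N≤n N≤m ⟩
    ε                  ∎

  +-cauchy : ∀ x y → IsCauchy x → IsCauchy y → IsCauchy (λ n → x n + y n)
  +-cauchy x y cx cy ε 0<ε with cx (½ * ε) (0<half 0<ε) | cy (½ * ε) (0<half 0<ε)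
  ... | N₁ , h₁ | N₂ , h₂ = N₁ ℕ.⊔ N₂ , λ m n N≤m N≤n → begin
    ∣ (x m + y m) - (x n + y n) ∣
      ≡⟨ cong ∣_∣ (solve 4 (λ a b c d → (a :+ b) :- (c :+ d) := (a :- c) :+ (b :- d)) refl
           (x m) (y m) (x n) (y n)) ⟩
    ∣ (x m - x n) + (y m - y n) ∣
      ≤⟨ ℚ.∣p+q∣≤∣p∣+∣q∣ (x m - x n) (y m - y n) ⟩
    ∣ x m - x n ∣ + ∣ y m - y n ∣
      ≤⟨ ℚ.+-mono-≤
           (h₁ m n (ℕ.m⊔n≤o⇒m≤o N₁ N₂ N≤m) (ℕ.m⊔n≤o⇒m≤o N₁ N₂ N≤n))
           (h₂ m n (ℕ.m⊔n≤o⇒n≤o N₁ N₂ N≤m) (ℕ.m⊔n≤o⇒n≤o N₁ N₂ N≤n)) ⟩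
    ½ * ε + ½ * ε
      ≡⟨ half-sum ε ⟩
    ε ∎

  eventually-bounded : ∀ {x} → IsCauchy x →
    ∃[ B ] 0ℚ < B × ∃[ N ] (∀ n → N ℕ.≤ n → ∣ x n ∣ ≤ B)
  eventually-bounded {x} cx with cx 1ℚ (ℚ.positive⁻¹ 1ℚ)
  ... | N , h = ∣ x N ∣ + 1ℚ , 0<B , N , λ n N≤n → begin
      ∣ x n ∣                    ≡⟨ cong ∣_∣ (solve 2 (λ p q → p := q :+ (p :- q)) refl (x n) (x N)) ⟩
      ∣ x N + (x n - x N) ∣      ≤⟨ ℚ.∣p+q∣≤∣p∣+∣q∣ (x N) (x n - x N) ⟩
      ∣ x N ∣ + ∣ x n - x N ∣    ≤⟨ ℚ.+-monoʳ-≤ ∣ x N ∣ (h n N N≤n ℕ.≤-refl) ⟩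
      ∣ x N ∣ + 1ℚ               ∎
    where
    0<B : 0ℚ < ∣ x N ∣ + 1ℚ
    0<B = ℚ.+-mono-≤-< (ℚ.0≤∣p∣ (x N)) (ℚ.positive⁻¹ 1ℚ)

  *-mono-≤ : ∀ {p q r s} → 0ℚ ≤ q → 0ℚ ≤ r → p ≤ q → r ≤ s → p * r ≤ q * s
  *-mono-≤ {p} {q} {r} {s} 0≤q 0≤r p≤q r≤s = begin
    p * r  ≤⟨ ℚ.*-monoʳ-≤-nonNeg r {{ℚ.nonNegative 0≤r}} p≤q ⟩
    q * r  ≤⟨ ℚ.*-monoˡ-≤-nonNeg q {{ℚ.nonNegative 0≤q}} r≤s ⟩
    q * s  ∎

  split-ε : ∀ {A B ε} → 0ℚ < A → 0ℚ < B → 0ℚ < ε → ∃[ δ ] 0ℚ < δ × A * δ + δ * B ≡ ε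
  split-ε {A} {B} {ε} 0<A 0<B 0<ε = scale (A + B) refl (ℚ.+-mono-< 0<A 0<B)
    where
    scale : ∀ S → A + B ≡ S → 0ℚ < S → ∃[ δ ] 0ℚ < δ × A * δ + δ * B ≡ ε
    scale S A+B≡S 0<S = S⁻¹ * ε , 0<*0< (ℚ.positive⁻¹ S⁻¹ {{ℚ.1/pos⇒pos S}}) 0<ε , (begin-equality
        A * (S⁻¹ * ε) + (S⁻¹ * ε) * B
          ≡⟨ solve 4 (λ a b i e → a :* (i :* e) :+ (i :* e) :* b := ((a :+ b) :* i) :* e) refl
               A B S⁻¹ ε ⟩
        ((A + B) * S⁻¹) * ε  ≡⟨ cong (λ z → z * S⁻¹ * ε) A+B≡S ⟩
        (S * S⁻¹) * ε        ≡⟨ cong (_* ε) (ℚ.*-inverseʳ S) ⟩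
        1ℚ * ε               ≡⟨ ℚ.*-identityˡ ε ⟩
        ε                    ∎)
      where
      instance
        S-pos : ℚ.Positive S
        S-pos = ℚ.positive 0<S
        S-nonZero : ℚ.NonZero S
        S-nonZero = ℚ.pos⇒nonZero S
      S⁻¹ = ℚ.1/ S

  *-split : ∀ p q r s {A B δ} → 0ℚ ≤ A → 0ℚ ≤ δ →
    ∣ p ∣ ≤ A → ∣ q - s ∣ ≤ δ → ∣ p - r ∣ ≤ δ → ∣ s ∣ ≤ B →
    ∣ p * q - r * s ∣ ≤ A * δ + δ * B
  *-split p q r s {A} {B} {δ} 0≤A 0≤δ h₁ h₂ h₃ h₄ = begin
    ∣ p * q - r * s ∣
      ≡⟨ cong ∣_∣ (solve 4 (λ p q r s → p :* q :- r :* s := p :* (q :- s) :+ (p :- r) :* s) refl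
           p q r s) ⟩
    ∣ p * (q - s) + (p - r) * s ∣
      ≤⟨ ℚ.∣p+q∣≤∣p∣+∣q∣ (p * (q - s)) ((p - r) * s) ⟩
    ∣ p * (q - s) ∣ + ∣ (p - r) * s ∣
      ≡⟨ cong₂ _+_ (ℚ.∣p*q∣≡∣p∣*∣q∣ p (q - s)) (ℚ.∣p*q∣≡∣p∣*∣q∣ (p - r) s) ⟩
    ∣ p ∣ * ∣ q - s ∣ + ∣ p - r ∣ * ∣ s ∣
      ≤⟨ ℚ.+-mono-≤ (*-mono-≤ 0≤A (ℚ.0≤∣p∣ (q - s)) h₁ h₂) (*-mono-≤ 0≤δ (ℚ.0≤∣p∣ s) h₃ h₄) ⟩
    A * δ + δ * B ∎

  *-cauchy : ∀ x y → IsCauchy x → IsCauchy y → IsCauchy (λ n → x n * y n)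
  *-cauchy x y cx cy ε 0<ε =
    let A , 0<A , N₁ , a = eventually-bounded cx
        B , 0<B , N₂ , b = eventually-bounded cy
        δ , 0<δ , eq     = split-ε 0<A 0<B 0<ε
        N₃ , c           = cx δ 0<δ
        N₄ , d           = cy δ 0<δ
    in (N₁ ℕ.⊔ N₂) ℕ.⊔ (N₃ ℕ.⊔ N₄) , λ m n N≤m N≤n →
    let N₁₂≤m = ℕ.m⊔n≤o⇒m≤o (N₁ ℕ.⊔ N₂) (N₃ ℕ.⊔ N₄) N≤m
        N₁₂≤n = ℕ.m⊔n≤o⇒m≤o (N₁ ℕ.⊔ N₂) (N₃ ℕ.⊔ N₄) N≤n
        N₃₄≤m = ℕ.m⊔n≤o⇒n≤o (N₁ ℕ.⊔ N₂) (N₃ ℕ.⊔ N₄) N≤m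
        N₃₄≤n = ℕ.m⊔n≤o⇒n≤o (N₁ ℕ.⊔ N₂) (N₃ ℕ.⊔ N₄) N≤n
    in subst (∣ x m * y m - x n * y n ∣ ≤_) eq
         (*-split (x m) (y m) (x n) (y n) (ℚ.<⇒≤ 0<A) (ℚ.<⇒≤ 0<δ)
           (a m (ℕ.m⊔n≤o⇒m≤o N₁ N₂ N₁₂≤m))
           (d m n (ℕ.m⊔n≤o⇒n≤o N₃ N₄ N₃₄≤m) (ℕ.m⊔n≤o⇒n≤o N₃ N₄ N₃₄≤n))
           (c m n (ℕ.m⊔n≤o⇒m≤o N₃ N₄ N₃₄≤m) (ℕ.m⊔n≤o⇒m≤o N₃ N₄ N₃₄≤n))
           (b n (ℕ.m⊔n≤o⇒n≤o N₁ N₂ N₁₂≤n)))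

open CauchyProperties

------------------------------------------------------------------------
-- Rational approximations of d ^ r, for a natural number d ≥ 1 and a real
-- exponent r ≥ 0 given by a Cauchy sequence.
--
-- With N = n + 1, the n-th approximation of d ^ r is j / N, where
-- e = ⌊ N r ⌋ and j is the greatest natural number with
-- j / N ≤ d ^ (e / N), that is, with j ^ N ≤ N ^ N * d ^ e.

-- The greatest j ≤ B with j ^ N ≤ A (for N ≥ 1).
searchRoot : (N A B : ℕ) → ℕ
searchRoot N A zero    = zero
searchRoot N A (suc B) with suc B ℕ.^ N ℕ.≤? A
... | yes _ = suc B
... | no  _ = searchRoot N A B

-- The integer part of the N-th root of A.
iroot : (N A : ℕ) → ℕ
iroot N A = searchRoot N A A

-- The numerator of max(r, 0).
num⁺ : ℚ → ℕ
num⁺ r = ℤ.∣ ↥ r ℤ.⊔ + 0 ∣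

-- max(⌊ N r ⌋, 0)
scaledFloor : ℕ → ℚ → ℕ
scaledFloor N r = (N ℕ.* num⁺ r) ℕ./ ↧ₙ r

powRoot : (d : ℕ) (r : ℕ → ℚ) (n : ℕ) → ℕ
powRoot d r n = iroot (suc n) (suc n ℕ.^ suc n ℕ.* d ℕ.^ scaledFloor (suc n) (r n))

powSeq : (d : ℕ) (r : ℕ → ℚ) (n : ℕ) → ℚ
powSeq d r n = + powRoot d r n ℚ./ suc n

module PowerProperties where

  open import Data.Nat using (_+_; _*_; _^_; _≤_; _<_; z≤n; s≤s)
  open import Data.Nat.Properties using (module ≤-Reasoning)
  open ≤-Reasoning

  ^-distribʳ-* : ∀ a b n → (a * b) ^ n ≡ a ^ n * b ^ n
  ^-distribʳ-* a b zero    = refl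
  ^-distribʳ-* a b (suc n) = trans (cong (a * b *_) (^-distribʳ-* a b n)) (lemma a b (a ^ n) (b ^ n))
    where
    lemma : ∀ a b c d → a * b * (c * d) ≡ a * c * (b * d)
    lemma = ℕ-solver.solve-∀

  ^-cancelˡ-≤ : ∀ n .{{_ : ℕ.NonZero n}} {a b} → a ^ n ≤ b ^ n → a ≤ b
  ^-cancelˡ-≤ n h = ℕ.≮⇒≥ λ b<a → ℕ.<⇒≱ (ℕ.^-monoˡ-< n b<a) h

  m≤m^n : ∀ m n → m ≤ m ^ suc n
  m≤m^n zero      n = z≤n
  m≤m^n m@(suc _) n = ℕ.m≤m*n m (m ^ n) {{ℕ.m^n≢0 m n}}

  searchRoot-lower : ∀ N A B → searchRoot (suc N) A B ^ suc N ≤ A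
  searchRoot-lower N A zero    = z≤n
  searchRoot-lower N A (suc B) with suc B ^ suc N ℕ.≤? A
  ... | yes h = h
  ... | no  _ = searchRoot-lower N A B

  searchRoot-upper : ∀ N A B → A < suc B ^ N → A < suc (searchRoot N A B) ^ N
  searchRoot-upper N A zero    h = h
  searchRoot-upper N A (suc B) h with suc B ^ N ℕ.≤? A
  ... | yes _ = h
  ... | no  g = searchRoot-upper N A B (ℕ.≰⇒> g)

  iroot-lower : ∀ N A → iroot (suc N) A ^ suc N ≤ A
  iroot-lower N A = searchRoot-lower N A A

  iroot-upper : ∀ N A → A < suc (iroot (suc N) A) ^ suc N
  iroot-upper N A = searchRoot-upper (suc N) A A (m≤m^n (suc A) N)

  bernoulli : ∀ k d n → k ^ suc n + suc n * k ^ n * d ≤ (k + d) ^ suc n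
  bernoulli k d zero    = ℕ.≤-reflexive (lemma k d)
    where
    lemma : ∀ k d → k * 1 + 1 * 1 * d ≡ (k + d) * 1
    lemma = ℕ-solver.solve-∀
  bernoulli k d (suc n) = begin
    k * (k * P) + suc (suc n) * (k * P) * d
      ≤⟨ ℕ.m≤m+n _ (d * (suc n * P * d)) ⟩
    k * (k * P) + suc (suc n) * (k * P) * d + d * (suc n * P * d)
      ≡⟨ lemma k d n P ⟩
    (k + d) * (k * P + suc n * P * d)
      ≤⟨ ℕ.*-monoʳ-≤ (k + d) (bernoulli k d n) ⟩
    (k + d) * (k + d) ^ suc n ∎
    where
    P = k ^ n
    lemma : ∀ k d n P → k * (k * P) + (2 + n) * (k * P) * d + d * ((1 + n) * P * d)
                      ≡ (k + d) * (k * P + (1 + n) * P * d)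
    lemma = ℕ-solver.solve-∀

  bernoulli′ : ∀ k d .{{_ : ℕ.NonZero k}} → d * k ^ k ≤ (k + d) ^ k
  bernoulli′ k@(suc n) d = begin
    d * (k * k ^ n)               ≡⟨ ℕ.*-comm d (k * k ^ n) ⟩
    k * k ^ n * d                 ≤⟨ ℕ.m≤n+m _ _ ⟩
    k ^ suc n + suc n * k ^ n * d ≤⟨ bernoulli k d n ⟩
    (k + d) ^ k                   ∎

  -- j / N ≤ d ^ (e / N), d ^ (f / M) ≤ l / M and e / N ≤ f / M + 1 / k
  -- imply j / N ≤ (l / M) (1 + d / k).
  root-compare : ∀ d N M k {e f j l}
    .{{_ : ℕ.NonZero d}} .{{_ : ℕ.NonZero N}} .{{_ : ℕ.NonZero M}} .{{_ : ℕ.NonZero k}} →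
    j ^ N ≤ N ^ N * d ^ e → M ^ M * d ^ f ≤ l ^ M →
    e * M * k ≤ f * N * k + N * M →
    j * M * k ≤ N * l * (k + d)
  root-compare d N M k {e} {f} {j} {l} lower upper close = ^-cancelˡ-≤ k (begin
      (j * M * k) ^ k                 ≡⟨ ^-distribʳ-* (j * M) k k ⟩
      (j * M) ^ k * k ^ k             ≤⟨ ℕ.*-monoˡ-≤ (k ^ k) step ⟩
      (N * l) ^ k * d * k ^ k         ≡⟨ ℕ.*-assoc ((N * l) ^ k) d (k ^ k) ⟩
      (N * l) ^ k * (d * k ^ k)       ≤⟨ ℕ.*-monoʳ-≤ ((N * l) ^ k) (bernoulli′ k d) ⟩
      (N * l) ^ k * (k + d) ^ k       ≡⟨ ^-distribʳ-* (N * l) (k + d) k ⟨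
      (N * l * (k + d)) ^ k           ∎)
    where
    instance
      NM≢0 : ℕ.NonZero (N * M)
      NM≢0 = ℕ.m*n≢0 N M
    Q = k * (N * M)
    j-bound : j ^ Q ≤ N ^ Q * d ^ (e * M * k)
    j-bound = begin
      j ^ Q                         ≡⟨ cong (j ^_) (eq₁ N M k) ⟩
      j ^ (N * (M * k))             ≡⟨ ℕ.^-*-assoc j N (M * k) ⟨
      (j ^ N) ^ (M * k)             ≤⟨ ℕ.^-monoˡ-≤ (M * k) lower ⟩
      (N ^ N * d ^ e) ^ (M * k)     ≡⟨ ^-distribʳ-* (N ^ N) (d ^ e) (M * k) ⟩
      (N ^ N) ^ (M * k) * (d ^ e) ^ (M * k)
        ≡⟨ cong₂ _*_ (trans (ℕ.^-*-assoc N N (M * k)) (cong (N ^_) (sym (eq₁ N M k))))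
                     (trans (ℕ.^-*-assoc d e (M * k)) (cong (d ^_) (sym (ℕ.*-assoc e M k)))) ⟩
      N ^ Q * d ^ (e * M * k)       ∎
      where
      eq₁ : ∀ N M k → k * (N * M) ≡ N * (M * k)
      eq₁ = ℕ-solver.solve-∀
    l-bound : M ^ Q * d ^ (f * N * k) ≤ l ^ Q
    l-bound = begin
      M ^ Q * d ^ (f * N * k)
        ≡⟨ cong₂ _*_ (trans (ℕ.^-*-assoc M M (N * k)) (cong (M ^_) (sym (eq₂ N M k))))
                     (trans (ℕ.^-*-assoc d f (N * k)) (cong (d ^_) (sym (ℕ.*-assoc f N k)))) ⟨
      (M ^ M) ^ (N * k) * (d ^ f) ^ (N * k) ≡⟨ ^-distribʳ-* (M ^ M) (d ^ f) (N * k) ⟨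
      (M ^ M * d ^ f) ^ (N * k)     ≤⟨ ℕ.^-monoˡ-≤ (N * k) upper ⟩
      (l ^ M) ^ (N * k)             ≡⟨ ℕ.^-*-assoc l M (N * k) ⟩
      l ^ (M * (N * k))             ≡⟨ cong (l ^_) (eq₂ N M k) ⟨
      l ^ Q                         ∎
      where
      eq₂ : ∀ N M k → k * (N * M) ≡ M * (N * k)
      eq₂ = ℕ-solver.solve-∀
    step : (j * M) ^ k ≤ (N * l) ^ k * d
    step = ^-cancelˡ-≤ (N * M) (begin
      ((j * M) ^ k) ^ (N * M)                     ≡⟨ ℕ.^-*-assoc (j * M) k (N * M) ⟩
      (j * M) ^ Q                                 ≡⟨ ^-distribʳ-* j M Q ⟩
      j ^ Q * M ^ Q                               ≤⟨ ℕ.*-monoˡ-≤ (M ^ Q) j-bound ⟩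
      N ^ Q * d ^ (e * M * k) * M ^ Q
        ≤⟨ ℕ.*-monoˡ-≤ (M ^ Q) (ℕ.*-monoʳ-≤ (N ^ Q) (ℕ.^-monoʳ-≤ d close)) ⟩
      N ^ Q * d ^ (f * N * k + N * M) * M ^ Q
        ≡⟨ cong (λ z → N ^ Q * z * M ^ Q) (ℕ.^-distribˡ-+-* d (f * N * k) (N * M)) ⟩
      N ^ Q * (d ^ (f * N * k) * d ^ (N * M)) * M ^ Q
        ≡⟨ eq₃ (N ^ Q) (d ^ (f * N * k)) (d ^ (N * M)) (M ^ Q) ⟩
      N ^ Q * (M ^ Q * d ^ (f * N * k)) * d ^ (N * M)
        ≤⟨ ℕ.*-monoˡ-≤ (d ^ (N * M)) (ℕ.*-monoʳ-≤ (N ^ Q) l-bound) ⟩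
      N ^ Q * l ^ Q * d ^ (N * M)
        ≡⟨ cong (_* d ^ (N * M)) (trans (sym (^-distribʳ-* N l Q)) (sym (ℕ.^-*-assoc (N * l) k (N * M)))) ⟩
      ((N * l) ^ k) ^ (N * M) * d ^ (N * M)       ≡⟨ ^-distribʳ-* ((N * l) ^ k) d (N * M) ⟨
      ((N * l) ^ k * d) ^ (N * M)                 ∎)
      where
      eq₃ : ∀ a b c d → a * (b * c) * d ≡ a * (d * b) * c
      eq₃ = ℕ-solver.solve-∀

  scaledFloor-lower : ∀ N r → scaledFloor N r * ↧ₙ r ≤ N * num⁺ r
  scaledFloor-lower N r = ℕ.m/n*n≤m (N * num⁺ r) (↧ₙ r)

  scaledFloor-upper : ∀ N r → N * num⁺ r ≤ suc (scaledFloor N r) * ↧ₙ r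
  scaledFloor-upper N r = begin
    m                             ≡⟨ ℕ.m≡m%n+[m/n]*n m (↧ₙ r) ⟩
    m ℕ.% ↧ₙ r + m ℕ./ ↧ₙ r * ↧ₙ r
      ≤⟨ ℕ.+-monoˡ-≤ _ (ℕ.<⇒≤ (ℕ.m%n<n m (↧ₙ r))) ⟩
    ↧ₙ r + m ℕ./ ↧ₙ r * ↧ₙ r       ∎
    where m = N * num⁺ r

  num⁺-compare : ∀ p q s .{{_ : ℕ.NonZero s}} → p ℚ.≤ q ℚ.+ (+ 1 ℚ./ s) →
    s * num⁺ p * ↧ₙ q ≤ s * num⁺ q * ↧ₙ p + ↧ₙ p * ↧ₙ q
  num⁺-compare p@record{} q@record{} s@(suc _) h = lemma (↥ p) (↥ q) cross
    where
    h′ : ℚ.toℚᵘ p ℚᵘ.≤ ℚ.toℚᵘ q ℚᵘ.+ (+ 1 ℚᵘ./ s)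
    h′ = ℚᵘ.≤-trans (ℚ.toℚᵘ-mono-≤ h)
          (ℚᵘ.≤-reflexive (ℚᵘ.≃-trans (ℚ.toℚᵘ-homo-+ q (+ 1 ℚ./ s))
            (ℚᵘ.+-congʳ (ℚ.toℚᵘ q) (ℚ.toℚᵘ-fromℚᵘ (+ 1 ℚᵘ./ s)))))
    cross : ↥ p ℤ.* + (↧ₙ q * s) ℤ.≤ (↥ q ℤ.* + s ℤ.+ + 1 ℤ.* + ↧ₙ q) ℤ.* + ↧ₙ p
    cross = ℚᵘ.drop-*≤* h′
    nat : ∀ a b → + a ℤ.* + (↧ₙ q * s) ℤ.≤ (+ b ℤ.* + s ℤ.+ + 1 ℤ.* + ↧ₙ q) ℤ.* + ↧ₙ p →
      s * a * ↧ₙ q ≤ s * b * ↧ₙ p + ↧ₙ p * ↧ₙ q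
    nat a b c = subst₂ _≤_ (e₁ a (↧ₙ q) s) (e₂ b s (↧ₙ q) (↧ₙ p)) (ℤ.drop‿+≤+ (subst₂ ℤ._≤_
        (sym (ℤ.pos-* a (↧ₙ q * s)))
        (trans (cong (ℤ._* + ↧ₙ p) (sym (trans (ℤ.pos-+ (b * s) (1 * ↧ₙ q))
                  (cong₂ ℤ._+_ (ℤ.pos-* b s) (ℤ.pos-* 1 (↧ₙ q))))))
               (sym (ℤ.pos-* (b * s + 1 * ↧ₙ q) (↧ₙ p))))
        c))
      where
      e₁ : ∀ a v s → a * (v * s) ≡ s * a * v
      e₁ = ℕ-solver.solve-∀
      e₂ : ∀ b s v u → (b * s + 1 * v) * u ≡ s * b * u + u * v
      e₂ = ℕ-solver.solve-∀
    lemma : ∀ a b → a ℤ.* + (↧ₙ q * s) ℤ.≤ (b ℤ.* + s ℤ.+ + 1 ℤ.* + ↧ₙ q) ℤ.* + ↧ₙ p →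
      s * ℤ.∣ a ℤ.⊔ + 0 ∣ * ↧ₙ q ≤ s * ℤ.∣ b ℤ.⊔ + 0 ∣ * ↧ₙ p + ↧ₙ p * ↧ₙ q
    lemma -[1+ _ ] b _ = subst (λ z → z * ↧ₙ q ≤ s * ℤ.∣ b ℤ.⊔ + 0 ∣ * ↧ₙ p + ↧ₙ p * ↧ₙ q)
      (sym (ℕ.*-zeroʳ s)) z≤n
    lemma (+ a) (+ b) c
      rewrite ℕ.⊔-identityʳ a | ℕ.⊔-identityʳ b = nat a b c
    lemma (+ a) -[1+ b ] c
      rewrite ℕ.⊔-identityʳ a = nat a 0 (ℤ.≤-trans c
        (ℤ.*-monoʳ-≤-nonNeg (+ ↧ₙ p) (ℤ.+-monoˡ-≤ (+ 1 ℤ.* + ↧ₙ q)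
          (ℤ.*-monoʳ-≤-nonNeg (+ s) {x = -[1+ b ]} {y = + 0} ℤ.-≤+))))

  -- If p ≤ q + 1 / (2 k) and M ≥ 2 k, then ⌊ N p ⌋ / N ≤ ⌊ M q ⌋ / M + 1 / k.
  exponent-compare : ∀ p q N M k .{{_ : ℕ.NonZero k}} →
    p ℚ.≤ q ℚ.+ (+ 1 ℚ./ (2 * k)) {{ℕ.m*n≢0 2 k}} → 2 * k ≤ M →
    scaledFloor N p * M * k ≤ scaledFloor M q * N * k + N * M
  exponent-compare p q N M k h 2k≤M = ℕ.*-cancelʳ-≤ _ _ D {{D≢0}} (begin
      e * M * k * D
        ≡⟨ e₁ e M k u v ⟩
      2 * k * M * v * (e * u)
        ≤⟨ ℕ.*-monoʳ-≤ (2 * k * M * v) (scaledFloor-lower N p) ⟩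
      2 * k * M * v * (N * a)
        ≡⟨ e₂ k M v N a ⟩
      N * M * (2 * k * a * v)
        ≤⟨ ℕ.*-monoʳ-≤ (N * M) (num⁺-compare p q (2 * k) {{ℕ.m*n≢0 2 k}} h) ⟩
      N * M * (2 * k * b * u + u * v)
        ≡⟨ e₃ N M k b u v ⟩
      N * 2 * k * u * (M * b) + N * M * u * v
        ≤⟨ ℕ.+-monoˡ-≤ _ (ℕ.*-monoʳ-≤ (N * 2 * k * u) (scaledFloor-upper M q)) ⟩
      N * 2 * k * u * (suc f * v) + N * M * u * v
        ≡⟨ e₄ N k u v f M ⟩
      f * N * k * D + (N * (2 * k) * u * v + N * M * u * v)
        ≤⟨ ℕ.+-monoʳ-≤ (f * N * k * D) (ℕ.+-monoˡ-≤ _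
             (ℕ.*-monoˡ-≤ v (ℕ.*-monoˡ-≤ u (ℕ.*-monoʳ-≤ N 2k≤M)))) ⟩
      f * N * k * D + (N * M * u * v + N * M * u * v)
        ≡⟨ e₅ N k u v f M ⟩
      (f * N * k + N * M) * D ∎)
    where
    e = scaledFloor N p
    f = scaledFloor M q
    u = ↧ₙ p
    v = ↧ₙ q
    a = num⁺ p
    b = num⁺ q
    D = 2 * (u * v)
    D≢0 : ℕ.NonZero D
    D≢0 = ℕ.m*n≢0 2 (u * v) {{_}} {{ℕ.m*n≢0 u v}}
    e₁ : ∀ e M k u v → e * M * k * (2 * (u * v)) ≡ 2 * k * M * v * (e * u)
    e₁ = ℕ-solver.solve-∀
    e₂ : ∀ k M v N a → 2 * k * M * v * (N * a) ≡ N * M * (2 * k * a * v)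
    e₂ = ℕ-solver.solve-∀
    e₃ : ∀ N M k b u v → N * M * (2 * k * b * u + u * v) ≡ N * 2 * k * u * (M * b) + N * M * u * v
    e₃ = ℕ-solver.solve-∀
    e₄ : ∀ N k u v f M → N * 2 * k * u * ((1 + f) * v) + N * M * u * v
       ≡ f * N * k * (2 * (u * v)) + (N * (2 * k) * u * v + N * M * u * v)
    e₄ = ℕ-solver.solve-∀
    e₅ : ∀ N k u v f M → f * N * k * (2 * (u * v)) + (N * M * u * v + N * M * u * v)
       ≡ (f * N * k + N * M) * (2 * (u * v))
    e₅ = ℕ-solver.solve-∀

  num⁺-bound : ∀ p K → p ℚ.≤ + K ℚ./ 1 → num⁺ p ≤ K * ↧ₙ p
  num⁺-bound p@record{} K h = lemma (↥ p) cross
    where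
    cross : ↥ p ℤ.* + 1 ℤ.≤ + K ℤ.* + ↧ₙ p
    cross = ℚᵘ.drop-*≤* (ℚᵘ.≤-trans (ℚ.toℚᵘ-mono-≤ h)
              (ℚᵘ.≤-reflexive (ℚ.toℚᵘ-fromℚᵘ (+ K ℚᵘ./ 1))))
    lemma : ∀ a → a ℤ.* + 1 ℤ.≤ + K ℤ.* + ↧ₙ p → ℤ.∣ a ℤ.⊔ + 0 ∣ ≤ K * ↧ₙ p
    lemma -[1+ _ ] _ = z≤n
    lemma (+ a) c rewrite ℕ.⊔-identityʳ a = ℤ.drop‿+≤+
      (subst₂ ℤ._≤_ (ℤ.*-identityʳ (+ a)) (sym (ℤ.pos-* K (↧ₙ p))) c)

  powRoot-bound : ∀ d .{{_ : ℕ.NonZero d}} r n K → r n ℚ.≤ + K ℚ./ 1 →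
    powRoot d r n ≤ suc n * d ^ K
  powRoot-bound d r n K h = ^-cancelˡ-≤ M (begin
      powRoot d r n ^ M      ≤⟨ iroot-lower n (M ^ M * d ^ f) ⟩
      M ^ M * d ^ f          ≤⟨ ℕ.*-monoʳ-≤ (M ^ M) (ℕ.^-monoʳ-≤ d f≤KM) ⟩
      M ^ M * d ^ (K * M)    ≡⟨ cong (M ^ M *_) (ℕ.^-*-assoc d K M) ⟨
      M ^ M * (d ^ K) ^ M    ≡⟨ ^-distribʳ-* M (d ^ K) M ⟨
      (M * d ^ K) ^ M        ∎)
    where
    M = suc n
    f = scaledFloor M (r n)
    v = ↧ₙ (r n)
    f≤KM : f ≤ K * M
    f≤KM = ℕ.*-cancelʳ-≤ f (K * M) v (begin
      f * v              ≤⟨ scaledFloor-lower M (r n) ⟩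
      M * num⁺ (r n)     ≤⟨ ℕ.*-monoʳ-≤ M (num⁺-bound (r n) K h) ⟩
      M * (K * v)        ≡⟨ eq M K v ⟩
      K * M * v          ∎)
      where
      eq : ∀ M K v → M * (K * v) ≡ K * M * v
      eq = ℕ-solver.solve-∀

  /-compare : ∀ j N l M s ε .{{_ : ℕ.NonZero N}} .{{_ : ℕ.NonZero M}} .{{_ : ℕ.NonZero s}} →
    + 1 ℚ./ s ℚ.≤ ε → j * M * s ≤ l * N * s + N * M →
    + j ℚ./ N ℚ.≤ (+ l ℚ./ M) ℚ.+ ε
  /-compare j N@(suc _) l M@(suc _) s@(suc _) ε 1/s≤ε h =
    ℚ.≤-trans (ℚ.toℚᵘ-cancel-≤ unnorm) (ℚ.+-monoʳ-≤ (+ l ℚ./ M) 1/s≤ε)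
    where
    e₁ : ∀ j M s → j * M * s ≡ j * (M * s)
    e₁ = ℕ-solver.solve-∀
    e₂ : ∀ l N s M → l * N * s + N * M ≡ (l * s + 1 * M) * N
    e₂ = ℕ-solver.solve-∀
    cross : + j ℤ.* + (M * s) ℤ.≤ (+ l ℤ.* + s ℤ.+ + 1 ℤ.* + M) ℤ.* + N
    cross = subst₂ ℤ._≤_
      (ℤ.pos-* j (M * s))
      (trans (ℤ.pos-* (l * s + 1 * M) N) (cong (ℤ._* + N)
        (trans (ℤ.pos-+ (l * s) (1 * M)) (cong₂ ℤ._+_ (ℤ.pos-* l s) (ℤ.pos-* 1 M)))))
      (ℤ.+≤+ (subst₂ _≤_ (e₁ j M s) (e₂ l N s M) h))
    unnorm : ℚ.toℚᵘ (+ j ℚ./ N) ℚᵘ.≤ ℚ.toℚᵘ ((+ l ℚ./ M) ℚ.+ (+ 1 ℚ./ s))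
    unnorm = ℚᵘ.≤-trans (ℚᵘ.≤-reflexive (ℚ.toℚᵘ-fromℚᵘ (+ j ℚᵘ./ N)))
      (ℚᵘ.≤-trans {j = (+ l ℚᵘ./ M) ℚᵘ.+ (+ 1 ℚᵘ./ s)} (ℚᵘ.*≤* cross)
        (ℚᵘ.≤-reflexive (ℚᵘ.≃-sym (ℚᵘ.≃-trans (ℚ.toℚᵘ-homo-+ (+ l ℚ./ M) (+ 1 ℚ./ s))
          (ℚᵘ.+-cong (ℚ.toℚᵘ-fromℚᵘ (+ l ℚᵘ./ M)) (ℚ.toℚᵘ-fromℚᵘ (+ 1 ℚᵘ./ s)))))))

  1/↧≤ : ∀ ε → 0ℚ ℚ.< ε → + 1 ℚ./ ↧ₙ ε ℚ.≤ ε
  1/↧≤ ε@(ℚ.mkℚ (+ suc a) q _) _ = ℚ.toℚᵘ-cancel-≤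
    (ℚᵘ.≤-trans (ℚᵘ.≤-reflexive (ℚ.toℚᵘ-fromℚᵘ (+ 1 ℚᵘ./ suc q)))
      (ℚᵘ.*≤* (ℤ.*-monoʳ-≤-nonNeg (+ suc q) {x = + 1} {y = + suc a} (ℤ.+≤+ (s≤s z≤n)))))
  1/↧≤ (ℚ.mkℚ (+ 0) _ _) (ℚ.*<* (ℤ.+<+ ()))
  1/↧≤ (ℚ.mkℚ -[1+ _ ] _ _) (ℚ.*<* ())

  0<1/ : ∀ s .{{_ : ℕ.NonZero s}} → 0ℚ ℚ.< + 1 ℚ./ s
  0<1/ s = ℚ.positive⁻¹ (+ 1 ℚ./ s) {{ℚ.normalize-pos 1 s}}

  ≤num⁺ : ∀ p → p ℚ.≤ + num⁺ p ℚ./ 1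
  ≤num⁺ p@record{} = ℚ.toℚᵘ-cancel-≤ (ℚᵘ.≤-trans (ℚᵘ.*≤* (lemma (↥ p)))
      (ℚᵘ.≤-reflexive (ℚᵘ.≃-sym (ℚ.toℚᵘ-fromℚᵘ (+ num⁺ p ℚᵘ./ 1)))))
    where
    lemma : ∀ a → a ℤ.* + 1 ℤ.≤ + ℤ.∣ a ℤ.⊔ + 0 ∣ ℤ.* + ↧ₙ p
    lemma -[1+ _ ] = ℤ.-≤+
    lemma (+ a) rewrite ℕ.⊔-identityʳ a = subst₂ ℤ._≤_ (ℤ.pos-* a 1) (ℤ.pos-* a (↧ₙ p))
      (ℤ.+≤+ (ℕ.*-monoʳ-≤ a (s≤s z≤n)))

  pow-cauchy : ∀ d .{{_ : ℕ.NonZero d}} r → IsCauchy r → IsCauchy (powSeq d r)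
  pow-cauchy d r cr ε 0<ε = N₀ , λ m n N₀≤m N₀≤n →
      p≤q+∧q≤p+⇒∣p-q∣≤ (half m n N₀≤m N₀≤n) (half n m N₀≤n N₀≤m)
    where
    bdd = eventually-bounded cr
    K = num⁺ (proj₁ bdd)
    N₁ = proj₁ (proj₂ (proj₂ bdd))
    s = ↧ₙ ε
    B = d ^ K
    t = 2 * (suc B * d)
    k = s * t
    instance
      t≢0 : ℕ.NonZero t
      t≢0 = ℕ.m*n≢0 2 (suc B * d) {{_}} {{ℕ.m*n≢0 (suc B) d}}
      k≢0 : ℕ.NonZero k
      k≢0 = ℕ.m*n≢0 s t
      2k≢0 : ℕ.NonZero (2 * k)
      2k≢0 = ℕ.m*n≢0 2 k
    close = cr (+ 1 ℚ./ (2 * k)) (0<1/ (2 * k))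
    N₂ = proj₁ close
    N₀ = (N₁ ℕ.⊔ N₂) ℕ.⊔ (2 * k)
    half : ∀ m n → N₀ ≤ m → N₀ ≤ n → powSeq d r m ℚ.≤ powSeq d r n ℚ.+ ε
    half m n N₀≤m N₀≤n = /-compare j N l M s ε (1/↧≤ ε 0<ε)
      (ℕ.*-cancelʳ-≤ (j * M * s) (l * N * s + N * M) t (begin
        j * M * s * t                      ≡⟨ ℕ.*-assoc (j * M) s t ⟩
        j * M * k
          ≤⟨ root-compare d N M k {scaledFloor N (r m)} {scaledFloor M (r n)} {j} {suc l}
               (iroot-lower m (N ^ N * d ^ scaledFloor N (r m)))
               (ℕ.<⇒≤ (iroot-upper n (M ^ M * d ^ scaledFloor M (r n))))
               (exponent-compare (r m) (r n) N M k
                 (∣p-q∣≤⇒p≤q+ (proj₂ close m n (i₂ N₀≤m) (i₂ N₀≤n))) 2k≤M) ⟩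
        N * suc l * (k + d)                ≡⟨ e₁ N l s t d ⟩
        l * N * s * t + N * (l * d + d + s * t)
          ≤⟨ ℕ.+-monoʳ-≤ (l * N * s * t) (ℕ.*-monoʳ-≤ N small) ⟩
        l * N * s * t + N * (M * t)        ≡⟨ e₂ l N s t M ⟩
        (l * N * s + N * M) * t            ∎))
      where
      N = suc m
      M = suc n
      j = powRoot d r m
      l = powRoot d r n
      i₁ : ∀ {n} → N₀ ≤ n → N₁ ≤ n
      i₁ = ℕ.m⊔n≤o⇒m≤o N₁ N₂ ∘ ℕ.m⊔n≤o⇒m≤o (N₁ ℕ.⊔ N₂) (2 * k)
      i₂ : ∀ {n} → N₀ ≤ n → N₂ ≤ n
      i₂ = ℕ.m⊔n≤o⇒n≤o N₁ N₂ ∘ ℕ.m⊔n≤o⇒m≤o (N₁ ℕ.⊔ N₂) (2 * k)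
      2k≤M : 2 * k ≤ M
      2k≤M = ℕ.m≤n⇒m≤1+n (ℕ.m⊔n≤o⇒n≤o (N₁ ℕ.⊔ N₂) (2 * k) N₀≤n)
      2s≤M : 2 * s ≤ M
      2s≤M = ℕ.≤-trans (ℕ.*-monoʳ-≤ 2 (ℕ.m≤m*n s t)) 2k≤M
      l≤MB : l ≤ M * B
      l≤MB = powRoot-bound d r n K (ℚ.≤-trans (p≤∣p∣ (r n))
               (ℚ.≤-trans (proj₂ (proj₂ (proj₂ bdd)) n (i₁ N₀≤n)) (≤num⁺ (proj₁ bdd))))
      small : l * d + d + s * t ≤ M * t
      small = ℕ.*-cancelˡ-≤ 2 (begin
        2 * (l * d + d + s * t)               ≡⟨ e₃ l d s t ⟩
        2 * ((l + 1) * d) + 2 * s * t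
          ≤⟨ ℕ.+-mono-≤ (ℕ.*-monoʳ-≤ 2 (ℕ.*-monoˡ-≤ d (ℕ.+-mono-≤ l≤MB (s≤s (z≤n {n})))))
                        (ℕ.*-monoˡ-≤ t 2s≤M) ⟩
        2 * ((M * B + M) * d) + M * t         ≡⟨ e₄ M B d ⟩
        2 * (M * t)                           ∎)
        where
        e₃ : ∀ l d s t → 2 * (l * d + d + s * t) ≡ 2 * ((l + 1) * d) + 2 * s * t
        e₃ = ℕ-solver.solve-∀
        e₄ : ∀ M B d → 2 * ((M * B + M) * d) + M * (2 * ((1 + B) * d)) ≡ 2 * (M * (2 * ((1 + B) * d)))
        e₄ = ℕ-solver.solve-∀
      e₁ : ∀ N l s t d → N * (1 + l) * (s * t + d) ≡ l * N * s * t + N * (l * d + d + s * t)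
      e₁ = ℕ-solver.solve-∀
      e₂ : ∀ l N s t M → l * N * s * t + N * (M * t) ≡ (l * N * s + N * M) * t
      e₂ = ℕ-solver.solve-∀

open PowerProperties using (pow-cauchy)

------------------------------------------------------------------------
-- Real numbers

record ℝ : Set where
  constructor mkℝ
  field
    seq    : ℕ → ℚ
    cauchy : IsCauchy seq
open ℝ public

infix 4 _≤_ _<_ _≈_

_≤_ : ℝ → ℝ → Set
x ≤ y = ∀ ε → 0ℚ ℚ.< ε → ∃[ N ] (∀ n → N ℕ.≤ n → seq x n ℚ.≤ seq y n ℚ.+ ε)

_<_ : ℝ → ℝ → Set
x < y = ∃[ ε ] 0ℚ ℚ.< ε × ∃[ N ] (∀ n → N ℕ.≤ n → seq x n ℚ.+ ε ℚ.≤ seq y n)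

-- Equality of the represented numbers.
_≈_ : ℝ → ℝ → Set
x ≈ y = x ≤ y × y ≤ x

infixl 6 _+_ _-_
infixl 7 _*_
infix  8 -_

fromℚ : ℚ → ℝ
fromℚ q = mkℝ (λ _ → q) (const-cauchy q)

fromℕ : ℕ → ℝ
fromℕ n = fromℚ (+ n ℚ./ 1)

0ℝ 1ℝ 2ℝ ½ℝ : ℝ
0ℝ = fromℕ 0
1ℝ = fromℕ 1
2ℝ = fromℕ 2
½ℝ = fromℚ ½

-_ : ℝ → ℝ
- x = mkℝ (λ n → ℚ.- seq x n) (neg-cauchy (seq x) (cauchy x))

_+_ : ℝ → ℝ → ℝ
x + y = mkℝ (λ n → seq x n ℚ.+ seq y n) (+-cauchy (seq x) (seq y) (cauchy x) (cauchy y))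

_-_ : ℝ → ℝ → ℝ
x - y = x + - y

_*_ : ℝ → ℝ → ℝ
x * y = mkℝ (λ n → seq x n ℚ.* seq y n) (*-cauchy (seq x) (seq y) (cauchy x) (cauchy y))

0<⇒0≤2+ : ∀ η → 0ℝ < η → 0ℝ ≤ 2ℝ + η
0<⇒0≤2+ η (δ , 0<δ , N , h) ε 0<ε = N , λ n N≤n → begin
    0ℚ                                ≡⟨ refl ⟩
    0ℚ ℚ.+ 0ℚ ℚ.+ 0ℚ                  ≤⟨ ℚ.+-mono-≤ (ℚ.+-mono-≤ (ℚ.nonNegative⁻¹ (+ 2 ℚ./ 1)) (0≤η n N≤n)) (ℚ.<⇒≤ 0<ε) ⟩
    + 2 ℚ./ 1 ℚ.+ seq η n ℚ.+ ε       ∎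
  where
  open import Data.Rational.Properties using (module ≤-Reasoning)
  open ≤-Reasoning
  0≤η : ∀ n → N ℕ.≤ n → 0ℚ ℚ.≤ seq η n
  0≤η n N≤n = begin
    0ℚ          ≤⟨ ℚ.<⇒≤ 0<δ ⟩
    δ           ≡⟨ ℚ.+-identityˡ δ ⟨
    0ℚ ℚ.+ δ    ≤⟨ h n N≤n ⟩
    seq η n     ∎

-- The real power d ^ r, for a real exponent r ≥ 0: the limit of powSeq.
-- (For r < 0 the same formula would give d ^ max(r, 0).)
pow : (d : ℕ) .{{_ : ℕ.NonZero d}} (r : ℝ) → .(0ℝ ≤ r) → ℝ
pow d r _ = mkℝ (powSeq d (seq r)) (pow-cauchy d (seq r) (cauchy r))

------------------------------------------------------------------------
-- Strategies and the two chains

record Strategy : Set where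
  field
    a    : ℕ → ℝ
    0≤a  : ∀ i → 0ℝ ≤ a i
    a≤1  : ∀ i → a i ≤ 1ℝ
    a₀≈½ : a 0 ≈ ½ℝ

  b : ℤ → ℝ
  b (+ i)    = a i
  b -[1+ i ] = 1ℝ - a (suc i)
open Strategy public

data Step : Set where
  right left : Step

-- The first n steps of a trajectory.
Path : ℕ → Set
Path = Vec Step

move : Step → ℤ → ℤ
move right k = k ℤ.+ + 1
move left  k = k ℤ.- + 1

stepProb : Strategy → ℤ → Step → ℝ
stepProb 𝒶 k right = b 𝒶 k
stepProb 𝒶 k left  = 1ℝ - b 𝒶 k

-- Probability that the chain started at k follows the path.
pathProb : ∀ {n} → Strategy → ℤ → Path n → ℝ
pathProb 𝒶 k []      = 1ℝ
pathProb 𝒶 k (s ∷ ω) = stepProb 𝒶 k s * pathProb 𝒶 (move s k) ω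

∑ : ∀ {n} → (Path n → ℝ) → ℝ
∑ {zero}  f = f []
∑ {suc n} f = ∑ (λ ω → f (right ∷ ω)) + ∑ (λ ω → f (left ∷ ω))

-- min(T, n), where T is the first time t ≥ 0 with X_t = Y_t + 2d, for
-- X and Y started at x and y and making the steps ω and ω′.
min𝒯 : ∀ {n} (d : ℕ) (x y : ℤ) (ω ω′ : Path n) → ℕ
min𝒯 d x y ω ω′ with x ℤ.≟ y ℤ.+ + (2 ℕ.* d)
min𝒯 d x y ω       ω′        | yes _ = 0
min𝒯 d x y []      []        | no  _ = 0
min𝒯 d x y (s ∷ ω) (s′ ∷ ω′) | no  _ = suc (min𝒯 d (move s x) (move s′ y) ω ω′)

-- 𝔼[min(𝒯_d(a), n)]: since min(𝒯_d(a), n) is determined by the first n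
-- steps of the two independent chains, this is a finite sum.
𝔼min𝒯 : Strategy → (d n : ℕ) → ℝ
𝔼min𝒯 𝒶 d n = ∑ {n} λ ω → ∑ {n} λ ω′ →
  pathProb 𝒶 (+ 0) ω * pathProb 𝒶 (+ 0) ω′ * fromℕ (min𝒯 d (+ 0) (+ 0) ω ω′)

-- A value in [0,∞], given as the supremum of a nondecreasing sequence.
ℝ∞ : Set
ℝ∞ = ℕ → ℝ

infix 4 _≤∞_

_≤∞_ : ℝ∞ → ℝ → Set
s ≤∞ y = ∀ n → s n ≤ y

-- 𝔼[𝒯] = sup_n 𝔼[min(𝒯, n)] by monotone convergence; in particular it is
-- ∞ as soon as 𝒯 = ∞ with positive probability.
𝔼𝒯 : Strategy → ℕ → ℝ∞
𝔼𝒯 𝒶 d = 𝔼min𝒯 𝒶 d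

{-# OPTIONS --safe #-}
module Submission where

-- The strategy is a_k = (k − κ) / (2k + 1) for k ≥ 1, with κ small: a drift of order 1/k towards
-- the starting point, with a stationary measure of order k^(−1−2κ).  The meeting time is bounded
-- by Foster's criterion: if f ≥ 0 and the expected one-step change of f is at most −δ before the
-- meeting, then δ 𝔼[𝒯] ≤ f(0,0).  At a scale R proportional to d, take
--
--   f(x,y) = A + G(x) + G(−y) − μ Φ(S(x) − S(y) + W).
--
-- S is the odd harmonic function of the walk, with increments r_k = (k + 1) σ_k at k ≥ 0.
-- The function w(k) = k (k + 1) / 2 of |x| has drift −κ away from 0 but drift +1 at 0, so a small
-- multiple of it is corrected by a function with a concave kink at 0: −H_c on the positive and
-- +ρ H_{c′} on the negative side, where H_c is harmonic up to the point at which σ reaches c and has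
-- the increments of c w beyond it, with c = σ_R and c′ = σ_{2R}.  For x > R this produces a positive
-- drift κ σ_R.  It is cancelled by the drift of G(−y) if y > 2R, while x and y are both at most 3R
-- otherwise; there the quadratic part of the convex function Φ of the martingale S(x) − S(y),
-- which stands for the chance of meeting, supplies the missing negative drift.
-- All this holds with A of order R² σ_R, and σ_k^j ≤ k + 1 as soon as 5 j κ ≤ 1.

import Defs

module Rendezvous where

  open import Algebra.Properties.AbelianGroup using (∙-cancelˡ)
  open import Data.Integer as ℤ using (ℤ; +_; -[1+_])
  import Data.Integer.Properties as ℤ
  import Data.Integer.Tactic.RingSolver as ℤ-solver
  open import Data.Nat as ℕ using (ℕ; zero; suc)
  import Data.Nat.Properties as ℕ
  import Data.Nat.Tactic.RingSolver as ℕ-solver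
  open import Data.Product using (Σ-syntax; ∃-syntax; _×_; _,_)
  open import Data.Rational
  import Data.Rational.Properties as ℚ
  import Data.Rational.Unnormalised as ℚᵘ
  import Data.Rational.Unnormalised.Properties as ℚᵘ
  open import Data.Sum using (_⊎_; inj₁; inj₂; [_,_]′)
  open import Data.Vec using ([]; _∷_)
  open import Level using (0ℓ)
  open import Relation.Binary.PropositionalEquality
  open import Relation.Nullary using (yes; no; contradiction)
  open import Relation.Nullary.Decidable using (dec⇒maybe)
  open import Tactic.RingSolver using (solve-∀)
  open import Tactic.RingSolver.Core.AlmostCommutativeRing using (AlmostCommutativeRing; fromCommutativeRing)
  open Defs using
    ( ℝ; seq; fromℚ; fromℕ; 0ℝ; 2ℝ; pow; 0<⇒0≤2+; num⁺; scaledFloor; powRoot; powSeq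
    ; Step; right; left; Path; move; min𝒯; ∑; Strategy; stepProb; pathProb; 𝔼min𝒯; 𝔼𝒯; _≤∞_ )
  open Defs.PowerProperties using
    (^-distribʳ-*; ^-cancelˡ-≤; iroot-upper; scaledFloor-upper; 1/↧≤; ≤num⁺)

  -- Rational arithmetic

  ring : AlmostCommutativeRing 0ℓ 0ℓ
  ring = fromCommutativeRing ℚ.+-*-commutativeRing λ p → dec⇒maybe (0ℚ ℚ.≟ p)

  0≤+ : ∀ {p q} → 0ℚ ≤ p → 0ℚ ≤ q → 0ℚ ≤ p + q
  0≤+ = ℚ.+-mono-≤

  0≤* : ∀ {p q} → 0ℚ ≤ p → 0ℚ ≤ q → 0ℚ ≤ p * q
  0≤* {p} {q} 0≤p 0≤q = ℚ.nonNegative⁻¹ (p * q)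
    {{ℚ.nonNeg*nonNeg⇒nonNeg p {{nonNegative 0≤p}} q {{nonNegative 0≤q}}}}

  0<* : ∀ {p q} → 0ℚ < p → 0ℚ < q → 0ℚ < p * q
  0<* {p} {q} 0<p 0<q = ℚ.positive⁻¹ (p * q) {{ℚ.pos*pos⇒pos p {{positive 0<p}} q {{positive 0<q}}}}

  ≤⇒0≤- : ∀ {p q} → p ≤ q → 0ℚ ≤ q - p
  ≤⇒0≤- {p} {q} p≤q = subst (_≤ q - p) (ℚ.+-inverseʳ p) (ℚ.+-monoˡ-≤ (- p) p≤q)

  ≤-by : ∀ {p q} t → 0ℚ ≤ t → q ≡ p + t → p ≤ q
  ≤-by {p} {q} t 0≤t eq = subst (p ≤_) (sym eq)
    (subst (_≤ p + t) (ℚ.+-identityʳ p) (ℚ.+-monoʳ-≤ p 0≤t))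

  *-monoˡ : ∀ {r p q} → 0ℚ ≤ r → p ≤ q → r * p ≤ r * q
  *-monoˡ {r} 0≤r = ℚ.*-monoˡ-≤-nonNeg r {{nonNegative 0≤r}}

  *-monoʳ : ∀ {r p q} → 0ℚ ≤ r → p ≤ q → p * r ≤ q * r
  *-monoʳ {r} 0≤r = ℚ.*-monoʳ-≤-nonNeg r {{nonNegative 0≤r}}

  *-cancelˡ : ∀ {r p q} → 0ℚ < r → r * p ≤ r * q → p ≤ q
  *-cancelˡ {r} 0<r = ℚ.*-cancelˡ-≤-pos r {{positive 0<r}}

  0≤p² : ∀ p → 0ℚ ≤ p * p
  0≤p² p with ℚ.≤-total 0ℚ p
  ... | inj₁ 0≤p = 0≤* 0≤p 0≤p
  ... | inj₂ p≤0 = subst (0ℚ ≤_) (lemma p) (0≤* (≤⇒0≤- p≤0) (≤⇒0≤- p≤0))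
    where
    lemma : ∀ p → (0ℚ - p) * (0ℚ - p) ≡ p * p
    lemma = solve-∀ ring

  inv : ∀ q → 0ℚ < q → ℚ
  inv q 0<q = (1/ q) {{ℚ.pos⇒nonZero q {{positive 0<q}}}}

  *-inv : ∀ q (0<q : 0ℚ < q) → q * inv q 0<q ≡ 1ℚ
  *-inv q 0<q = ℚ.*-inverseʳ q {{ℚ.pos⇒nonZero q {{positive 0<q}}}}

  0<inv : ∀ q (0<q : 0ℚ < q) → 0ℚ < inv q 0<q
  0<inv q 0<q = ℚ.positive⁻¹ (inv q 0<q) {{ℚ.1/pos⇒pos q {{positive 0<q}}}}

  -- Recursive rather than `+ n / 1`, so that `ι (suc n)` unfolds to `1ℚ + ι n` and identities
  -- polynomial in n can be passed to the ring solver.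
  ι : ℕ → ℚ
  ι zero    = 0ℚ
  ι (suc n) = 1ℚ + ι n

  0≤ι : ∀ n → 0ℚ ≤ ι n
  0≤ι zero    = ℚ.≤-refl
  0≤ι (suc n) = 0≤+ (ℚ.nonNegative⁻¹ 1ℚ) (0≤ι n)

  0<1+ : ∀ {p} → 0ℚ ≤ p → 0ℚ < 1ℚ + p
  0<1+ 0≤p = ℚ.+-mono-<-≤ (ℚ.positive⁻¹ 1ℚ) 0≤p

  1≤ι : ∀ n .{{_ : ℕ.NonZero n}} → 1ℚ ≤ ι n
  1≤ι (suc n) = ≤-by (ι n) (0≤ι n) refl

  ι-+ : ∀ m n → ι (m ℕ.+ n) ≡ ι m + ι n
  ι-+ zero    n = sym (ℚ.+-identityˡ (ι n))
  ι-+ (suc m) n = trans (cong (_+_ 1ℚ) (ι-+ m n)) (sym (ℚ.+-assoc 1ℚ (ι m) (ι n)))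

  ι-* : ∀ m n → ι (m ℕ.* n) ≡ ι m * ι n
  ι-* zero    n = sym (ℚ.*-zeroˡ (ι n))
  ι-* (suc m) n = trans (ι-+ n (m ℕ.* n)) (trans (cong (_+_ (ι n)) (ι-* m n)) (lemma (ι m) (ι n)))
    where
    lemma : ∀ m n → n + m * n ≡ (1ℚ + m) * n
    lemma = solve-∀ ring

  ι-mono : ∀ {m n} → m ℕ.≤ n → ι m ≤ ι n
  ι-mono {n = n} ℕ.z≤n = 0≤ι n
  ι-mono (ℕ.s≤s h) = ℚ.+-monoʳ-≤ 1ℚ (ι-mono h)

  ι≡/1 : ∀ n → + n / 1 ≡ ι n
  ι≡/1 zero    = refl
  ι≡/1 (suc n) = trans (ℚ.toℚᵘ-injective (ℚᵘ.≃-trans (ℚ.toℚᵘ-fromℚᵘ (+ suc n ℚᵘ./ 1))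
      (ℚᵘ.≃-sym (ℚᵘ.≃-trans (ℚ.toℚᵘ-homo-+ 1ℚ (+ n / 1))
        (ℚᵘ.≃-trans (ℚᵘ.+-congʳ (toℚᵘ 1ℚ) (ℚ.toℚᵘ-fromℚᵘ (+ n ℚᵘ./ 1)))
          (ℚᵘ.*≡* (cong (λ z → (+ 1 ℤ.+ z) ℤ.* + 1) (ℤ.*-identityʳ (+ n)))))))))
    (cong (_+_ 1ℚ) (ι≡/1 n))

  infixr 8 _^_

  _^_ : ℚ → ℕ → ℚ
  p ^ zero  = 1ℚ
  p ^ suc n = p * p ^ n

  0≤^ : ∀ {p} n → 0ℚ ≤ p → 0ℚ ≤ p ^ n
  0≤^ zero    0≤p = ℚ.nonNegative⁻¹ 1ℚ
  0≤^ (suc n) 0≤p = 0≤* 0≤p (0≤^ n 0≤p)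

  0<^ : ∀ {p} n → 0ℚ < p → 0ℚ < p ^ n
  0<^ zero    0<p = ℚ.positive⁻¹ 1ℚ
  0<^ (suc n) 0<p = 0<* 0<p (0<^ n 0<p)

  ^-mono : ∀ {p q} n → 0ℚ ≤ p → p ≤ q → p ^ n ≤ q ^ n
  ^-mono zero    0≤p p≤q = ℚ.≤-refl
  ^-mono {p} {q} (suc n) 0≤p p≤q = ℚ.≤-trans (*-monoˡ 0≤p (^-mono n 0≤p p≤q))
    (*-monoʳ (0≤^ n (ℚ.≤-trans 0≤p p≤q)) p≤q)

  ^-cancel : ∀ {p q} n → 0ℚ ≤ q → p ^ suc n ≤ q ^ suc n → p ≤ q
  ^-cancel {p} {q} n 0≤q h = ℚ.≮⇒≥ λ q<p → ℚ.<-irrefl refl (ℚ.<-≤-trans (strict q<p) h)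
    where
    strict : q < p → q ^ suc n < p ^ suc n
    strict q<p = ℚ.≤-<-trans (*-monoˡ 0≤q (^-mono n 0≤q (ℚ.<⇒≤ q<p)))
      (ℚ.*-monoˡ-<-pos (p ^ n) {{positive (0<^ n (ℚ.≤-<-trans 0≤q q<p))}} q<p)

  ^-distrib-* : ∀ p q n → (p * q) ^ n ≡ p ^ n * q ^ n
  ^-distrib-* p q zero    = refl
  ^-distrib-* p q (suc n) = trans (cong (p * q *_) (^-distrib-* p q n)) (lemma p q (p ^ n) (q ^ n))
    where
    lemma : ∀ a b c d → a * b * (c * d) ≡ a * c * (b * d)
    lemma = solve-∀ ring

  ι-^ : ∀ m n → ι (m ℕ.^ n) ≡ ι m ^ n
  ι-^ m zero    = refl
  ι-^ m (suc n) = trans (ι-* m (m ℕ.^ n)) (cong (ι m *_) (ι-^ m n))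

  -- Bernoulli's inequality (p/q)^n ≥ 1 − n (1 − p/q), cleared of denominators
  bernoulli : ∀ {p q} n → 0ℚ ≤ p → p ≤ q → q ^ n * (q - ι n * (q - p)) ≤ p ^ n * q
  bernoulli {p} {q} zero    0≤p p≤q = ℚ.≤-reflexive (lemma p q)
    where
    lemma : ∀ p q → 1ℚ * (q - 0ℚ * (q - p)) ≡ 1ℚ * q
    lemma = solve-∀ ring
  bernoulli {p} {q} (suc n) 0≤p p≤q = begin
      q * q ^ n * (q - ι (suc n) * (q - p))
        ≤⟨ ≤-by (q ^ n * (ι n * ((q - p) * (q - p))))
             (0≤* (0≤^ n (ℚ.≤-trans 0≤p p≤q)) (0≤* (0≤ι n) (0≤p² (q - p)))) (lemma p q (q ^ n) (ι n)) ⟩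
      p * (q ^ n * (q - ι n * (q - p)))
        ≤⟨ *-monoˡ 0≤p (bernoulli n 0≤p p≤q) ⟩
      p * (p ^ n * q)
        ≡⟨ ℚ.*-assoc p (p ^ n) q ⟨
      p * p ^ n * q ∎
    where
    open ℚ.≤-Reasoning
    lemma : ∀ p q Q n → p * (Q * (q - n * (q - p)))
      ≡ q * Q * (q - (1ℚ + n) * (q - p)) + Q * (n * ((q - p) * (q - p)))
    lemma = solve-∀ ring

  -- Comparison with the rational approximations of d ^ r

  -- With `N = suc n` and `e` the rounded exponent, the hypothesis reads e/N ≥ 2 + 1/j. For
  -- `l = powRoot d r n` the integer root satisfies N^N d^e < (l + 1)^N. Raising this to the power j
  -- and cancelling the exponent N leaves N d^(2 + 1/j) ≤ l + 1, stated through j-th powers to stay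
  -- within ℕ.
  powRoot-lower : ∀ d .{{_ : ℕ.NonZero d}} (r : ℕ → ℚ) n j →
    suc n ℕ.* (2 ℕ.* j ℕ.+ 1) ℕ.≤ scaledFloor (suc n) (r n) ℕ.* j →
    suc n ℕ.^ j ℕ.* (d ℕ.^ j ℕ.* d ℕ.^ j ℕ.* d) ℕ.≤ suc (powRoot d r n) ℕ.^ j
  powRoot-lower d r n j h = ^-cancelˡ-≤ N (begin
      (N ℕ.^ j ℕ.* (d ℕ.^ j ℕ.* d ℕ.^ j ℕ.* d)) ℕ.^ N
        ≡⟨ cong (λ z → (N ℕ.^ j ℕ.* z) ℕ.^ N) d-power ⟩
      (N ℕ.^ j ℕ.* d ℕ.^ (2 ℕ.* j ℕ.+ 1)) ℕ.^ N
        ≡⟨ ^-distribʳ-* (N ℕ.^ j) (d ℕ.^ (2 ℕ.* j ℕ.+ 1)) N ⟩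
      (N ℕ.^ j) ℕ.^ N ℕ.* (d ℕ.^ (2 ℕ.* j ℕ.+ 1)) ℕ.^ N
        ≡⟨ cong₂ ℕ._*_ (power-swap N j N) (trans (ℕ.^-*-assoc d (2 ℕ.* j ℕ.+ 1) N) (cong (d ℕ.^_) (ℕ.*-comm (2 ℕ.* j ℕ.+ 1) N))) ⟩
      (N ℕ.^ N) ℕ.^ j ℕ.* d ℕ.^ (N ℕ.* (2 ℕ.* j ℕ.+ 1))
        ≤⟨ ℕ.*-monoʳ-≤ ((N ℕ.^ N) ℕ.^ j) (ℕ.^-monoʳ-≤ d h) ⟩
      (N ℕ.^ N) ℕ.^ j ℕ.* d ℕ.^ (e ℕ.* j)
        ≡⟨ cong ((N ℕ.^ N) ℕ.^ j ℕ.*_) (ℕ.^-*-assoc d e j) ⟨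
      (N ℕ.^ N) ℕ.^ j ℕ.* (d ℕ.^ e) ℕ.^ j
        ≡⟨ ^-distribʳ-* (N ℕ.^ N) (d ℕ.^ e) j ⟨
      (N ℕ.^ N ℕ.* d ℕ.^ e) ℕ.^ j
        ≤⟨ ℕ.^-monoˡ-≤ j (ℕ.<⇒≤ (iroot-upper n (N ℕ.^ N ℕ.* d ℕ.^ e))) ⟩
      (suc (powRoot d r n) ℕ.^ N) ℕ.^ j
        ≡⟨ power-swap (suc (powRoot d r n)) N j ⟩
      (suc (powRoot d r n) ℕ.^ j) ℕ.^ N ∎)
    where
    open ℕ.≤-Reasoning
    N = suc n
    e = scaledFloor N (r n)
    power-swap : ∀ a b c → (a ℕ.^ b) ℕ.^ c ≡ (a ℕ.^ c) ℕ.^ b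
    power-swap a b c = trans (ℕ.^-*-assoc a b c) (trans (cong (a ℕ.^_) (ℕ.*-comm b c)) (sym (ℕ.^-*-assoc a c b)))
    d-power : d ℕ.^ j ℕ.* d ℕ.^ j ℕ.* d ≡ d ℕ.^ (2 ℕ.* j ℕ.+ 1)
    d-power = sym (trans (ℕ.^-distribˡ-+-* d (2 ℕ.* j) 1) (cong₂ ℕ._*_
      (trans (cong (λ z → d ℕ.^ (j ℕ.+ z)) (ℕ.+-identityʳ j)) (ℕ.^-distribˡ-+-* d j j)) (ℕ.*-identityʳ d)))

  num⁺-lower : ∀ r v .{{_ : ℕ.NonZero v}} → + 2 / 1 + + 1 / v ≤ r →
    (2 ℕ.* v ℕ.+ 1) ℕ.* ↧ₙ r ℕ.≤ num⁺ r ℕ.* v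
  num⁺-lower r@record{} v@(suc _) h = lemma (↥ r) cross
    where
    h′ : (+ 2 ℚᵘ./ 1) ℚᵘ.+ (+ 1 ℚᵘ./ v) ℚᵘ.≤ toℚᵘ r
    h′ = ℚᵘ.≤-trans (ℚᵘ.≤-reflexive (ℚᵘ.≃-sym (ℚᵘ.≃-trans (ℚ.toℚᵘ-homo-+ (+ 2 / 1) (+ 1 / v))
      (ℚᵘ.+-congʳ (+ 2 ℚᵘ./ 1) (ℚ.toℚᵘ-fromℚᵘ (+ 1 ℚᵘ./ v)))))) (ℚ.toℚᵘ-mono-≤ h)
    cross : (+ 2 ℤ.* + v ℤ.+ + 1 ℤ.* + 1) ℤ.* + ↧ₙ r ℤ.≤ ↥ r ℤ.* + (1 ℕ.* v)
    cross = ℚᵘ.drop-*≤* h′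
    eq : (+ 2 ℤ.* + v ℤ.+ + 1 ℤ.* + 1) ℤ.* + ↧ₙ r ≡ + ((2 ℕ.* v ℕ.+ 1) ℕ.* ↧ₙ r)
    eq = trans (cong (λ z → (z ℤ.+ + 1) ℤ.* + ↧ₙ r) (sym (ℤ.pos-* 2 v))) (sym (ℤ.pos-* (2 ℕ.* v ℕ.+ 1) (↧ₙ r)))
    lemma : ∀ a → (+ 2 ℤ.* + v ℤ.+ + 1 ℤ.* + 1) ℤ.* + ↧ₙ r ℤ.≤ a ℤ.* + (1 ℕ.* v) →
      (2 ℕ.* v ℕ.+ 1) ℕ.* ↧ₙ r ℕ.≤ ℤ.∣ a ℤ.⊔ + 0 ∣ ℕ.* v
    lemma (+ a) c = subst₂ (λ x y → (2 ℕ.* v ℕ.+ 1) ℕ.* ↧ₙ r ℕ.≤ x ℕ.* y) (sym (ℕ.⊔-identityʳ a)) (ℕ.*-identityˡ v)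
      (ℤ.drop‿+≤+ (subst₂ ℤ._≤_ eq (sym (ℤ.pos-* a (1 ℕ.* v))) c))
    lemma -[1+ a ] c with () ← subst (ℤ._≤ -[1+ a ] ℤ.* + (1 ℕ.* v)) eq c

  -- Rounding down loses at most one: e + 1 ≥ N r ≥ N (2 + 1/v). Half of the margin N/v pays for
  -- that unit once N ≥ 2v, which leaves e/N ≥ 2 + 1/(2v). This is why j = 2v later.
  scaledFloor-linear : ∀ r v n .{{_ : ℕ.NonZero v}} → + 2 / 1 + + 1 / v ≤ r → 2 ℕ.* v ℕ.≤ n →
    suc n ℕ.* (2 ℕ.* (2 ℕ.* v) ℕ.+ 1) ℕ.≤ scaledFloor (suc n) r ℕ.* (2 ℕ.* v)
  scaledFloor-linear r v n h 2v≤n = ℕ.+-cancelʳ-≤ (2 ℕ.* v) (N ℕ.* (2 ℕ.* (2 ℕ.* v) ℕ.+ 1)) (e ℕ.* (2 ℕ.* v)) (begin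
      N ℕ.* (2 ℕ.* (2 ℕ.* v) ℕ.+ 1) ℕ.+ 2 ℕ.* v
        ≤⟨ ℕ.+-monoʳ-≤ (N ℕ.* (2 ℕ.* (2 ℕ.* v) ℕ.+ 1)) (ℕ.m≤n⇒m≤1+n 2v≤n) ⟩
      N ℕ.* (2 ℕ.* (2 ℕ.* v) ℕ.+ 1) ℕ.+ N
        ≡⟨ e₁ N v ⟩
      2 ℕ.* (N ℕ.* (2 ℕ.* v ℕ.+ 1))
        ≤⟨ ℕ.*-monoʳ-≤ 2 (ℕ.*-cancelʳ-≤ (N ℕ.* (2 ℕ.* v ℕ.+ 1)) (suc e ℕ.* v) (↧ₙ r) (begin
             N ℕ.* (2 ℕ.* v ℕ.+ 1) ℕ.* ↧ₙ r      ≡⟨ ℕ.*-assoc N (2 ℕ.* v ℕ.+ 1) (↧ₙ r) ⟩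
             N ℕ.* ((2 ℕ.* v ℕ.+ 1) ℕ.* ↧ₙ r)    ≤⟨ ℕ.*-monoʳ-≤ N (num⁺-lower r v h) ⟩
             N ℕ.* (num⁺ r ℕ.* v)                ≡⟨ ℕ.*-assoc N (num⁺ r) v ⟨
             N ℕ.* num⁺ r ℕ.* v                  ≤⟨ ℕ.*-monoˡ-≤ v (scaledFloor-upper N r) ⟩
             suc e ℕ.* ↧ₙ r ℕ.* v                ≡⟨ e₂ (suc e) (↧ₙ r) v ⟩
             suc e ℕ.* v ℕ.* ↧ₙ r                ∎)) ⟩
      2 ℕ.* (suc e ℕ.* v)
        ≡⟨ e₃ e v ⟩
      e ℕ.* (2 ℕ.* v) ℕ.+ 2 ℕ.* v ∎)
    where
    open ℕ.≤-Reasoning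
    N = suc n
    e = scaledFloor N r
    e₁ : ∀ N v → N ℕ.* (2 ℕ.* (2 ℕ.* v) ℕ.+ 1) ℕ.+ N ≡ 2 ℕ.* (N ℕ.* (2 ℕ.* v ℕ.+ 1))
    e₁ = ℕ-solver.solve-∀
    e₂ : ∀ a b c → a ℕ.* b ℕ.* c ≡ a ℕ.* c ℕ.* b
    e₂ = ℕ-solver.solve-∀
    e₃ : ∀ e v → 2 ℕ.* ((1 ℕ.+ e) ℕ.* v) ≡ e ℕ.* (2 ℕ.* v) ℕ.+ 2 ℕ.* v
    e₃ = ℕ-solver.solve-∀

  /-*-ι : ∀ l n → (+ l / suc n) * ι (suc n) ≡ ι l
  /-*-ι l n = trans (cong (+ l / suc n *_) (sym (ι≡/1 (suc n)))) (trans
    (ℚ.toℚᵘ-injective (ℚᵘ.≃-trans (ℚ.toℚᵘ-homo-* (+ l / suc n) (+ suc n / 1))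
      (ℚᵘ.≃-trans (ℚᵘ.*-cong (ℚ.toℚᵘ-fromℚᵘ (+ l ℚᵘ./ suc n)) (ℚ.toℚᵘ-fromℚᵘ (+ suc n ℚᵘ./ 1)))
        (ℚᵘ.≃-trans (ℚᵘ.*≡* (trans (ℤ.*-identityʳ (+ l ℤ.* + suc n))
            (cong (λ z → + l ℤ.* + z) (sym (ℕ.*-identityʳ (suc n))))))
          (ℚᵘ.≃-sym (ℚ.toℚᵘ-fromℚᵘ (+ l ℚᵘ./ 1)))))))
    (ι≡/1 l))

  -- The positive part of the numerator bounds `c` from above, and the reciprocal of the denominator
  -- bounds `e` from below.
  archimedean : ∀ c e → 0ℚ < e → c ≤ ι (num⁺ c ℕ.* ↧ₙ e) * e
  archimedean c e 0<e = begin
      c                               ≤⟨ ≤num⁺ c ⟩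
      + num⁺ c / 1                    ≡⟨ ι≡/1 (num⁺ c) ⟩
      ι (num⁺ c)                      ≡⟨ ℚ.*-identityʳ (ι (num⁺ c)) ⟨
      ι (num⁺ c) * 1ℚ                 ≡⟨ cong (ι (num⁺ c) *_) (trans (ℚ.*-comm (ι (↧ₙ e)) (+ 1 / ↧ₙ e)) (1/↧*ι (↧ₙ e))) ⟨
      ι (num⁺ c) * (ι (↧ₙ e) * (+ 1 / ↧ₙ e))
        ≤⟨ *-monoˡ (0≤ι (num⁺ c)) (*-monoˡ (0≤ι (↧ₙ e)) (1/↧≤ e 0<e)) ⟩
      ι (num⁺ c) * (ι (↧ₙ e) * e)     ≡⟨ ℚ.*-assoc (ι (num⁺ c)) (ι (↧ₙ e)) e ⟨
      ι (num⁺ c) * ι (↧ₙ e) * e       ≡⟨ cong (_* e) (ι-* (num⁺ c) (↧ₙ e)) ⟨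
      ι (num⁺ c ℕ.* ↧ₙ e) * e         ∎
    where
    open ℚ.≤-Reasoning
    1/↧*ι : ∀ n .{{_ : ℕ.NonZero n}} → (+ 1 / n) * ι n ≡ 1ℚ
    1/↧*ι (suc n) = /-*-ι 1 n

  -- Foster's criterion for the meeting of two independent walks

  module Walk (P : ℤ → Step → ℚ)
    (0≤P : ∀ x s → 0ℚ ≤ P x s) (∑P : ∀ x → P x right + P x left ≡ 1ℚ) where

    E : ℤ → (Step → ℚ) → ℚ
    E x h = P x right * h right + P x left * h left

    E-cong : ∀ x {g h} → (∀ s → g s ≡ h s) → E x g ≡ E x h
    E-cong x eq = cong₂ (λ p q → P x right * p + P x left * q) (eq right) (eq left)

    E-mono : ∀ x {g h} → (∀ s → g s ≤ h s) → E x g ≤ E x h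
    E-mono x le = ℚ.+-mono-≤ (*-monoˡ (0≤P x right) (le right)) (*-monoˡ (0≤P x left) (le left))

    E-scale : ∀ x b g → E x (λ s → b * g s) ≡ b * E x g
    E-scale x b g = lemma (P x right) (P x left) b (g right) (g left)
      where
      lemma : ∀ p q b x y → p * (b * x) + q * (b * y) ≡ b * (p * x + q * y)
      lemma = solve-∀ ring

    E-const+ : ∀ x a g → E x (λ s → a + g s) ≡ a + E x g
    E-const+ x a g = trans (lemma (P x right) (P x left) a (g right) (g left))
      (trans (cong (λ z → z * a + E x g) (∑P x)) (cong (_+ E x g) (ℚ.*-identityˡ a)))
      where
      lemma : ∀ p q a b c → p * (a + b) + q * (a + c) ≡ (p + q) * a + (p * b + q * c)
      lemma = solve-∀ ring

    E-+ : ∀ x g h → E x (λ s → g s + h s) ≡ E x g + E x h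
    E-+ x g h = lemma (P x right) (P x left) (g right) (g left) (h right) (h left)
      where
      lemma : ∀ p q a b c d → p * (a + c) + q * (b + d) ≡ (p * a + q * b) + (p * c + q * d)
      lemma = solve-∀ ring

    E² : ℤ → ℤ → (Step → Step → ℚ) → ℚ
    E² x y h = E x λ s → E y (h s)

    E²-mono : ∀ x y {g h} → (∀ s s′ → g s s′ ≤ h s s′) → E² x y g ≤ E² x y h
    E²-mono x y le = E-mono x λ s → E-mono y (le s)

    E²-scale : ∀ x y b g → E² x y (λ s s′ → b * g s s′) ≡ b * E² x y g
    E²-scale x y b g = trans (E-cong x λ s → E-scale y b (g s)) (E-scale x b λ s → E y (g s))

    𝔼 : ∀ {n} → ℤ → (Path n → ℚ) → ℚ
    𝔼 {zero}  x g = g []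
    𝔼 {suc n} x g = E x λ s → 𝔼 (move s x) λ ω → g (s ∷ ω)

    𝔼-cong : ∀ {n} x {g h : Path n → ℚ} → (∀ ω → g ω ≡ h ω) → 𝔼 x g ≡ 𝔼 x h
    𝔼-cong {zero}  x eq = eq []
    𝔼-cong {suc n} x eq = E-cong x λ s → 𝔼-cong (move s x) λ ω → eq (s ∷ ω)

    𝔼-1+ : ∀ {n} x (g : Path n → ℚ) → 𝔼 x (λ ω → 1ℚ + g ω) ≡ 1ℚ + 𝔼 x g
    𝔼-1+ {zero}  x g = refl
    𝔼-1+ {suc n} x g = trans
      (E-cong x λ s → 𝔼-1+ (move s x) λ ω → g (s ∷ ω))
      (E-const+ x 1ℚ λ s → 𝔼 (move s x) λ ω → g (s ∷ ω))

    𝔼-0 : ∀ {n} x → 𝔼 {n} x (λ _ → 0ℚ) ≡ 0ℚ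
    𝔼-0 {zero}  x = refl
    𝔼-0 {suc n} x = trans (E-cong x λ s → 𝔼-0 {n} (move s x))
      (lemma (P x right) (P x left))
      where
      lemma : ∀ p q → p * 0ℚ + q * 0ℚ ≡ 0ℚ
      lemma = solve-∀ ring

    E-swap : ∀ x y (h : Step → Step → ℚ) → E x (λ s → E y (h s)) ≡ E y (λ s′ → E x (λ s → h s s′))
    E-swap x y h = lemma (P x right) (P x left) (P y right) (P y left)
        (h right right) (h right left) (h left right) (h left left)
      where
      lemma : ∀ p q u v a b c d →
        p * (u * a + v * b) + q * (u * c + v * d) ≡ u * (p * a + q * c) + v * (p * b + q * d)
      lemma = solve-∀ ring

    -- In `𝔼min` the average over the whole path of X stands outside the first step of Y. Exchanging
    -- independent averages brings the two first steps together in `𝔼min-suc`.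
    𝔼-E-swap : ∀ {n} x y (h : Step → Path n → ℚ) →
      𝔼 x (λ ω → E y (λ s → h s ω)) ≡ E y (λ s → 𝔼 x (h s))
    𝔼-E-swap {zero}  x y h = refl
    𝔼-E-swap {suc n} x y h = trans
      (E-cong x λ s → 𝔼-E-swap (move s x) y λ s′ ω → h s′ (s ∷ ω))
      (E-swap x y λ s s′ → 𝔼 (move s x) λ ω → h s′ (s ∷ ω))

    module Meeting (d : ℕ) where

      -- The number `j` is half of the remaining gap y + 2d - x. Being natural, it records both that
      -- the gap is even and that X has not passed beyond y + 2d. The walks start at j = d and meet
      -- at j = 0.
      Distance : ℤ → ℤ → ℕ → Set
      Distance x y j = x ℤ.+ + (2 ℕ.* j) ≡ y ℤ.+ + (2 ℕ.* d)

      𝔼min : ℕ → ℤ → ℤ → ℚ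
      𝔼min n x y = 𝔼 {n} x λ ω → 𝔼 {n} y λ ω′ → ι (min𝒯 d x y ω ω′)

      min𝒯-met : ∀ {n} x y (ω ω′ : Path n) → Distance x y 0 → min𝒯 d x y ω ω′ ≡ 0
      min𝒯-met x y ω ω′ met with x ℤ.≟ y ℤ.+ + (2 ℕ.* d)
      min𝒯-met x y []      []        met | yes _ = refl
      min𝒯-met x y (_ ∷ _) (_ ∷ _)   met | yes _ = refl
      ... | no ≢ = contradiction (trans (sym (ℤ.+-identityʳ x)) met) ≢

      min𝒯-∷ : ∀ {n} x y s s′ (ω ω′ : Path n) j → Distance x y (suc j) →
        min𝒯 d x y (s ∷ ω) (s′ ∷ ω′) ≡ suc (min𝒯 d (move s x) (move s′ y) ω ω′)
      min𝒯-∷ x y s s′ ω ω′ j dist with x ℤ.≟ y ℤ.+ + (2 ℕ.* d)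
      ... | no  _  = refl
      ... | yes eq with ∙-cancelˡ ℤ.+-0-abelianGroup x (+ (2 ℕ.* suc j)) (+ 0)
        (trans dist (trans (sym eq) (sym (ℤ.+-identityʳ x))))
      ... | ()

      -- A joint step changes half of the gap by -1, 0 or 1, so that from a positive value it cannot
      -- jump over 0: the walks do not cross without meeting.
      Distance-move : ∀ {x y j} → Distance x y (suc j) → ∀ s s′ →
        ∃[ i ] Distance (move s x) (move s′ y) i
      Distance-move {x} {y} {j} h = steps
        where
        2* : ∀ k → + (2 ℕ.* k) ≡ + 2 ℤ.* + k
        2* = ℤ.pos-* 2
        e₁ : ∀ a b c → a ℤ.+ b ℤ.+ c ≡ a ℤ.+ c ℤ.+ b
        e₁ = ℤ-solver.solve-∀
        e₂ : ∀ a k → a ℤ.+ + 1 ℤ.+ + 2 ℤ.* k ≡ a ℤ.+ + 2 ℤ.* (+ 1 ℤ.+ k) ℤ.+ ℤ.- + 1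
        e₂ = ℤ-solver.solve-∀
        e₃ : ∀ a k → a ℤ.- + 1 ℤ.+ + 2 ℤ.* (+ 2 ℤ.+ k) ≡ a ℤ.+ + 2 ℤ.* (+ 1 ℤ.+ k) ℤ.+ + 1
        e₃ = ℤ-solver.solve-∀
        shift : ∀ x′ c i → x′ ℤ.+ + 2 ℤ.* + i ≡ x ℤ.+ + 2 ℤ.* + suc j ℤ.+ c →
          Distance x′ (y ℤ.+ c) i
        shift x′ c i eq = trans (cong (ℤ._+_ x′) (2* i)) (trans eq
          (trans (cong (λ z → x ℤ.+ z ℤ.+ c) (sym (2* (suc j)))) (trans (cong (ℤ._+ c) h)
            (e₁ y (+ (2 ℕ.* d)) c))))
        steps : ∀ s s′ → ∃[ i ] Distance (move s x) (move s′ y) i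
        steps right right = suc j , shift (move right x) (+ 1) (suc j) (e₁ x (+ 1) (+ 2 ℤ.* + suc j))
        steps left  left  = suc j , shift (move left x) (ℤ.- + 1) (suc j) (e₁ x (ℤ.- + 1) (+ 2 ℤ.* + suc j))
        steps right left  = j , shift (move right x) (ℤ.- + 1) j (e₂ x (+ j))
        steps left  right = suc (suc j) , shift (move left x) (+ 1) (suc (suc j)) (e₃ x (+ j))

      𝔼min-met : ∀ n x y → Distance x y 0 → 𝔼min n x y ≡ 0ℚ
      𝔼min-met n x y met = trans
        (𝔼-cong {n} x λ ω → trans (𝔼-cong {n} y λ ω′ → cong ι (min𝒯-met x y ω ω′ met)) (𝔼-0 {n} y))
        (𝔼-0 {n} x)

      𝔼min-0 : ∀ x y → 𝔼min 0 x y ≡ 0ℚ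
      𝔼min-0 x y with x ℤ.≟ y ℤ.+ + (2 ℕ.* d)
      ... | yes _ = refl
      ... | no  _ = refl

      𝔼min-suc : ∀ n x y j → Distance x y (suc j) →
        𝔼min (suc n) x y ≡ 1ℚ + E² x y (λ s s′ → 𝔼min n (move s x) (move s′ y))
      𝔼min-suc n x y j dist = trans
          (E-cong x λ s → trans
            (𝔼-cong {n} (move s x) λ ω → trans
              (E-cong y λ s′ → trans
                (𝔼-cong {n} (move s′ y) λ ω′ → cong ι (min𝒯-∷ x y s s′ ω ω′ j dist))
                (𝔼-1+ {n} (move s′ y) λ ω′ → ι (min𝒯 d (move s x) (move s′ y) ω ω′)))
              (E-const+ y 1ℚ λ s′ → 𝔼 {n} (move s′ y) λ ω′ → ι (min𝒯 d (move s x) (move s′ y) ω ω′)))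
            (trans (𝔼-1+ {n} (move s x) λ ω → E y λ s′ → 𝔼 {n} (move s′ y) λ ω′ →
                      ι (min𝒯 d (move s x) (move s′ y) ω ω′))
              (cong (_+_ 1ℚ) (𝔼-E-swap {n} (move s x) y λ s′ ω → 𝔼 {n} (move s′ y) λ ω′ →
                      ι (min𝒯 d (move s x) (move s′ y) ω ω′)))))
          (E-const+ x 1ℚ λ s → E y λ s′ → 𝔼min n (move s x) (move s′ y))

      module _ (f : ℤ → ℤ → ℚ) (δ : ℚ) (0≤δ : 0ℚ ≤ δ)
        (0≤f : ∀ x y j → Distance x y j → 0ℚ ≤ f x y)
        (drift : ∀ x y j → Distance x y (suc j) →
          E² x y (λ s s′ → f (move s x) (move s′ y)) + δ ≤ f x y) where

        -- Induction on the horizon `n`. Before the meeting one step adds 1 to the truncated time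
        -- and lowers the mean of `f` by at least `δ`. At the meeting and at horizon 0 the left-hand
        -- side vanishes and `f ≥ 0` suffices.
        foster : ∀ n x y j → Distance x y j → δ * 𝔼min n x y ≤ f x y
        foster n x y zero dist = subst (_≤ f x y)
          (sym (trans (cong (δ *_) (𝔼min-met n x y dist)) (ℚ.*-zeroʳ δ))) (0≤f x y 0 dist)
        foster zero x y j@(suc _) dist = subst (_≤ f x y)
          (sym (trans (cong (δ *_) (𝔼min-0 x y)) (ℚ.*-zeroʳ δ))) (0≤f x y j dist)
        foster (suc n) x y (suc j) dist = begin
            δ * 𝔼min (suc n) x y
              ≡⟨ cong (δ *_) (𝔼min-suc n x y j dist) ⟩
            δ * (1ℚ + E² x y m)
              ≡⟨ lemma δ (E² x y m) ⟩
            δ * E² x y m + δ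
              ≡⟨ cong (_+ δ) (E²-scale x y δ m) ⟨
            E² x y (λ s s′ → δ * m s s′) + δ
              ≤⟨ ℚ.+-monoˡ-≤ δ (E²-mono x y λ s s′ → step s s′ (Distance-move {j = j} dist s s′)) ⟩
            E² x y (λ s s′ → f (move s x) (move s′ y)) + δ
              ≤⟨ drift x y j dist ⟩
            f x y ∎
          where
          open ℚ.≤-Reasoning
          m : Step → Step → ℚ
          m s s′ = 𝔼min n (move s x) (move s′ y)
          step : ∀ s s′ → ∃[ i ] Distance (move s x) (move s′ y) i →
            δ * m s s′ ≤ f (move s x) (move s′ y)
          step s s′ (i , dist′) = foster n (move s x) (move s′ y) i dist′
          lemma : ∀ δ e → δ * (1ℚ + e) ≡ δ * e + δ
          lemma = solve-∀ ring

  -- Finite sums over paths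

  ∑ℚ : ∀ {n} → (Path n → ℚ) → ℚ
  ∑ℚ {zero}  f = f []
  ∑ℚ {suc n} f = ∑ℚ (λ ω → f (right ∷ ω)) + ∑ℚ (λ ω → f (left ∷ ω))

  seq-∑ : ∀ {n} (f : Path n → ℝ) m → seq (∑ f) m ≡ ∑ℚ (λ ω → seq (f ω) m)
  seq-∑ {zero}  f m = refl
  seq-∑ {suc n} f m = cong₂ _+_ (seq-∑ (λ ω → f (right ∷ ω)) m) (seq-∑ (λ ω → f (left ∷ ω)) m)

  ∑ℚ-cong : ∀ {n} {f g : Path n → ℚ} → (∀ ω → f ω ≡ g ω) → ∑ℚ f ≡ ∑ℚ g
  ∑ℚ-cong {zero}  eq = eq []
  ∑ℚ-cong {suc n} eq = cong₂ _+_ (∑ℚ-cong (λ ω → eq (right ∷ ω))) (∑ℚ-cong (λ ω → eq (left ∷ ω)))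

  ∑ℚ-scale : ∀ {n} c (f : Path n → ℚ) → ∑ℚ (λ ω → c * f ω) ≡ c * ∑ℚ f
  ∑ℚ-scale {zero}  c f = refl
  ∑ℚ-scale {suc n} c f = trans
    (cong₂ _+_ (∑ℚ-scale c (λ ω → f (right ∷ ω))) (∑ℚ-scale c (λ ω → f (left ∷ ω))))
    (sym (ℚ.*-distribˡ-+ c (∑ℚ (λ ω → f (right ∷ ω))) (∑ℚ (λ ω → f (left ∷ ω)))))

  -- The walk and its Lyapunov function

  w : ℕ → ℚ
  w k = ½ * (ι k * ι (suc k))

  w-suc : ∀ k → w (suc k) ≡ w k + ι (suc k)
  w-suc k = lemma (ι k)
    where
    lemma : ∀ k → ½ * ((1ℚ + k) * (1ℚ + (1ℚ + k))) ≡ ½ * (k * (1ℚ + k)) + (1ℚ + k)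
    lemma = solve-∀ ring

  0≤w : ∀ k → 0ℚ ≤ w k
  0≤w k = 0≤* (ℚ.nonNegative⁻¹ ½) (0≤* (0≤ι k) (0≤ι (suc k)))

  w-mono : ∀ {k l} → k ℕ.≤ l → w k ≤ w l
  w-mono {k} {l} k≤l = *-monoˡ (ℚ.nonNegative⁻¹ ½) (ℚ.≤-trans
    (*-monoˡ (0≤ι k) (ι-mono (ℕ.s≤s k≤l))) (*-monoʳ (0≤ι (suc l)) (ι-mono k≤l)))

  -- The increments of `w` below `k` are at most `k`, and at most `n` of them lie between `l` and
  -- `k`.
  w-lipschitz : ∀ k l n → k ℕ.≤ n ℕ.+ l → w k ≤ w l + ι n * ι k
  w-lipschitz k l zero k≤l = ℚ.≤-trans (w-mono k≤l) (≤-by 0ℚ ℚ.≤-refl (lemma (w l) (ι k)))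
    where
    lemma : ∀ a b → a + 0ℚ * b ≡ a + 0ℚ
    lemma = solve-∀ ring
  w-lipschitz zero    l (suc n) _ = ≤-by (w l) (0≤w l) (lemma (w l) (ι (suc n)))
    where
    lemma : ∀ a b → a + b * 0ℚ ≡ ½ * (0ℚ * 1ℚ) + a
    lemma = solve-∀ ring
  w-lipschitz (suc k) l (suc n) (ℕ.s≤s k≤) = begin
      w (suc k)                           ≡⟨ w-suc k ⟩
      w k + ι (suc k)                     ≤⟨ ℚ.+-monoˡ-≤ (ι (suc k)) (w-lipschitz k l n k≤) ⟩
      w l + ι n * ι k + ι (suc k)         ≤⟨ ≤-by (ι n) (0≤ι n) (lemma (w l) (ι n) (ι k)) ⟩
      w l + ι (suc n) * ι (suc k)         ∎
    where
    open ℚ.≤-Reasoning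
    lemma : ∀ w n k → w + (1ℚ + n) * (1ℚ + k) ≡ w + n * k + (1ℚ + k) + n
    lemma = solve-∀ ring

  -- A convex function, quadratic and then linear

  module Huber (L : ℚ) (0≤L : 0ℚ ≤ L) where

    clamp : ℚ → ℚ
    clamp t = 0ℚ ⊔ (t ⊓ L)

    0≤clamp : ∀ t → 0ℚ ≤ clamp t
    0≤clamp t = ℚ.p≤p⊔q 0ℚ (t ⊓ L)

    clamp≤ : ∀ t → clamp t ≤ L
    clamp≤ t = ℚ.⊔-lub 0≤L (ℚ.p⊓q≤q t L)

    -- The variational inequality that characterises `clamp t` as the point of the interval from 0
    -- to `L` nearest to `t`.
    clamp-projection : ∀ t {h} → 0ℚ ≤ h → h ≤ L → 0ℚ ≤ (clamp t - h) * (t - clamp t)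
    clamp-projection t {h} 0≤h h≤L with ℚ.≤-total L t
    ... | inj₁ L≤t rewrite ℚ.p≥q⇒p⊓q≡q L≤t | ℚ.p≤q⇒p⊔q≡q 0≤L = 0≤* (≤⇒0≤- h≤L) (≤⇒0≤- L≤t)
    ... | inj₂ t≤L rewrite ℚ.p≤q⇒p⊓q≡p t≤L with ℚ.≤-total 0ℚ t
    ...   | inj₁ 0≤t rewrite ℚ.p≤q⇒p⊔q≡q 0≤t = ℚ.≤-reflexive (lemma t h)
      where
      lemma : ∀ t h → 0ℚ ≡ (t - h) * (t - t)
      lemma = solve-∀ ring
    ...   | inj₂ t≤0 rewrite ℚ.p≥q⇒p⊔q≡p t≤0 = ≤-by (h * (0ℚ - t)) (0≤* 0≤h (≤⇒0≤- t≤0)) (lemma t h)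
      where
      lemma : ∀ t h → (0ℚ - h) * (t - 0ℚ) ≡ 0ℚ + h * (0ℚ - t)
      lemma = solve-∀ ring

    tangent : ℚ → ℚ → ℚ
    tangent h t = h * t + h * t - h * h

    -- This is max { 2ht − h² : 0 ≤ h ≤ L }, a convex function equal to 0, t² and 2Lt − L²
    -- for t ≤ 0, 0 ≤ t ≤ L and t ≥ L respectively.
    Φ : ℚ → ℚ
    Φ t = tangent (clamp t) t

    -- `tangent h t` is t² - (t - h)², hence largest at the admissible `h` nearest to `t`. Since it
    -- is affine in `t`, this is the form in which the convexity of `Φ` is used.
    tangent≤Φ : ∀ t {h} → 0ℚ ≤ h → h ≤ L → tangent h t ≤ Φ t
    tangent≤Φ t {h} 0≤h h≤L = ≤-by
        ((c - h) * (c - h) + ((c - h) * (t - c) + (c - h) * (t - c)))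
        (0≤+ (0≤p² (c - h)) (0≤+ p p)) (lemma t h c)
      where
      c = clamp t
      p = clamp-projection t 0≤h h≤L
      lemma : ∀ t h c → c * t + c * t - c * c
        ≡ h * t + h * t - h * h + ((c - h) * (c - h) + ((c - h) * (t - c) + (c - h) * (t - c)))
      lemma = solve-∀ ring

    0≤Φ : ∀ t → 0ℚ ≤ Φ t
    0≤Φ t = ℚ.≤-trans (ℚ.≤-reflexive (lemma t)) (tangent≤Φ t ℚ.≤-refl 0≤L)
      where
      lemma : ∀ t → 0ℚ ≡ 0ℚ * t + 0ℚ * t - 0ℚ * 0ℚ
      lemma = solve-∀ ring

    Φ≤t² : ∀ t → Φ t ≤ t * t
    Φ≤t² t = ≤-by ((t - c) * (t - c)) (0≤p² (t - c)) (lemma t c)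
      where
      c = clamp t
      lemma : ∀ t c → t * t ≡ c * t + c * t - c * c + (t - c) * (t - c)
      lemma = solve-∀ ring

    t²≤Φ : ∀ t → 0ℚ ≤ t → t ≤ L → t * t ≤ Φ t
    t²≤Φ t 0≤t t≤L = ℚ.≤-trans (ℚ.≤-reflexive (lemma t)) (tangent≤Φ t 0≤t t≤L)
      where
      lemma : ∀ t → t * t ≡ t * t + t * t - t * t
      lemma = solve-∀ ring

    Φ≤linear : ∀ {t B} → 0ℚ ≤ B → t ≤ B → Φ t ≤ L * B + L * B
    Φ≤linear {t} {B} 0≤B t≤B = ≤-by (((L - c) * B + (L - c) * B) + (c * (B - t) + c * (B - t)) + c * c)
        (0≤+ (0≤+ (0≤+ p p) (0≤+ q q)) (0≤p² c)) (lemma L t c B)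
      where
      c = clamp t
      p = 0≤* (≤⇒0≤- (clamp≤ t)) 0≤B
      q = 0≤* (0≤clamp t) (≤⇒0≤- t≤B)
      lemma : ∀ L t c B → L * B + L * B ≡ c * t + c * t - c * c
        + (((L - c) * B + (L - c) * B) + (c * (B - t) + c * (B - t)) + c * c)
      lemma = solve-∀ ring

  signed : (ℕ → ℚ) → (ℕ → ℚ) → ℤ → ℚ
  signed g h (+ k)    = g k
  signed g h -[1+ i ] = h (suc i)

  -- The chain and the growth of σ

  module Chain (κ : ℚ) (0<κ : 0ℚ < κ) (5κ≤1 : + 5 / 1 * κ ≤ 1ℚ) where

    0≤κ : 0ℚ ≤ κ
    0≤κ = ℚ.<⇒≤ 0<κ

    0≤1-5κ : 0ℚ ≤ 1ℚ - + 5 / 1 * κ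
    0≤1-5κ = ≤⇒0≤- 5κ≤1

    0<2k+1 : ∀ k → 0ℚ < 1ℚ + (ι k + ι k)
    0<2k+1 k = 0<1+ (0≤+ (0≤ι k) (0≤ι k))

    0<k-κ : ∀ i → 0ℚ < ι (suc i) - κ
    0<k-κ i = subst (0ℚ <_) (lemma (ι i) κ)
      (ℚ.+-mono-<-≤ (0<* (ℚ.positive⁻¹ (+ 4 / 1)) 0<κ) (0≤+ (0≤ι i) 0≤1-5κ))
      where
      lemma : ∀ i κ → + 4 / 1 * κ + (i + (1ℚ - + 5 / 1 * κ)) ≡ 1ℚ + i - κ
      lemma = solve-∀ ring

    0<m : ∀ i → 0ℚ < (ι (suc i) - κ) * ι (suc (suc i))
    0<m i = 0<* (0<k-κ i) (0<1+ (0≤ι (suc i)))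

    α : ℕ → ℚ
    α zero    = ½
    α (suc i) = (ι (suc i) - κ) * inv (1ℚ + (ι (suc i) + ι (suc i))) (0<2k+1 (suc i))

    -- The recursion is α_k r_k = (1 - α_k) r_(k-1) for r_k = (k + 1) σ_k, the equation for the
    -- increments of a harmonic function. The factor from σ_(k-1) to σ_k is about 1 + 2κ/k, so that
    -- σ_k grows like k^(2κ).
    σ : ℕ → ℚ
    σ zero    = 1ℚ
    σ (suc i) = σ i * ((ι (suc (suc i)) + κ) * ι (suc i))
              * inv ((ι (suc i) - κ) * ι (suc (suc i))) (0<m i)

    1-α : ∀ i → 1ℚ - α (suc i)
              ≡ (ι (suc (suc i)) + κ) * inv (1ℚ + (ι (suc i) + ι (suc i))) (0<2k+1 (suc i))
    1-α i = trans (cong (_- α (suc i)) (sym (*-inv _ (0<2k+1 (suc i))))) (lemma (ι (suc i)) κ _)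
      where
      lemma : ∀ k κ v → (1ℚ + (k + k)) * v - (k - κ) * v ≡ (1ℚ + k + κ) * v
      lemma = solve-∀ ring

    0≤α : ∀ k → 0ℚ ≤ α k
    0≤α zero    = ℚ.nonNegative⁻¹ ½
    0≤α (suc i) = 0≤* (ℚ.<⇒≤ (0<k-κ i)) (ℚ.<⇒≤ (0<inv _ (0<2k+1 (suc i))))

    0≤1-α : ∀ k → 0ℚ ≤ 1ℚ - α k
    0≤1-α zero    = ℚ.nonNegative⁻¹ ½
    0≤1-α (suc i) = subst (0ℚ ≤_) (sym (1-α i))
      (0≤* (0≤+ (0≤ι (suc (suc i))) 0≤κ) (ℚ.<⇒≤ (0<inv _ (0<2k+1 (suc i)))))

    σ-rec : ∀ i → (ι (suc i) - κ) * ι (suc (suc i)) * σ (suc i) ≡ (ι (suc (suc i)) + κ) * ι (suc i) * σ i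
    σ-rec i = trans (lemma ((ι (suc i) - κ) * ι (suc (suc i))) (σ i) ((ι (suc (suc i)) + κ) * ι (suc i)) _)
      (trans (cong ((ι (suc (suc i)) + κ) * ι (suc i) * σ i *_) (*-inv _ (0<m i))) (ℚ.*-identityʳ _))
      where
      lemma : ∀ m s n v → m * (s * n * v) ≡ n * s * (m * v)
      lemma = solve-∀ ring

    0<σ : ∀ k → 0ℚ < σ k
    0<σ zero    = ℚ.positive⁻¹ 1ℚ
    0<σ (suc i) = 0<* (0<* (0<σ i) (0<* (ℚ.+-mono-<-≤ (0<1+ (0≤ι (suc i))) 0≤κ) (0<1+ (0≤ι i))))
                      (0<inv _ (0<m i))

    0≤σ : ∀ k → 0ℚ ≤ σ k
    0≤σ k = ℚ.<⇒≤ (0<σ k)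

    σ-step : ∀ i → σ i ≤ σ (suc i)
    σ-step i = *-cancelˡ (0<m i) (≤-by (κ * (1ℚ + (k + k)) * σ i)
        (0≤* (0≤* 0≤κ (ℚ.<⇒≤ (0<2k+1 (suc i)))) (0≤σ i))
        (trans (σ-rec i) (lemma k κ (σ i))))
      where
      k = ι (suc i)
      lemma : ∀ k κ s → (1ℚ + k + κ) * k * s ≡ (k - κ) * (1ℚ + k) * s + κ * (1ℚ + (k + k)) * s
      lemma = solve-∀ ring

    σ-mono : ∀ {k l} → k ℕ.≤ l → σ k ≤ σ l
    σ-mono h = go (ℕ.≤⇒≤′ h)
      where
      go : ∀ {k l} → k ℕ.≤′ l → σ k ≤ σ l
      go ℕ.≤′-refl = ℚ.≤-refl
      go {l = suc l} (ℕ.≤′-step h) = ℚ.≤-trans (go h) (σ-step l)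

    -- The quotient σ_k / (k + 1) does not increase, because growth like k^(2κ) is sublinear. After
    -- multiplication by `m` the difference of the two sides is `t`, which is nonnegative by 5κ ≤ 1.
    σ-concave-step : ∀ i → ι (suc i) * σ (suc i) ≤ ι (suc (suc i)) * σ i
    σ-concave-step i = *-cancelˡ (0<m i) (≤-by t 0≤t (sym (trans (cong (_+ t) (trans
        (lemma₀ m (ι (suc i)) (σ (suc i))) (cong (ι (suc i) *_) (σ-rec i)))) (lemma₁ (ι i) κ (σ i)))))
      where
      m = (ι (suc i) - κ) * ι (suc (suc i))
      t = (((1ℚ + ι i) * (1ℚ + (1ℚ + ι i))) * (1ℚ - + 5 / 1 * κ)
            + κ * (+ 5 / 1 + (+ 9 / 1 * ι i + + 3 / 1 * (ι i * ι i)))) * σ i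
      0≤t : 0ℚ ≤ t
      0≤t = 0≤* (0≤+ (0≤* (0≤* (0≤ι (suc i)) (0≤ι (suc (suc i)))) 0≤1-5κ)
        (0≤* 0≤κ (0≤+ (ℚ.nonNegative⁻¹ (+ 5 / 1)) (0≤+ (0≤* (ℚ.nonNegative⁻¹ (+ 9 / 1)) (0≤ι i))
          (0≤* (ℚ.nonNegative⁻¹ (+ 3 / 1)) (0≤p² (ι i))))))) (0≤σ i)
      lemma₀ : ∀ m k s → m * (k * s) ≡ k * (m * s)
      lemma₀ = solve-∀ ring
      lemma₁ : ∀ i κ s →
        (1ℚ + i) * ((1ℚ + (1ℚ + i) + κ) * (1ℚ + i) * s)
          + (((1ℚ + i) * (1ℚ + (1ℚ + i))) * (1ℚ - + 5 / 1 * κ)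
            + κ * (+ 5 / 1 + (+ 9 / 1 * i + + 3 / 1 * (i * i)))) * s
        ≡ (1ℚ + i - κ) * (1ℚ + (1ℚ + i)) * ((1ℚ + (1ℚ + i)) * s)
      lemma₁ = solve-∀ ring

    σ-concave : ∀ {k l} → k ℕ.≤ l → ι (suc k) * σ l ≤ ι (suc l) * σ k
    σ-concave h = go (ℕ.≤⇒≤′ h)
      where
      go : ∀ {k l} → k ℕ.≤′ l → ι (suc k) * σ l ≤ ι (suc l) * σ k
      go ℕ.≤′-refl = ℚ.≤-refl
      go {k} {suc l} (ℕ.≤′-step h) = *-cancelˡ (0<1+ (0≤ι l)) (begin
          ι (suc l) * (ι (suc k) * σ (suc l))       ≡⟨ swap (ι (suc l)) (ι (suc k)) (σ (suc l)) ⟩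
          ι (suc k) * (ι (suc l) * σ (suc l))       ≤⟨ *-monoˡ (0≤ι (suc k)) (σ-concave-step l) ⟩
          ι (suc k) * (ι (suc (suc l)) * σ l)       ≡⟨ swap (ι (suc k)) (ι (suc (suc l))) (σ l) ⟩
          ι (suc (suc l)) * (ι (suc k) * σ l)       ≤⟨ *-monoˡ (0≤ι (suc (suc l))) (go h) ⟩
          ι (suc (suc l)) * (ι (suc l) * σ k)       ≡⟨ swap (ι (suc (suc l))) (ι (suc l)) (σ k) ⟩
          ι (suc l) * (ι (suc (suc l)) * σ k)       ∎)
        where
        open ℚ.≤-Reasoning
        swap : ∀ a b c → a * (b * c) ≡ b * (a * c)
        swap = solve-∀ ring

    σ-growth-step : ∀ i → (+ 2 / 1 * κ) * σ i ≤ ι (suc (suc i)) * (σ (suc i) - σ i)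
    σ-growth-step i = *-cancelˡ (0<k-κ i) (≤-by t 0≤t (trans (lemma₀ k κ (σ i) (σ (suc i)))
        (trans (cong (_- (k - κ) * (1ℚ + k) * σ i) (σ-rec i)) (lemma₁ k κ (σ i)))))
      where
      k = ι (suc i)
      t = κ * (1ℚ + (κ + κ)) * σ i
      0≤t : 0ℚ ≤ t
      0≤t = 0≤* (0≤* 0≤κ (0≤+ (ℚ.nonNegative⁻¹ 1ℚ) (0≤+ 0≤κ 0≤κ))) (0≤σ i)
      lemma₀ : ∀ k κ s s′ → (k - κ) * ((1ℚ + k) * (s′ - s)) ≡ (k - κ) * (1ℚ + k) * s′ - (k - κ) * (1ℚ + k) * s
      lemma₀ = solve-∀ ring
      lemma₁ : ∀ k κ s → (1ℚ + k + κ) * k * s - (k - κ) * (1ℚ + k) * s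
        ≡ (k - κ) * (+ 2 / 1 * κ * s) + κ * (1ℚ + (κ + κ)) * s
      lemma₁ = solve-∀ ring

    -- `σ-growth-step` is summed from `R` on: the divisors i + 2 stay at most 2R + 1 while n ≤ R,
    -- and σ_i ≥ σ_R.
    σ-growth : ∀ R n → n ℕ.≤ R →
      ι n * ((+ 2 / 1 * κ) * σ R) ≤ ι (suc (R ℕ.+ R)) * (σ (n ℕ.+ R) - σ R)
    σ-growth R zero    _   = ≤-by 0ℚ ℚ.≤-refl (lemma (ι (suc (R ℕ.+ R))) (σ R) (+ 2 / 1 * κ * σ R))
      where
      lemma : ∀ a s b → a * (s - s) ≡ 0ℚ * b + 0ℚ
      lemma = solve-∀ ring
    σ-growth R (suc n) n<R = begin
        ι (suc n) * (2κ * σ R)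
          ≡⟨ lemma₁ (ι n) (2κ * σ R) ⟩
        2κ * σ R + ι n * (2κ * σ R)
          ≤⟨ ℚ.+-mono-≤ (*-monoˡ (0≤* (ℚ.nonNegative⁻¹ (+ 2 / 1)) 0≤κ) (σ-mono (ℕ.m≤n+m R n)))
                        (σ-growth R n (ℕ.<⇒≤ n<R)) ⟩
        2κ * σ (n ℕ.+ R) + M * (σ (n ℕ.+ R) - σ R)
          ≤⟨ ℚ.+-monoˡ-≤ _ (σ-growth-step (n ℕ.+ R)) ⟩
        ι (suc (suc n ℕ.+ R)) * (σ (suc n ℕ.+ R) - σ (n ℕ.+ R)) + M * (σ (n ℕ.+ R) - σ R)
          ≤⟨ ℚ.+-monoˡ-≤ _ (*-monoʳ (≤⇒0≤- (σ-step (n ℕ.+ R))) (ι-mono (ℕ.s≤s (ℕ.+-monoˡ-≤ R n<R)))) ⟩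
        M * (σ (suc n ℕ.+ R) - σ (n ℕ.+ R)) + M * (σ (n ℕ.+ R) - σ R)
          ≡⟨ lemma₂ M (σ (suc n ℕ.+ R)) (σ (n ℕ.+ R)) (σ R) ⟩
        M * (σ (suc n ℕ.+ R) - σ R) ∎
      where
      open ℚ.≤-Reasoning
      2κ = + 2 / 1 * κ
      M = ι (suc (R ℕ.+ R))
      lemma₁ : ∀ n b → (1ℚ + n) * b ≡ b + n * b
      lemma₁ = solve-∀ ring
      lemma₂ : ∀ M a b c → M * (a - b) + M * (b - c) ≡ M * (a - c)
      lemma₂ = solve-∀ ring

    -- The case n = R of `σ-growth`. The fixed factor gained between the scales R and 2R leaves room
    -- for a coefficient `ρ` smaller than 1 in `pain`.
    σ-double : ∀ R .{{_ : ℕ.NonZero R}} → (1ℚ + ½ * κ) * σ R ≤ σ (R ℕ.+ R)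
    σ-double R@(suc R-1) = *-cancelˡ (0<1+ (0≤ι (R ℕ.+ R))) (≤-by t 0≤t eq)
      where
      t = (ι (suc (R ℕ.+ R)) * (σ (R ℕ.+ R) - σ R) - ι R * ((+ 2 / 1 * κ) * σ R))
        + ½ * κ * σ R * (1ℚ + (ι R-1 + ι R-1))
      0≤t : 0ℚ ≤ t
      0≤t = 0≤+ (≤⇒0≤- (σ-growth R R ℕ.≤-refl))
        (0≤* (0≤* (0≤* (ℚ.nonNegative⁻¹ ½) 0≤κ) (0≤σ R)) (ℚ.<⇒≤ (0<2k+1 R-1)))
      lemma : ∀ i κ s s′ → (1ℚ + ((1ℚ + i) + (1ℚ + i))) * s′
        ≡ (1ℚ + ((1ℚ + i) + (1ℚ + i))) * ((1ℚ + ½ * κ) * s)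
          + (((1ℚ + ((1ℚ + i) + (1ℚ + i))) * (s′ - s) - (1ℚ + i) * ((+ 2 / 1 * κ) * s))
            + ½ * κ * s * (1ℚ + (i + i)))
      lemma = solve-∀ ring
      eq : ι (suc (R ℕ.+ R)) * σ (R ℕ.+ R) ≡ ι (suc (R ℕ.+ R)) * ((1ℚ + ½ * κ) * σ R) + t
      eq = subst (λ z → (1ℚ + z) * σ (R ℕ.+ R) ≡ (1ℚ + z) * ((1ℚ + ½ * κ) * σ R)
          + (((1ℚ + z) * (σ (R ℕ.+ R) - σ R) - ι R * ((+ 2 / 1 * κ) * σ R))
            + ½ * κ * σ R * (1ℚ + (ι R-1 + ι R-1))))
        (sym (ι-+ R R)) (lemma (ι R-1) κ (σ R) (σ (R ℕ.+ R)))

    -- The harmonic function S and its truncations H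

    r : ℕ → ℚ
    r k = ι (suc k) * σ k

    0≤r : ∀ k → 0ℚ ≤ r k
    0≤r k = 0≤* (0≤ι (suc k)) (0≤σ k)

    S : ℕ → ℚ
    S zero    = 0ℚ
    S (suc k) = S k + r k

    H : ℚ → ℕ → ℚ
    H c zero    = 0ℚ
    H c (suc k) = H c k + ι (suc k) * (σ k ⊓ c)

    0≤S : ∀ k → 0ℚ ≤ S k
    0≤S zero    = ℚ.≤-refl
    0≤S (suc k) = 0≤+ (0≤S k) (0≤r k)

    S-mono : ∀ {k l} → k ℕ.≤ l → S k ≤ S l
    S-mono h = go (ℕ.≤⇒≤′ h)
      where
      go : ∀ {k l} → k ℕ.≤′ l → S k ≤ S l
      go ℕ.≤′-refl = ℚ.≤-refl
      go {l = suc l} (ℕ.≤′-step h) = ℚ.≤-trans (go h) (≤-by (r l) (0≤r l) refl)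

    S≤ : ∀ {R k} → k ℕ.≤ suc R → S k ≤ σ R * w k
    S≤ {R} {zero}  _ = ≤-by 0ℚ ℚ.≤-refl (lemma (σ R))
      where
      lemma : ∀ s → s * (½ * (0ℚ * 1ℚ)) ≡ 0ℚ + 0ℚ
      lemma = solve-∀ ring
    S≤ {R} {suc k} (ℕ.s≤s k≤R) = begin
      S k + ι (suc k) * σ k         ≤⟨ ℚ.+-mono-≤ (S≤ (ℕ.m≤n⇒m≤1+n k≤R)) (*-monoˡ (0≤ι (suc k)) (σ-mono k≤R)) ⟩
      σ R * w k + ι (suc k) * σ R   ≡⟨ lemma (σ R) (w k) (ι (suc k)) ⟩
      σ R * (w k + ι (suc k))       ≡⟨ cong (σ R *_) (w-suc k) ⟨
      σ R * w (suc k)               ∎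
      where
      open ℚ.≤-Reasoning
      lemma : ∀ s w k → s * w + k * s ≡ s * (w + k)
      lemma = solve-∀ ring

    -- The increments of `S` up to m = n + k have the form (i + 1) σ_i with i < m, and so are at
    -- most m σ_m.
    S-diff : ∀ n k → S (n ℕ.+ k) ≤ S k + ι n * (ι (n ℕ.+ k) * σ (n ℕ.+ k))
    S-diff zero    k = ≤-by 0ℚ ℚ.≤-refl (lemma (S k) (ι k * σ k))
      where
      lemma : ∀ a b → a + 0ℚ * b ≡ a + 0ℚ
      lemma = solve-∀ ring
    S-diff (suc n) k = begin
        S m + ι (suc m) * σ m
          ≤⟨ ℚ.+-mono-≤ (S-diff n k) (*-monoˡ (0≤ι (suc m)) (σ-step m)) ⟩
        S k + ι n * (ι m * σ m) + ι (suc m) * σ (suc m)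
          ≤⟨ ℚ.+-monoˡ-≤ _ (ℚ.+-monoʳ-≤ (S k) (*-monoˡ (0≤ι n) (ℚ.≤-trans
               (*-monoˡ (0≤ι m) (σ-step m)) (*-monoʳ (0≤σ (suc m)) (ι-mono (ℕ.n≤1+n m)))))) ⟩
        S k + ι n * (ι (suc m) * σ (suc m)) + ι (suc m) * σ (suc m)
          ≡⟨ lemma (S k) (ι n) (ι (suc m) * σ (suc m)) ⟩
        S k + ι (suc n) * (ι (suc m) * σ (suc m)) ∎
      where
      open ℚ.≤-Reasoning
      m = n ℕ.+ k
      lemma : ∀ s n b → s + n * b + b ≡ s + (1ℚ + n) * b
      lemma = solve-∀ ring

    module _ {c : ℚ} (0≤c : 0ℚ ≤ c) where

      0≤H : ∀ k → 0ℚ ≤ H c k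
      0≤H zero    = ℚ.≤-refl
      0≤H (suc k) = 0≤+ (0≤H k) (0≤* (0≤ι (suc k)) (ℚ.⊓-glb (0≤σ k) 0≤c))

      H≤ : ∀ k → H c k ≤ c * w k
      H≤ zero    = 0≤* 0≤c (0≤w 0)
      H≤ (suc k) = begin
        H c k + ι (suc k) * (σ k ⊓ c)   ≤⟨ ℚ.+-mono-≤ (H≤ k) (*-monoˡ (0≤ι (suc k)) (ℚ.p⊓q≤q (σ k) c)) ⟩
        c * w k + ι (suc k) * c         ≡⟨ lemma c (w k) (ι (suc k)) ⟩
        c * (w k + ι (suc k))           ≡⟨ cong (c *_) (w-suc k) ⟨
        c * w (suc k)                   ∎
        where
        open ℚ.≤-Reasoning
        lemma : ∀ s w k → s * w + k * s ≡ s * (w + k)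
        lemma = solve-∀ ring

    -- Beyond `R` the increments of `H (σ R)` are those of `σ R * w`, and at `R` the function is
    -- nonnegative.
    H≥ : ∀ R k → σ R * (w k - w R) ≤ H (σ R) k
    H≥ R k with k ℕ.≤? R
    ... | yes k≤R = ℚ.≤-trans (≤-by (σ R * (w R - w k)) (0≤* (0≤σ R) (≤⇒0≤- (w-mono k≤R)))
        (lemma (σ R) (w k) (w R))) (0≤H (0≤σ R) k)
      where
      lemma : ∀ s a b → 0ℚ ≡ s * (a - b) + s * (b - a)
      lemma = solve-∀ ring
    H≥ R zero    | no ≰ with () ← ≰ ℕ.z≤n
    H≥ R (suc k) | no ≰ = begin
      σ R * (w (suc k) - w R)                 ≡⟨ cong (λ z → σ R * (z - w R)) (w-suc k) ⟩
      σ R * (w k + ι (suc k) - w R)           ≡⟨ lemma (σ R) (w k) (ι (suc k)) (w R) ⟩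
      σ R * (w k - w R) + ι (suc k) * σ R     ≤⟨ ℚ.+-monoˡ-≤ _ (H≥ R k) ⟩
      H (σ R) k + ι (suc k) * σ R             ≡⟨ cong (λ z → H (σ R) k + ι (suc k) * z) (ℚ.p≥q⇒p⊓q≡q (σ-mono (ℕ.s≤s⁻¹ (ℕ.≰⇒> ≰)))) ⟨
      H (σ R) (suc k)                         ∎
      where
      open ℚ.≤-Reasoning
      lemma : ∀ s a k b → s * (a + k - b) ≡ s * (a - b) + k * s
      lemma = solve-∀ ring

    -- One-step drifts

    drift : (ℕ → ℚ) → ℕ → ℚ
    drift g i = α (suc i) * g (suc (suc i)) + (1ℚ - α (suc i)) * g i

    -- The hypothesis is the drift at k = i + 1 multiplied by 2k + 1. It combines the forward and
    -- the backward increment of `g` without any inverse, which makes it a matter for the ring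
    -- solver.
    drift-≡ : ∀ g i c →
      (ι (suc i) - κ) * (g (suc (suc i)) - g (suc i)) - (ι (suc (suc i)) + κ) * (g (suc i) - g i)
        ≡ (1ℚ + (ι (suc i) + ι (suc i))) * c →
      drift g i ≡ g (suc i) + c
    drift-≡ g i c eq = begin
        α (suc i) * g₂ + (1ℚ - α (suc i)) * g₀       ≡⟨ lemma₁ (α (suc i)) g₂ g₁ g₀ ⟩
        g₁ + (α (suc i) * (g₂ - g₁) - (1ℚ - α (suc i)) * (g₁ - g₀))
          ≡⟨ cong (λ z → g₁ + (α (suc i) * (g₂ - g₁) - z * (g₁ - g₀))) (1-α i) ⟩
        g₁ + ((k - κ) * v * (g₂ - g₁) - (1ℚ + k + κ) * v * (g₁ - g₀))
          ≡⟨ lemma₂ g₁ (k - κ) v (g₂ - g₁) (1ℚ + k + κ) (g₁ - g₀) ⟩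
        g₁ + ((k - κ) * (g₂ - g₁) - (1ℚ + k + κ) * (g₁ - g₀)) * v
          ≡⟨ cong (λ z → g₁ + z * v) eq ⟩
        g₁ + q * c * v                               ≡⟨ lemma₃ g₁ q c v ⟩
        g₁ + q * v * c                               ≡⟨ cong (λ z → g₁ + z * c) (*-inv q (0<2k+1 (suc i))) ⟩
        g₁ + 1ℚ * c                                  ≡⟨ cong (_+_ g₁) (ℚ.*-identityˡ c) ⟩
        g₁ + c                                       ∎
      where
      open ≡-Reasoning
      g₀ = g i
      g₁ = g (suc i)
      g₂ = g (suc (suc i))
      k = ι (suc i)
      q = 1ℚ + (k + k)
      v = inv q (0<2k+1 (suc i))
      lemma₁ : ∀ a g₂ g₁ g₀ → a * g₂ + (1ℚ - a) * g₀ ≡ g₁ + (a * (g₂ - g₁) - (1ℚ - a) * (g₁ - g₀))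
      lemma₁ = solve-∀ ring
      lemma₂ : ∀ g a v x b y → g + (a * v * x - b * v * y) ≡ g + (a * x - b * y) * v
      lemma₂ = solve-∀ ring
      lemma₃ : ∀ g q c v → g + q * c * v ≡ g + q * v * c
      lemma₃ = solve-∀ ring

    -- The increments of `w` around k are k + 1 and k, and (k - κ)(k + 1) - (k + 1 + κ) k = -κ (2k +
    -- 1).
    w-drift : ∀ i → drift w i ≡ w (suc i) + - κ
    w-drift i = drift-≡ w i (- κ) (lemma (ι i) κ)
      where
      lemma : ∀ i κ → (1ℚ + i - κ) * (½ * ((1ℚ + (1ℚ + i)) * (1ℚ + (1ℚ + (1ℚ + i)))) - ½ * ((1ℚ + i) * (1ℚ + (1ℚ + i))))
        - (1ℚ + (1ℚ + i) + κ) * (½ * ((1ℚ + i) * (1ℚ + (1ℚ + i))) - ½ * (i * (1ℚ + i)))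
        ≡ (1ℚ + ((1ℚ + i) + (1ℚ + i))) * - κ
      lemma = solve-∀ ring

    S-drift : ∀ i → drift S i ≡ S (suc i) + 0ℚ
    S-drift i = drift-≡ S i 0ℚ (trans (lemma (ι (suc i)) κ (S i) (σ i) (σ (suc i)))
        (trans (cong (_- (ι (suc (suc i)) + κ) * ι (suc i) * σ i) (σ-rec i)) (lemma′ (ι (suc i)) ((ι (suc (suc i)) + κ) * ι (suc i) * σ i))))
      where
      lemma : ∀ k κ S s s′ → (k - κ) * (S + k * s + (1ℚ + k) * s′ - (S + k * s)) - (1ℚ + k + κ) * (S + k * s - S)
        ≡ (k - κ) * (1ℚ + k) * s′ - (1ℚ + k + κ) * k * s
      lemma = solve-∀ ring
      lemma′ : ∀ k x → x - x ≡ (1ℚ + (k + k)) * 0ℚ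
      lemma′ = solve-∀ ring

    -- Both increments involved lie where σ ≤ σ_R, so they are increments of `S`, and the
    -- computation is that of `S-drift`.
    H-drift-inside : ∀ {R i} → suc i ℕ.≤ R → drift (H (σ R)) i ≡ H (σ R) (suc i) + 0ℚ
    H-drift-inside {R} {i} i<R = drift-≡ (H c) i 0ℚ (trans
        (lemma (ι (suc i)) κ (H c i) (σ i ⊓ c) (σ (suc i) ⊓ c))
        (trans (cong₂ (λ s s′ → (ι (suc i) - κ) * ι (suc (suc i)) * s′ - (ι (suc (suc i)) + κ) * ι (suc i) * s)
                  (ℚ.p≤q⇒p⊓q≡p (σ-mono (ℕ.<⇒≤ i<R))) (ℚ.p≤q⇒p⊓q≡p (σ-mono i<R)))
        (trans (cong (_- (ι (suc (suc i)) + κ) * ι (suc i) * σ i) (σ-rec i)) (lemma′ (ι (suc i)) ((ι (suc (suc i)) + κ) * ι (suc i) * σ i)))))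
      where
      c = σ R
      lemma : ∀ k κ S s s′ → (k - κ) * (S + k * s + (1ℚ + k) * s′ - (S + k * s)) - (1ℚ + k + κ) * (S + k * s - S)
        ≡ (k - κ) * (1ℚ + k) * s′ - (1ℚ + k + κ) * k * s
      lemma = solve-∀ ring
      lemma′ : ∀ k x → x - x ≡ (1ℚ + (k + k)) * 0ℚ
      lemma′ = solve-∀ ring

    -- Both increments involved are those of `σ R * w`, and the computation is that of `w-drift`.
    H-drift-outside : ∀ {R i} → R ℕ.≤ i → drift (H (σ R)) i ≡ H (σ R) (suc i) + - (κ * σ R)
    H-drift-outside {R} {i} R≤i = drift-≡ (H c) i (- (κ * c)) (trans
        (lemma (ι (suc i)) κ (H c i) (σ i ⊓ c) (σ (suc i) ⊓ c))
        (trans (cong₂ (λ s s′ → (ι (suc i) - κ) * ι (suc (suc i)) * s′ - (ι (suc (suc i)) + κ) * ι (suc i) * s)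
                  (ℚ.p≥q⇒p⊓q≡q (σ-mono R≤i)) (ℚ.p≥q⇒p⊓q≡q (σ-mono (ℕ.m≤n⇒m≤1+n R≤i))))
        (lemma′ (ι (suc i)) κ c)))
      where
      c = σ R
      lemma : ∀ k κ S s s′ → (k - κ) * (S + k * s + (1ℚ + k) * s′ - (S + k * s)) - (1ℚ + k + κ) * (S + k * s - S)
        ≡ (k - κ) * (1ℚ + k) * s′ - (1ℚ + k + κ) * k * s
      lemma = solve-∀ ring
      lemma′ : ∀ k κ c → (k - κ) * (1ℚ + k) * c - (1ℚ + k + κ) * k * c ≡ (1ℚ + (k + k)) * - (κ * c)
      lemma′ = solve-∀ ring

    -- The double complement in the last clause is the form in which `stepProb` produces this
    -- probability, so that `seq-stepProb` holds by computation.
    P : ℤ → Step → ℚ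
    P (+ k)    right = α k
    P (+ k)    left  = 1ℚ - α k
    P -[1+ i ] right = 1ℚ - α (suc i)
    P -[1+ i ] left  = 1ℚ - (1ℚ - α (suc i))

    1-1- : ∀ p → 1ℚ - (1ℚ - p) ≡ p
    1-1- = solve-∀ ring

    0≤P : ∀ x s → 0ℚ ≤ P x s
    0≤P (+ k)    right = 0≤α k
    0≤P (+ k)    left  = 0≤1-α k
    0≤P -[1+ i ] right = 0≤1-α (suc i)
    0≤P -[1+ i ] left  = subst (0ℚ ≤_) (sym (1-1- (α (suc i)))) (0≤α (suc i))

    ∑P : ∀ x → P x right + P x left ≡ 1ℚ
    ∑P (+ k)    = lemma (α k)
      where
      lemma : ∀ p → p + (1ℚ - p) ≡ 1ℚ
      lemma = solve-∀ ring
    ∑P -[1+ i ] = lemma (α (suc i))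
      where
      lemma : ∀ p → 1ℚ - p + (1ℚ - (1ℚ - p)) ≡ 1ℚ
      lemma = solve-∀ ring

    open Walk P 0≤P ∑P public

    next : (ℤ → ℚ) → ℤ → ℚ
    next g x = E x λ s → g (move s x)

    next-signed-+ : ∀ g h i → next (signed g h) (+ suc i) ≡ drift g i
    next-signed-+ g h i = cong (λ n → α (suc i) * g (suc n) + (1ℚ - α (suc i)) * g i) (ℕ.+-comm i 1)

    -- A step to the right from -1 leads to 0, where `signed g h` takes its value from `g`; hence
    -- the condition that `g` and `h` agree at 0.
    next-signed-- : ∀ g h i → g 0 ≡ h 0 → next (signed g h) -[1+ i ] ≡ drift h i
    next-signed-- g h i g0≡h0 = trans
        (cong₂ (λ y z → (1ℚ - α (suc i)) * z + (1ℚ - (1ℚ - α (suc i))) * h (suc (suc y)))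
          (ℕ.+-identityʳ i) (lemma i))
        (lemma′ (α (suc i)) (h i) (h (suc (suc i))))
      where
      lemma : ∀ i → signed g h (-[1+ i ] ℤ.+ + 1) ≡ h i
      lemma zero    = g0≡h0
      lemma (suc i) = refl
      lemma′ : ∀ a x y → (1ℚ - a) * x + (1ℚ - (1ℚ - a)) * y ≡ a * y + (1ℚ - a) * x
      lemma′ = solve-∀ ring

    S± : ℤ → ℚ
    S± = signed S (λ k → - S k)

    -- At 0 the two neighbours cancel by oddness; elsewhere this is `S-drift`.
    next-S± : ∀ x → next S± x ≡ S± x
    next-S± (+ zero)  = lemma (S 1)
      where
      lemma : ∀ s → ½ * s + (1ℚ - ½) * - s ≡ 0ℚ
      lemma = solve-∀ ring
    next-S± (+ suc i) = trans (next-signed-+ S (λ k → - S k) i) (trans (S-drift i) (ℚ.+-identityʳ (S (suc i))))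
    next-S± -[1+ i ]  = trans (next-signed-- S (λ k → - S k) i refl)
      (trans (lemma (α (suc i)) (S (suc (suc i))) (S i)) (cong -_ (trans (S-drift i) (ℚ.+-identityʳ (S (suc i))))))
      where
      lemma : ∀ a x y → a * - x + (1ℚ - a) * - y ≡ - (a * x + (1ℚ - a) * y)
      lemma = solve-∀ ring

    -- The functions G and Ĝ at the scale R

    module Lyapunov (R : ℕ) {{R≢0 : ℕ.NonZero R}} where

      s s₂ ρ ε δ Q W L : ℚ
      s = σ R
      s₂ = σ (R ℕ.+ R)
      -- The deficit κ/8 is the concave kink at 0 of the part of `G` built from `H`, whose slope
      -- passes there from -ρ to -1. It is small enough for `ρs₂-lower`, and `ε` is small enough for
      -- the kink to outweigh the drift of ε w at 0.
      ρ = 1ℚ - + 1 / 8 * κ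
      ε = + 1 / 32 * κ
      δ = ε * κ
      Q = ι R * ι R * s
      -- By `S±-small`, S(x) and S(y) are at most 18 Q in absolute value if x and y are within 3R of
      -- 0. The shift `W` then puts S(x) - S(y) + W between 0 and `L`, where `Φ` is a square.
      W = + 36 / 1 * Q
      L = W + W

      0≤s : 0ℚ ≤ s
      0≤s = 0≤σ R

      0<Q : 0ℚ < Q
      0<Q = 0<* (0<* (0<ι R) (0<ι R)) (0<σ R)
        where
        0<ι : ∀ n .{{_ : ℕ.NonZero n}} → 0ℚ < ι n
        0<ι (suc n) = 0<1+ (0≤ι n)

      0≤Q : 0ℚ ≤ Q
      0≤Q = ℚ.<⇒≤ 0<Q

      0≤W : 0ℚ ≤ W
      0≤W = 0≤* (ℚ.nonNegative⁻¹ (+ 36 / 1)) 0≤Q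

      open Huber L (0≤+ 0≤W 0≤W) public

      -- With this weight a variance of (R s)² contributes exactly s, enough to pay for an excess
      -- drift κ s.
      μ : ℚ
      μ = inv Q 0<Q

      0≤μ : 0ℚ ≤ μ
      0≤μ = ℚ.<⇒≤ (0<inv Q 0<Q)

      -- The profiles on the side towards the other agent and on the side away from it. Both are
      -- written as ε w + a H, so that `drift-w+` serves both.
      gain pain : ℕ → ℚ
      gain k = ε * w k + - 1ℚ * H s k
      pain k = ε * w k + ρ * H s₂ k

      0≤ε : 0ℚ ≤ ε
      0≤ε = 0≤* (ℚ.nonNegative⁻¹ (+ 1 / 32)) 0≤κ

      0≤ρ : 0ℚ ≤ ρ
      0≤ρ = subst (0ℚ ≤_) (lemma κ)
          (0≤+ 0≤1-5κ (0≤* (ℚ.nonNegative⁻¹ (+ 39 / 8)) 0≤κ))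
        where
        lemma : ∀ κ → 1ℚ - + 5 / 1 * κ + + 39 / 8 * κ ≡ 1ℚ - + 1 / 8 * κ
        lemma = solve-∀ ring

      -- By `σ-double`, since (1 - κ/8)(1 + κ/2) exceeds 1 + κ/4 by (κ/8)(1 - κ/2). The surplus κ/4
      -- is what makes `pain` outweigh `gain` far from the origin in `quadratic-bound`.
      ρs₂-lower : (1ℚ + + 1 / 4 * κ) * s ≤ ρ * s₂
      ρs₂-lower = ℚ.≤-trans
          (≤-by (+ 1 / 8 * κ * (1ℚ - + 5 / 1 * κ + + 9 / 2 * κ) * s)
            (0≤* (0≤* (0≤* (ℚ.nonNegative⁻¹ (+ 1 / 8)) 0≤κ)
              (0≤+ 0≤1-5κ (0≤* (ℚ.nonNegative⁻¹ (+ 9 / 2)) 0≤κ))) 0≤s) (lemma κ s))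
          (*-monoˡ 0≤ρ (σ-double R))
        where
        lemma : ∀ κ s → (1ℚ - + 1 / 8 * κ) * ((1ℚ + ½ * κ) * s)
          ≡ (1ℚ + + 1 / 4 * κ) * s + + 1 / 8 * κ * (1ℚ - + 5 / 1 * κ + + 9 / 2 * κ) * s
        lemma = solve-∀ ring

      s≤ρs₂ : s ≤ ρ * s₂
      s≤ρs₂ = ℚ.≤-trans (≤-by (+ 1 / 4 * κ * s) (0≤* (0≤* (ℚ.nonNegative⁻¹ (+ 1 / 4)) 0≤κ) 0≤s) (lemma κ s)) ρs₂-lower
        where
        lemma : ∀ κ s → (1ℚ + + 1 / 4 * κ) * s ≡ s + + 1 / 4 * κ * s
        lemma = solve-∀ ring

      drift-linear : ∀ a g b h i → drift (λ k → a * g k + b * h k) i ≡ a * drift g i + b * drift h i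
      drift-linear a g b h i = lemma (α (suc i)) a b (g (suc (suc i))) (g i) (h (suc (suc i))) (h i)
        where
        lemma : ∀ p a b g g′ h h′ → p * (a * g + b * h) + (1ℚ - p) * (a * g′ + b * h′)
          ≡ a * (p * g + (1ℚ - p) * g′) + b * (p * h + (1ℚ - p) * h′)
        lemma = solve-∀ ring

      drift-w+ : ∀ a c i e → drift (H c) i ≡ H c (suc i) + e →
        drift (λ k → ε * w k + a * H c k) i ≡ ε * w (suc i) + a * H c (suc i) - δ + a * e
      drift-w+ a c i e eq = trans (drift-linear ε w a (H c) i)
          (trans (cong₂ (λ x y → ε * x + a * y) (w-drift i) eq) (lemma ε κ (w (suc i)) a (H c (suc i)) e))
        where
        lemma : ∀ ε κ w a h e → ε * (w + - κ) + a * (h + e) ≡ ε * w + a * h - ε * κ + a * e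
        lemma = solve-∀ ring

      private
        +*0 : ∀ x a → x + a * 0ℚ ≡ x
        +*0 = solve-∀ ring

      gain-inside : ∀ i → suc i ℕ.≤ R → drift gain i ≤ gain (suc i) - δ
      gain-inside i i<R = ℚ.≤-reflexive (trans
        (drift-w+ (- 1ℚ) s i 0ℚ (H-drift-inside i<R)) (+*0 (gain (suc i) - δ) (- 1ℚ)))

      gain-outside : ∀ i → R ℕ.≤ i → drift gain i ≤ gain (suc i) - δ + κ * s
      gain-outside i R≤i = ℚ.≤-reflexive (trans
          (drift-w+ (- 1ℚ) s i (- (κ * s)) (H-drift-outside R≤i))
          (lemma (gain (suc i) - δ) (κ * s)))
        where
        lemma : ∀ x y → x + - 1ℚ * - y ≡ x + y
        lemma = solve-∀ ring

      pain-inside : ∀ i → suc i ℕ.≤ R ℕ.+ R → drift pain i ≤ pain (suc i) - δ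
      pain-inside i i<R = ℚ.≤-reflexive (trans
        (drift-w+ ρ s₂ i 0ℚ (H-drift-inside i<R)) (+*0 (pain (suc i) - δ) ρ))

      -- Since ρ s₂ ≥ s, the drift -κ ρ s₂ is negative enough to cancel the term κ s that
      -- `gain-outside` gives for the other walk.
      pain-outside : ∀ i → R ℕ.+ R ℕ.≤ i → drift pain i ≤ pain (suc i) - δ - κ * s
      pain-outside i R≤i = ≤-by (κ * (ρ * s₂ - s)) (0≤* 0≤κ (≤⇒0≤- s≤ρs₂))
          (sym (trans (cong (_+ κ * (ρ * s₂ - s)) (drift-w+ ρ s₂ i (- (κ * s₂)) (H-drift-outside R≤i)))
            (lemma (pain (suc i) - δ) ρ κ s s₂)))
        where
        lemma : ∀ x ρ κ s s₂ → x + ρ * - (κ * s₂) + κ * (ρ * s₂ - s) ≡ x - κ * s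
        lemma = solve-∀ ring

      pain-drift : ∀ i → drift pain i ≤ pain (suc i) - δ
      pain-drift i = [ pain-inside i , (λ 2R≤i → ℚ.≤-trans (pain-outside i 2R≤i)
          (≤-by (κ * s) (0≤* 0≤κ 0≤s) (lemma (pain (suc i) - δ) (κ * s)))) ]′ (ℕ.<-≤-connex i (R ℕ.+ R))
        where
        lemma : ∀ x y → x ≡ x - y + y
        lemma = solve-∀ ring

      G Ĝ : ℤ → ℚ
      G = signed gain pain
      Ĝ = signed pain gain

      gain0≡pain0 : gain 0 ≡ pain 0
      gain0≡pain0 = lemma (ε * w 0) ρ
        where
        lemma : ∀ x r → x + - 1ℚ * 0ℚ ≡ x + r * 0ℚ
        lemma = solve-∀ ring

      -- As `w` and both functions `H` are 1 at 1, the left-hand side is ε - κ/16 = -κ/32, and δ =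
      -- κ²/32 with κ ≤ 1.
      kick : ½ * gain 1 + ½ * pain 1 ≤ gain 0 - δ
      kick = ≤-by (+ 1 / 32 * κ * (1ℚ - + 5 / 1 * κ + + 4 / 1 * κ))
          (0≤* 0≤ε (0≤+ 0≤1-5κ (0≤* (ℚ.nonNegative⁻¹ (+ 4 / 1)) 0≤κ)))
          (sym (trans (cong₂ (λ a b → ½ * (ε * w 1 + - 1ℚ * a) + ½ * (ε * w 1 + ρ * b)
              + + 1 / 32 * κ * (1ℚ - + 5 / 1 * κ + + 4 / 1 * κ)) (H1 R) (H1 (R ℕ.+ R))) (lemma κ)))
        where
        H1 : ∀ n → H (σ n) 1 ≡ 0ℚ + ι 1 * 1ℚ
        H1 n = cong (λ z → 0ℚ + ι 1 * z) (ℚ.p≤q⇒p⊓q≡p (σ-mono {0} {n} ℕ.z≤n))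
        lemma : ∀ κ → ½ * (+ 1 / 32 * κ * (½ * ((1ℚ + 0ℚ) * (1ℚ + (1ℚ + 0ℚ)))) + - 1ℚ * (0ℚ + (1ℚ + 0ℚ) * 1ℚ))
          + ½ * (+ 1 / 32 * κ * (½ * ((1ℚ + 0ℚ) * (1ℚ + (1ℚ + 0ℚ)))) + (1ℚ - + 1 / 8 * κ) * (0ℚ + (1ℚ + 0ℚ) * 1ℚ))
          + + 1 / 32 * κ * (1ℚ - + 5 / 1 * κ + + 4 / 1 * κ)
          ≡ + 1 / 32 * κ * (½ * (0ℚ * (1ℚ + 0ℚ))) + - 1ℚ * 0ℚ - + 1 / 32 * κ * κ
        lemma = solve-∀ ring

      next-G-far : ∀ {i} → R ℕ.≤ i → next G (+ suc i) ≤ G (+ suc i) - δ + κ * s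
      next-G-far {i} R≤i = subst (_≤ gain (suc i) - δ + κ * s) (sym (next-signed-+ gain pain i)) (gain-outside i R≤i)

      next-Ĝ-far : ∀ {i} → R ℕ.≤ i → next Ĝ -[1+ i ] ≤ Ĝ -[1+ i ] - δ + κ * s
      next-Ĝ-far {i} R≤i = subst (_≤ gain (suc i) - δ + κ * s)
        (sym (next-signed-- pain gain i (sym gain0≡pain0))) (gain-outside i R≤i)

      next-G-deep : ∀ {i} → R ℕ.+ R ℕ.≤ i → next G -[1+ i ] ≤ G -[1+ i ] - δ - κ * s
      next-G-deep {i} R≤i = subst (_≤ pain (suc i) - δ - κ * s)
        (sym (next-signed-- gain pain i gain0≡pain0)) (pain-outside i R≤i)

      next-Ĝ-deep : ∀ {i} → R ℕ.+ R ℕ.≤ i → next Ĝ (+ suc i) ≤ Ĝ (+ suc i) - δ - κ * s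
      next-Ĝ-deep {i} R≤i = subst (_≤ pain (suc i) - δ - κ * s)
        (sym (next-signed-+ pain gain i)) (pain-outside i R≤i)

      next-G : ∀ x → (∃[ i ] x ≡ + suc i × R ℕ.≤ i) ⊎ next G x ≤ G x - δ
      next-G (+ zero) = inj₂ kick
      next-G (+ suc i) = [ (λ i<R → inj₂ (subst (_≤ gain (suc i) - δ)
          (sym (next-signed-+ gain pain i)) (gain-inside i i<R)))
        , (λ R≤i → inj₁ (i , refl , R≤i)) ]′ (ℕ.<-≤-connex i R)
      next-G -[1+ i ] = inj₂ (subst (_≤ pain (suc i) - δ)
        (sym (next-signed-- gain pain i gain0≡pain0)) (pain-drift i))

      next-Ĝ : ∀ y → (∃[ i ] y ≡ -[1+ i ] × R ℕ.≤ i) ⊎ next Ĝ y ≤ Ĝ y - δ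
      next-Ĝ (+ zero) = inj₂ (ℚ.≤-trans (ℚ.≤-reflexive (ℚ.+-comm (½ * pain 1) (½ * gain 1)))
        (ℚ.≤-trans kick (ℚ.≤-reflexive (cong (_- δ) gain0≡pain0))))
      next-Ĝ (+ suc i) = inj₂ (subst (_≤ pain (suc i) - δ) (sym (next-signed-+ pain gain i)) (pain-drift i))
      next-Ĝ -[1+ i ] = [ (λ i<R → inj₂ (subst (_≤ gain (suc i) - δ)
          (sym (next-signed-- pain gain i (sym gain0≡pain0))) (gain-inside i i<R)))
        , (λ R≤i → inj₁ (i , refl , R≤i)) ]′ (ℕ.<-≤-connex i R)

      E-const : ∀ x c → E x (λ _ → c) ≡ c
      E-const x c = trans (lemma (P x right) (P x left) c) (trans (cong (_* c) (∑P x)) (ℚ.*-identityˡ c))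
        where
        lemma : ∀ p q c → p * c + q * c ≡ (p + q) * c
        lemma = solve-∀ ring

      E-variance : ∀ x z (Δ : Step → ℚ) → E x Δ ≡ 0ℚ →
        E x (λ t → (z + Δ t) * (z + Δ t)) ≡ z * z + E x (λ t → Δ t * Δ t)
      E-variance x z Δ Δ≡0 = trans (lemma (P x right) (P x left) z (Δ right) (Δ left))
          (trans (cong₂ (λ e f → e * (z * z) + (f * z + f * z) + E x (λ t → Δ t * Δ t)) (∑P x) Δ≡0)
            (lemma′ z (E x (λ t → Δ t * Δ t))))
        where
        lemma : ∀ p q z a b → p * ((z + a) * (z + a)) + q * ((z + b) * (z + b))
          ≡ (p + q) * (z * z) + ((p * a + q * b) * z + (p * a + q * b) * z) + (p * (a * a) + q * (b * b))
        lemma = solve-∀ ring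
        lemma′ : ∀ z v → 1ℚ * (z * z) + (0ℚ * z + 0ℚ * z) + v ≡ z * z + v
        lemma′ = solve-∀ ring

      E²-+ : ∀ x y g h → E² x y (λ t t′ → g t t′ + h t t′) ≡ E² x y g + E² x y h
      E²-+ x y g h = trans (E-cong x λ t → E-+ y (g t) (h t)) (E-+ x (λ t → E y (g t)) (λ t → E y (h t)))

      E²-separate : ∀ x y c g h → E² x y (λ t t′ → c + (g t + h t′)) ≡ c + (E x g + E y h)
      E²-separate x y c g h = begin
          E x (λ t → E y (λ t′ → c + (g t + h t′)))   ≡⟨ E-cong x (λ t → E-const+ y c (λ t′ → g t + h t′)) ⟩
          E x (λ t → c + E y (λ t′ → g t + h t′))     ≡⟨ E-const+ x c (λ t → E y (λ t′ → g t + h t′)) ⟩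
          c + E x (λ t → E y (λ t′ → g t + h t′))
            ≡⟨ cong (_+_ c) (trans (E-cong x (λ t → trans (E-const+ y (g t) h) (ℚ.+-comm (g t) (E y h))))
                 (trans (E-const+ x (E y h) g) (ℚ.+-comm (E y h) (E x g)))) ⟩
          c + (E x g + E y h) ∎
        where open ≡-Reasoning

      -- The shifted martingale and its variance

      level : ℤ → ℤ → ℚ
      level x y = S± x - S± y + W

      Φ-next : ℤ → ℤ → ℚ
      Φ-next x y = E² x y λ t t′ → Φ (level (move t x) (move t′ y))

      -- Jensen's inequality: the tangent at `h = clamp (level x y)` is affine in the martingale
      -- `level`, so its mean is preserved. It lies below `Φ` everywhere, with equality at the
      -- present level.
      Φ-submartingale : ∀ x y → Φ (level x y) ≤ Φ-next x y
      Φ-submartingale x y = begin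
          tangent h (level x y)
            ≡⟨ lemma₁ h (S± x) (S± y) W ⟩
          h * W + h * W - h * h + ((h + h) * S± x + (- (h + h)) * S± y)
            ≡⟨ cong₂ (λ a b → h * W + h * W - h * h + ((h + h) * a + (- (h + h)) * b)) (next-S± x) (next-S± y) ⟨
          h * W + h * W - h * h + ((h + h) * next S± x + (- (h + h)) * next S± y)
            ≡⟨ cong₂ (λ a b → h * W + h * W - h * h + (a + b))
                 (E-scale x (h + h) (λ t → S± (move t x))) (E-scale y (- (h + h)) (λ t → S± (move t y))) ⟨
          h * W + h * W - h * h + (E x (λ t → (h + h) * S± (move t x)) + E y (λ t → (- (h + h)) * S± (move t y)))
            ≡⟨ E²-separate x y (h * W + h * W - h * h) (λ t → (h + h) * S± (move t x)) (λ t → (- (h + h)) * S± (move t y)) ⟨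
          E² x y (λ t t′ → h * W + h * W - h * h + ((h + h) * S± (move t x) + (- (h + h)) * S± (move t′ y)))
            ≤⟨ E²-mono x y (λ t t′ → ℚ.≤-trans
                 (ℚ.≤-reflexive (sym (lemma₁ h (S± (move t x)) (S± (move t′ y)) W)))
                 (tangent≤Φ (level (move t x) (move t′ y)) (0≤clamp (level x y)) (clamp≤ (level x y)))) ⟩
          Φ-next x y ∎
        where
        open ℚ.≤-Reasoning
        h = clamp (level x y)
        lemma₁ : ∀ h a b W → h * (a - b + W) + h * (a - b + W) - h * h
          ≡ h * W + h * W - h * h + ((h + h) * a + (- (h + h)) * b)
        lemma₁ = solve-∀ ring

      Δ : ℤ → Step → ℚ
      Δ x t = S± (move t x) - S± x

      E-Δ : ∀ x → E x (Δ x) ≡ 0ℚ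
      E-Δ x = trans (lemma (P x right) (P x left) (S± (move right x)) (S± (move left x)) (S± x))
          (trans (cong₂ (λ a b → a - b * S± x) (next-S± x) (∑P x)) (lemma′ (S± x)))
        where
        lemma : ∀ p q a b c → p * (a - c) + q * (b - c) ≡ p * a + q * b - (p + q) * c
        lemma = solve-∀ ring
        lemma′ : ∀ c → c - 1ℚ * c ≡ 0ℚ
        lemma′ = solve-∀ ring

      V : ℤ → ℚ
      V x = E x λ t → Δ x t * Δ x t

      V-lower : ∀ x v → (∀ t → v ≤ Δ x t * Δ x t) → v ≤ V x
      V-lower x v le = subst (_≤ V x) (E-const x v) (E-mono x le)

      0≤V : ∀ x → 0ℚ ≤ V x
      0≤V x = V-lower x 0ℚ λ t → 0≤p² (Δ x t)

      -- The increments of S(x) and S(y) are centred and independent, so the cross terms vanish in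
      -- the mean.
      level²-next : ∀ x y →
        E² x y (λ t t′ → level (move t x) (move t′ y) * level (move t x) (move t′ y))
          ≡ level x y * level x y + V x + V y
      level²-next x y = begin
          E x (λ t → E y (λ t′ → level (move t x) (move t′ y) * level (move t x) (move t′ y)))
            ≡⟨ E-cong x (λ t → trans
                 (E-cong y (λ t′ → cong (λ z → z * z) (lemma (S± (move t x)) (S± x) (S± (move t′ y)) (S± y) W)))
                 (trans (E-variance y (z + Δ x t) (λ t′ → - Δ y t′) E-Δ⁻)
                   (ℚ.+-comm ((z + Δ x t) * (z + Δ x t)) (E y (λ t′ → - Δ y t′ * - Δ y t′))))) ⟩
          E x (λ t → E y (λ t′ → - Δ y t′ * - Δ y t′) + (z + Δ x t) * (z + Δ x t))
            ≡⟨ E-const+ x (E y (λ t′ → - Δ y t′ * - Δ y t′)) (λ t → (z + Δ x t) * (z + Δ x t)) ⟩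
          E y (λ t′ → - Δ y t′ * - Δ y t′) + E x (λ t → (z + Δ x t) * (z + Δ x t))
            ≡⟨ cong₂ _+_ (E-cong y (λ t′ → neg² (Δ y t′))) (E-variance x z (Δ x) (E-Δ x)) ⟩
          V y + (z * z + V x)
            ≡⟨ ℚ.+-comm (V y) (z * z + V x) ⟩
          z * z + V x + V y ∎
        where
        open ≡-Reasoning
        z = level x y
        lemma : ∀ a a₀ b b₀ W → a - b + W ≡ a₀ - b₀ + W + (a - a₀) + - (b - b₀)
        lemma = solve-∀ ring
        neg² : ∀ d → - d * - d ≡ d * d
        neg² = solve-∀ ring
        E-Δ⁻ : E y (λ t′ → - Δ y t′) ≡ 0ℚ
        E-Δ⁻ = trans (lemma₂ (P y right) (P y left) (Δ y right) (Δ y left)) (cong -_ (E-Δ y))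
          where
          lemma₂ : ∀ p q a b → p * - a + q * - b ≡ - (p * a + q * b)
          lemma₂ = solve-∀ ring

      -- S(3R) ≤ σ_(3R) w(3R), where σ_(3R) ≤ 3s by `σ-concave` and w(3R) ≤ 6R².
      S-small : ∀ {n} → n ℕ.≤ 3 ℕ.* R → S n ≤ + 18 / 1 * Q
      S-small {n} n≤3R = ℚ.≤-trans (S-mono n≤3R) (ℚ.≤-trans (S≤ (ℕ.n≤1+n (3 ℕ.* R)))
          (ℚ.≤-trans (*-monoʳ (0≤w (3 ℕ.* R)) σ₃) w₃))
        where
        ιR = ι R
        ι3R : ι (3 ℕ.* R) ≡ + 3 / 1 * ιR
        ι3R = ι-* 3 R
        σ₃ : σ (3 ℕ.* R) ≤ + 3 / 1 * s
        σ₃ = *-cancelˡ (0<1+ (0≤ι R)) (ℚ.≤-trans (σ-concave (ℕ.m≤m+n R (R ℕ.+ (R ℕ.+ 0))))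
            (≤-by (+ 2 / 1 * s) (0≤* (ℚ.nonNegative⁻¹ (+ 2 / 1)) 0≤s)
              (trans (lemma ιR s) (cong (λ z → (1ℚ + z) * s + + 2 / 1 * s) (sym ι3R)))))
          where
          lemma : ∀ R s → (1ℚ + R) * (+ 3 / 1 * s) ≡ (1ℚ + + 3 / 1 * R) * s + + 2 / 1 * s
          lemma = solve-∀ ring
        w₃ : + 3 / 1 * s * w (3 ℕ.* R) ≤ + 18 / 1 * Q
        w₃ = ≤-by (+ 9 / 2 * (ιR * (ιR - 1ℚ)) * s)
            (0≤* (0≤* (ℚ.nonNegative⁻¹ (+ 9 / 2)) (0≤* (0≤ι R) (≤⇒0≤- (1≤ι R)))) 0≤s)
            (trans (lemma ιR s) (cong (λ z → + 3 / 1 * s * (½ * (z * (1ℚ + z))) + + 9 / 2 * (ιR * (ιR - 1ℚ)) * s) (sym ι3R)))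
          where
          lemma : ∀ R s → + 18 / 1 * (R * R * s) ≡
            + 3 / 1 * s * (½ * (+ 3 / 1 * R * (1ℚ + + 3 / 1 * R))) + + 9 / 2 * (R * (R - 1ℚ)) * s
          lemma = solve-∀ ring

      S±-small : ∀ x → ℤ.∣ x ∣ ℕ.≤ 3 ℕ.* R → S± x ≤ + 18 / 1 * Q × - S± x ≤ + 18 / 1 * Q
      S±-small x h = go x h
        where
        neg≤ : ∀ {p q} → 0ℚ ≤ p → 0ℚ ≤ q → - p ≤ q
        neg≤ {p} {q} 0≤p 0≤q = ≤-by (p + q) (0≤+ 0≤p 0≤q) (lemma p q)
          where
          lemma : ∀ p q → q ≡ - p + (p + q)
          lemma = solve-∀ ring
        0≤18Q = 0≤* (ℚ.nonNegative⁻¹ (+ 18 / 1)) 0≤Q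
        go : ∀ x → ℤ.∣ x ∣ ℕ.≤ 3 ℕ.* R → S± x ≤ + 18 / 1 * Q × - S± x ≤ + 18 / 1 * Q
        go (+ k)    h = S-small h , neg≤ (0≤S k) 0≤18Q
        go -[1+ i ] h = neg≤ (0≤S (suc i)) 0≤18Q , ℚ.≤-trans (ℚ.≤-reflexive (lemma (S (suc i)))) (S-small h)
          where
          lemma : ∀ p → - - p ≡ p
          lemma = solve-∀ ring

      ∣move∣ : ∀ t x → ℤ.∣ move t x ∣ ℕ.≤ suc ℤ.∣ x ∣
      ∣move∣ right x = ℕ.≤-trans (ℤ.∣i+j∣≤∣i∣+∣j∣ x (+ 1)) (ℕ.≤-reflexive (ℕ.+-comm ℤ.∣ x ∣ 1))
      ∣move∣ left  x = ℕ.≤-trans (ℤ.∣i-j∣≤∣i∣+∣j∣ x (+ 1)) (ℕ.≤-reflexive (ℕ.+-comm ℤ.∣ x ∣ 1))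

      -- `Φ` never exceeds the square, and it reaches the square at every position after the step,
      -- since these are still within 3R. The mean of `Φ` thus grows at least as much as that of the
      -- square, namely by the two variances.
      Φ-corner : ∀ x y v → suc ℤ.∣ x ∣ ℕ.≤ 3 ℕ.* R → suc ℤ.∣ y ∣ ℕ.≤ 3 ℕ.* R → v ≤ V x ⊎ v ≤ V y →
        Φ (level x y) + v ≤ Φ-next x y
      Φ-corner x y v hx hy hv = begin
          Φ z + v                   ≤⟨ ℚ.+-mono-≤ (Φ≤t² z) (variance hv) ⟩
          z * z + (V x + V y)       ≡⟨ ℚ.+-assoc (z * z) (V x) (V y) ⟨
          z * z + V x + V y         ≡⟨ level²-next x y ⟨
          E² x y (λ t t′ → level (move t x) (move t′ y) * level (move t x) (move t′ y))
            ≤⟨ E²-mono x y (λ t t′ → inside (move t x) (move t′ y)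
                 (ℕ.≤-trans (∣move∣ t x) hx) (ℕ.≤-trans (∣move∣ t′ y) hy)) ⟩
          Φ-next x y                ∎
        where
        open ℚ.≤-Reasoning
        z = level x y
        variance : v ≤ V x ⊎ v ≤ V y → v ≤ V x + V y
        variance (inj₁ h) = ℚ.≤-trans h (≤-by (V y) (0≤V y) refl)
        variance (inj₂ h) = ℚ.≤-trans h (≤-by (V x) (0≤V x) (ℚ.+-comm (V x) (V y)))
        inside : ∀ x y → ℤ.∣ x ∣ ℕ.≤ 3 ℕ.* R → ℤ.∣ y ∣ ℕ.≤ 3 ℕ.* R → level x y * level x y ≤ Φ (level x y)
        inside x y hx hy = bounds (S±-small x hx) (S±-small y hy)
          where
          lower : ∀ a b Q → a - b + + 36 / 1 * Q ≡ 0ℚ + ((+ 18 / 1 * Q - - a) + (+ 18 / 1 * Q - b))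
          lower = solve-∀ ring
          upper : ∀ a b Q → + 36 / 1 * Q + + 36 / 1 * Q
            ≡ a - b + + 36 / 1 * Q + ((+ 18 / 1 * Q - a) + (+ 18 / 1 * Q - - b))
          upper = solve-∀ ring
          bounds : S± x ≤ + 18 / 1 * Q × - S± x ≤ + 18 / 1 * Q → S± y ≤ + 18 / 1 * Q × - S± y ≤ + 18 / 1 * Q →
            level x y * level x y ≤ Φ (level x y)
          bounds (a , b) (c , e) = t²≤Φ (level x y)
            (≤-by ((+ 18 / 1 * Q - - S± x) + (+ 18 / 1 * Q - S± y)) (0≤+ (≤⇒0≤- b) (≤⇒0≤- c)) (lower (S± x) (S± y) Q))
            (≤-by ((+ 18 / 1 * Q - S± x) + (+ 18 / 1 * Q - - S± y)) (0≤+ (≤⇒0≤- a) (≤⇒0≤- e)) (upper (S± x) (S± y) Q))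

      ιR²s² : ℚ
      ιR²s² = (ι R * s) * (ι R * s)

      r-lower : ∀ {k} → R ℕ.≤ k → ιR²s² ≤ r k * r k
      r-lower {k} R≤k = ℚ.≤-trans (*-monoʳ (0≤* (0≤ι R) 0≤s) le) (*-monoˡ (0≤r k) le)
        where
        le : ι R * s ≤ r k
        le = ℚ.≤-trans (*-monoʳ 0≤s (ι-mono (ℕ.m≤n⇒m≤1+n R≤k))) (*-monoˡ (0≤ι (suc k)) (σ-mono R≤k))

      -- From i + 1 the increments of `S` are r_(i+1) and -r_i, both at least R s in absolute value.
      V-far⁺ : ∀ {i} → R ℕ.≤ i → ιR²s² ≤ V (+ suc i)
      V-far⁺ {i} R≤i = V-lower (+ suc i) ιR²s² λ where
          right → subst (λ n → ιR²s² ≤ (S (suc n) - S (suc i)) * (S (suc n) - S (suc i))) (sym (ℕ.+-comm i 1))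
            (ℚ.≤-trans (r-lower (ℕ.m≤n⇒m≤1+n R≤i)) (ℚ.≤-reflexive (lemma₁ (S (suc i)) (r (suc i)))))
          left → ℚ.≤-trans (r-lower R≤i) (ℚ.≤-reflexive (lemma₂ (S i) (r i)))
        where
        lemma₁ : ∀ a r → r * r ≡ (a + r - a) * (a + r - a)
        lemma₁ = solve-∀ ring
        lemma₂ : ∀ a r → r * r ≡ (a - (a + r)) * (a - (a + r))
        lemma₂ = solve-∀ ring

      V-far⁻ : ∀ {i} → R ℕ.≤ i → ιR²s² ≤ V -[1+ i ]
      V-far⁻ {i} R≤i = V-lower -[1+ i ] ιR²s² λ where
          right → ℚ.≤-trans (r-lower R≤i) (ℚ.≤-reflexive
            (trans (lemma₁ (S i) (r i)) (cong (λ z → (z - - S (suc i)) * (z - - S (suc i))) (sym (pred i)))))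
          left → subst (λ n → ιR²s² ≤ (- S (suc (suc n)) - - S (suc i)) * (- S (suc (suc n)) - - S (suc i)))
            (sym (ℕ.+-identityʳ i))
            (ℚ.≤-trans (r-lower (ℕ.m≤n⇒m≤1+n R≤i)) (ℚ.≤-reflexive (lemma₂ (S (suc i)) (r (suc i)))))
        where
        pred : ∀ i → S± (-[1+ i ] ℤ.+ + 1) ≡ - S i
        pred zero    = refl
        pred (suc i) = refl
        lemma₁ : ∀ a r → r * r ≡ (- a - - (a + r)) * (- a - - (a + r))
        lemma₁ = solve-∀ ring
        lemma₂ : ∀ a r → r * r ≡ (- (a + r) - - a) * (- (a + r) - - a)
        lemma₂ = solve-∀ ring

      -- Negative drift of the Lyapunov function

      module Potential (d : ℕ) (2d≤R : 2 ℕ.* d ℕ.≤ R)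
        (small-d : + 2336 / 1 * ι (2 ℕ.* d) ≤ κ * ι R) where

        open Meeting d

        A : ℚ
        A = + 6000 / 1 * Q

        f : ℤ → ℤ → ℚ
        f x y = A + (G x + Ĝ y) + - μ * Φ (level x y)

        next-f : ∀ x y → E² x y (λ t t′ → f (move t x) (move t′ y))
                       ≡ A + (next G x + next Ĝ y) + - μ * Φ-next x y
        next-f x y = trans
          (E²-+ x y (λ t t′ → A + (G (move t x) + Ĝ (move t′ y))) (λ t t′ → - μ * Φ (level (move t x) (move t′ y))))
          (cong₂ _+_ (E²-separate x y A (λ t → G (move t x)) (λ t′ → Ĝ (move t′ y)))
                     (E²-scale x y (- μ) (λ t t′ → Φ (level (move t x) (move t′ y)))))

        μ*ιR²s² : μ * ιR²s² ≡ s
        μ*ιR²s² = trans (lemma μ (ι R) s) (trans (cong (_* s) (*-inv Q 0<Q)) (ℚ.*-identityˡ s))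
          where
          lemma : ∀ m R s → m * ((R * s) * (R * s)) ≡ R * R * s * m * s
          lemma = solve-∀ ring

        κs≤s : κ * s ≤ s
        κs≤s = ≤-by ((1ℚ - + 5 / 1 * κ + + 4 / 1 * κ) * s)
            (0≤* (0≤+ 0≤1-5κ (0≤* (ℚ.nonNegative⁻¹ (+ 4 / 1)) 0≤κ)) 0≤s) (lemma κ s)
          where
          lemma : ∀ κ s → s ≡ κ * s + (1ℚ - + 5 / 1 * κ + + 4 / 1 * κ) * s
          lemma = solve-∀ ring

        Decreasing : ℤ → ℤ → Set
        Decreasing x y = E² x y (λ t t′ → f (move t x) (move t′ y)) + (δ + δ) ≤ f x y

        -- The balance of one step: `u` and `v` are the excess drifts of the two walks, and `q` is
        -- the increase in the mean of `Φ` that pays for them with weight `μ`.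
        decreasing : ∀ x y u v q → next G x ≤ G x - δ + u → next Ĝ y ≤ Ĝ y - δ + v →
          Φ (level x y) + q ≤ Φ-next x y → u + v ≤ μ * q → Decreasing x y
        decreasing x y u v q hG hĜ hΦ h = subst (λ z → z + (δ + δ) ≤ f x y) (sym (next-f x y))
            (≤-by ((G x - δ + u - next G x) + (Ĝ y - δ + v - next Ĝ y)
                   + μ * (Φ-next x y - (Φ (level x y) + q)) + (μ * q - (u + v)))
              (0≤+ (0≤+ (0≤+ (≤⇒0≤- hG) (≤⇒0≤- hĜ)) (0≤* 0≤μ (≤⇒0≤- hΦ))) (≤⇒0≤- h))
              (lemma A (G x) (Ĝ y) (next G x) (next Ĝ y) δ u v q μ (Φ (level x y)) (Φ-next x y)))
          where
          lemma : ∀ A g h g′ h′ δ u v q m p p′ → A + (g + h) + - m * p ≡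
            A + (g′ + h′) + - m * p′ + (δ + δ)
            + ((g - δ + u - g′) + (h - δ + v - h′) + m * (p′ - (p + q)) + (m * q - (u + v)))
          lemma = solve-∀ ring

        private
          ≤+0 : ∀ {p q} → p ≤ q → p ≤ q + 0ℚ
          ≤+0 {p} {q} = subst (p ≤_) (sym (ℚ.+-identityʳ q))

        decreasing-near : ∀ x y → next G x ≤ G x - δ → next Ĝ y ≤ Ĝ y - δ → Decreasing x y
        decreasing-near x y hG hĜ = decreasing x y 0ℚ 0ℚ 0ℚ (≤+0 hG) (≤+0 hĜ)
          (subst (_≤ Φ-next x y) (sym (ℚ.+-identityʳ (Φ (level x y)))) (Φ-submartingale x y))
          (ℚ.≤-reflexive (sym (ℚ.*-zeroʳ μ)))

        decreasing-deep : ∀ x y u v → u + v ≡ 0ℚ → next G x ≤ G x - δ + u → next Ĝ y ≤ Ĝ y - δ + v → Decreasing x y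
        decreasing-deep x y u v u+v≡0 hG hĜ = decreasing x y u v 0ℚ hG hĜ
          (subst (_≤ Φ-next x y) (sym (ℚ.+-identityʳ (Φ (level x y)))) (Φ-submartingale x y))
          (ℚ.≤-reflexive (trans u+v≡0 (sym (ℚ.*-zeroʳ μ))))

        decreasing-corner : ∀ x y u v → u + v ≡ κ * s → next G x ≤ G x - δ + u → next Ĝ y ≤ Ĝ y - δ + v →
          suc ℤ.∣ x ∣ ℕ.≤ 3 ℕ.* R → suc ℤ.∣ y ∣ ℕ.≤ 3 ℕ.* R → ιR²s² ≤ V x ⊎ ιR²s² ≤ V y → Decreasing x y
        decreasing-corner x y u v u+v≡κs hG hĜ hx hy hV = decreasing x y u v ιR²s² hG hĜ
          (Φ-corner x y ιR²s² hx hy hV)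
          (subst₂ _≤_ (sym u+v≡κs) (sym μ*ιR²s²) κs≤s)

        distance-++ : ∀ k l j → Distance (+ k) (+ l) j → k ℕ.+ 2 ℕ.* j ≡ l ℕ.+ 2 ℕ.* d
        distance-++ k l j = ℤ.+-injective

        distance-+- : ∀ k l j → Distance (+ k) -[1+ l ] j → k ℕ.+ 2 ℕ.* j ℕ.+ suc l ≡ 2 ℕ.* d
        distance-+- k l j h = ℤ.+-injective (trans (cong (ℤ._+ + suc l) h) (lemma (+ suc l) (+ (2 ℕ.* d))))
          where
          lemma : ∀ a b → ℤ.- a ℤ.+ b ℤ.+ a ≡ b
          lemma = ℤ-solver.solve-∀

        distance--- : ∀ k l j → Distance -[1+ k ] -[1+ l ] j → suc l ℕ.+ 2 ℕ.* j ≡ suc k ℕ.+ 2 ℕ.* d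
        distance--- k l j h = ℤ.+-injective (trans (sym (lemma (+ suc k) (+ suc l) (+ (2 ℕ.* j))))
            (trans (cong (ℤ._+ (+ suc k ℤ.+ + suc l)) h) (lemma′ (+ suc k) (+ suc l) (+ (2 ℕ.* d)))))
          where
          lemma : ∀ a b u → ℤ.- a ℤ.+ u ℤ.+ (a ℤ.+ b) ≡ b ℤ.+ u
          lemma = ℤ-solver.solve-∀
          lemma′ : ∀ a b u → ℤ.- b ℤ.+ u ℤ.+ (a ℤ.+ b) ≡ a ℤ.+ u
          lemma′ = ℤ-solver.solve-∀

        R+R<3R : suc (R ℕ.+ R) ℕ.≤ 3 ℕ.* R
        R+R<3R = subst₂ ℕ._≤_ (ℕ.+-comm (R ℕ.+ R) 1) (lemma R) (ℕ.+-monoʳ-≤ (R ℕ.+ R) (ℕ.>-nonZero⁻¹ R))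
          where
          lemma : ∀ R → R ℕ.+ R ℕ.+ R ≡ 3 ℕ.* R
          lemma = ℕ-solver.solve-∀

        -- Before the meeting the gap is at least 2, hence k + 2 ≤ l + 2d ≤ 3R.
        corner-bound : ∀ k l j → k ℕ.+ 2 ℕ.* suc j ≡ l ℕ.+ 2 ℕ.* d → l ℕ.≤ R ℕ.+ R → suc k ℕ.≤ 3 ℕ.* R
        corner-bound k l j eq l≤2R = begin
            suc k                 ≡⟨ ℕ.+-comm 1 k ⟩
            k ℕ.+ 1               ≤⟨ ℕ.+-monoʳ-≤ k (ℕ.s≤s (ℕ.z≤n {j ℕ.+ 1 ℕ.* suc j})) ⟩
            k ℕ.+ 2 ℕ.* suc j     ≡⟨ eq ⟩
            l ℕ.+ 2 ℕ.* d         ≤⟨ ℕ.+-mono-≤ l≤2R 2d≤R ⟩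
            R ℕ.+ R ℕ.+ R         ≡⟨ lemma R ⟩
            3 ℕ.* R               ∎
          where
          open ℕ.≤-Reasoning
          lemma : ∀ R → R ℕ.+ R ℕ.+ R ≡ 3 ℕ.* R
          lemma = ℕ-solver.solve-∀

        -- If y < 0, then x + |y| ≤ 2d ≤ R, which contradicts x > R. If y ≤ 2R, both walks are
        -- within 3R and `Φ` pays for the excess κ s of `G`. If y > 2R, the drift -κ s of `Ĝ`
        -- cancels it.
        far-x : ∀ i y j → R ℕ.≤ i → Distance (+ suc i) y (suc j) → Decreasing (+ suc i) y
        far-x i -[1+ l ] j R≤i dist = contradiction
          (subst (suc i ℕ.≤_) (distance-+- (suc i) l (suc j) dist)
            (ℕ.≤-trans (ℕ.m≤m+n (suc i) (2 ℕ.* suc j)) (ℕ.m≤m+n (suc i ℕ.+ 2 ℕ.* suc j) (suc l))))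
          (ℕ.<⇒≱ (ℕ.s≤s (ℕ.≤-trans 2d≤R R≤i)))
        far-x i (+ l) j R≤i dist = [ near , deep l ]′ (ℕ.≤-<-connex l (R ℕ.+ R))
          where
          ndist : suc i ℕ.+ 2 ℕ.* suc j ≡ l ℕ.+ 2 ℕ.* d
          ndist = distance-++ (suc i) l (suc j) dist
          strip : ∀ {l} {X : Set} → (∃[ k ] + l ≡ -[1+ k ] × R ℕ.≤ k) ⊎ X → X
          strip (inj₁ (_ , () , _))
          strip (inj₂ h) = h
          near : l ℕ.≤ R ℕ.+ R → Decreasing (+ suc i) (+ l)
          near l≤2R = decreasing-corner (+ suc i) (+ l) (κ * s) 0ℚ (ℚ.+-identityʳ (κ * s))
            (next-G-far R≤i) (≤+0 (strip {l} (next-Ĝ (+ l))))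
            (corner-bound (suc i) l j ndist l≤2R) (ℕ.≤-trans (ℕ.s≤s l≤2R) R+R<3R) (inj₁ (V-far⁺ R≤i))
          deep : ∀ l → R ℕ.+ R ℕ.< l → Decreasing (+ suc i) (+ l)
          deep (suc l) (ℕ.s≤s 2R≤l) = decreasing-deep (+ suc i) (+ suc l) (κ * s) (- (κ * s)) (ℚ.+-inverseʳ (κ * s))
            (next-G-far R≤i) (next-Ĝ-deep 2R≤l)

        -- The mirror image of `far-x`, with (-y, -x) in place of (x, y).
        far-y : ∀ x i j → R ℕ.≤ i → Distance x -[1+ i ] (suc j) → Decreasing x -[1+ i ]
        far-y (+ k) i j R≤i dist = contradiction
          (subst (suc i ℕ.≤_) (distance-+- k i (suc j) dist) (ℕ.m≤n+m (suc i) (k ℕ.+ 2 ℕ.* suc j)))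
          (ℕ.<⇒≱ (ℕ.s≤s (ℕ.≤-trans 2d≤R R≤i)))
        far-y -[1+ k ] i j R≤i dist = [ near , deep ]′ (ℕ.<-≤-connex k (R ℕ.+ R))
          where
          ndist : suc i ℕ.+ 2 ℕ.* suc j ≡ suc k ℕ.+ 2 ℕ.* d
          ndist = distance--- k i (suc j) dist
          strip : ∀ {X : Set} → (∃[ l ] -[1+ k ] ≡ + suc l × R ℕ.≤ l) ⊎ X → X
          strip (inj₁ (_ , () , _))
          strip (inj₂ h) = h
          near : k ℕ.< R ℕ.+ R → Decreasing -[1+ k ] -[1+ i ]
          near k<2R = decreasing-corner -[1+ k ] -[1+ i ] 0ℚ (κ * s) (ℚ.+-identityˡ (κ * s))
            (≤+0 (strip (next-G -[1+ k ]))) (next-Ĝ-far R≤i)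
            (ℕ.≤-trans (ℕ.s≤s k<2R) R+R<3R) (corner-bound (suc i) (suc k) j ndist k<2R) (inj₂ (V-far⁻ R≤i))
          deep : R ℕ.+ R ℕ.≤ k → Decreasing -[1+ k ] -[1+ i ]
          deep 2R≤k = decreasing-deep -[1+ k ] -[1+ i ] (- (κ * s)) (κ * s) (ℚ.+-inverseˡ (κ * s))
            (next-G-deep 2R≤k) (next-Ĝ-far R≤i)

        drift-f : ∀ x y j → Distance x y (suc j) → Decreasing x y
        drift-f x y j dist = [ (λ { (i , refl , R≤i) → far-x i y j R≤i dist })
          , (λ hG → [ (λ { (i , refl , R≤i) → far-y x i j R≤i dist })
                    , decreasing-near x y hG ]′ (next-Ĝ y)) ]′ (next-G x)

        -- Nonnegativity of the Lyapunov function

        1+θ D : ℚ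
        1+θ = 1ℚ + + 1 / 4 * κ
        D = ι (2 ℕ.* d)

        0≤1+θ : 0ℚ ≤ 1+θ
        0≤1+θ = 0≤+ (ℚ.nonNegative⁻¹ 1ℚ) (0≤* (ℚ.nonNegative⁻¹ (+ 1 / 4)) 0≤κ)

        0≤D : 0ℚ ≤ D
        0≤D = 0≤ι (2 ℕ.* d)

        gain-lower : ∀ k → - (s * w k) ≤ gain k
        gain-lower k = ≤-by (ε * w k + (s * w k - H s k)) (0≤+ (0≤* 0≤ε (0≤w k)) (≤⇒0≤- (H≤ 0≤s k)))
            (lemma (ε * w k) (s * w k) (H s k))
          where
          lemma : ∀ e a h → e + - 1ℚ * h ≡ - a + (e + (a - h))
          lemma = solve-∀ ring

        0≤pain : ∀ k → 0ℚ ≤ pain k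
        0≤pain k = 0≤+ (0≤* 0≤ε (0≤w k)) (0≤* 0≤ρ (0≤H (0≤σ (R ℕ.+ R)) k))

        -- Up to 2R the left-hand side is at most 0; beyond it, `H≥` at the scale 2R and `ρs₂-lower`
        -- apply.
        pain-lower : ∀ k → 1+θ * s * (w k - w (R ℕ.+ R)) ≤ pain k
        pain-lower k = [ shallow , deep ]′ (ℕ.≤-total k (R ℕ.+ R))
          where
          w₂ = w (R ℕ.+ R)
          shallow : k ℕ.≤ R ℕ.+ R → 1+θ * s * (w k - w₂) ≤ pain k
          shallow h = ℚ.≤-trans
              (≤-by (1+θ * s * (w₂ - w k)) (0≤* (0≤* 0≤1+θ 0≤s) (≤⇒0≤- (w-mono h))) (lemma (1+θ * s) (w k) w₂))
              (0≤pain k)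
            where
            lemma : ∀ c a b → 0ℚ ≡ c * (a - b) + c * (b - a)
            lemma = solve-∀ ring
          deep : R ℕ.+ R ℕ.≤ k → 1+θ * s * (w k - w₂) ≤ pain k
          deep h = begin
              1+θ * s * (w k - w₂)       ≤⟨ *-monoʳ (≤⇒0≤- (w-mono h)) ρs₂-lower ⟩
              ρ * s₂ * (w k - w₂)        ≡⟨ ℚ.*-assoc ρ s₂ (w k - w₂) ⟩
              ρ * (s₂ * (w k - w₂))      ≤⟨ *-monoˡ 0≤ρ (H≥ (R ℕ.+ R) k) ⟩
              ρ * H s₂ k                 ≤⟨ ≤-by (ε * w k) (0≤* 0≤ε (0≤w k)) (ℚ.+-comm (ε * w k) (ρ * H s₂ k)) ⟩
              pain k                     ∎
            where open ℚ.≤-Reasoning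

        -- The factor is 2 L μ with L = 72 Q and μ = 1/Q.
        μΦ≤ : ∀ {t B} → 0ℚ ≤ B → t ≤ B → μ * Φ t ≤ + 144 / 1 * B
        μΦ≤ {t} {B} 0≤B t≤B = ℚ.≤-trans (*-monoˡ 0≤μ (Φ≤linear 0≤B t≤B))
            (ℚ.≤-reflexive (trans (lemma μ Q B) (trans (cong (λ z → + 144 / 1 * (z * B)) (*-inv Q 0<Q))
              (cong (+ 144 / 1 *_) (ℚ.*-identityˡ B)))))
          where
          lemma : ∀ m Q B → m * ((+ 36 / 1 * Q + + 36 / 1 * Q) * B + (+ 36 / 1 * Q + + 36 / 1 * Q) * B)
            ≡ + 144 / 1 * (Q * m * B)
          lemma = solve-∀ ring

        -- Up to `R` this is monotonicity of σ, and from `R` on that of σ_k / (k + 1).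
        Rσ≤ : ∀ k → ι R * σ k ≤ s * (ι R + ι k)
        Rσ≤ k = [ small , large ]′ (ℕ.≤-total k R)
          where
          small : k ℕ.≤ R → ι R * σ k ≤ s * (ι R + ι k)
          small h = ≤-by (ι R * (s - σ k) + s * ι k) (0≤+ (0≤* (0≤ι R) (≤⇒0≤- (σ-mono h))) (0≤* 0≤s (0≤ι k)))
              (lemma (ι R) (ι k) s (σ k))
            where
            lemma : ∀ R k s σ → s * (R + k) ≡ R * σ + (R * (s - σ) + s * k)
            lemma = solve-∀ ring
          large : R ℕ.≤ k → ι R * σ k ≤ s * (ι R + ι k)
          large h = ≤-by ((ι (suc k) * s - ι (suc R) * σ k) + σ k + (ι R - 1ℚ) * s)
              (0≤+ (0≤+ (≤⇒0≤- (σ-concave h)) (0≤σ k)) (0≤* (≤⇒0≤- (1≤ι R)) 0≤s))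
              (lemma (ι R) (ι k) s (σ k))
            where
            lemma : ∀ R k s σ → s * (R + k) ≡ R * σ + (((1ℚ + k) * s - (1ℚ + R) * σ) + σ + (R - 1ℚ) * s)
            lemma = solve-∀ ring

        -- `quadratic-bound` is multiplied by 16, so D k σ_k has the coefficient 16 · 144 = 2304
        -- there. The constant 2336 = 2304 + 32 leaves a share for the terms s D k, which stem from
        -- `w-lipschitz`; the weights 72/73 and 1/73 are these two shares.
        Dσ≤ : ∀ k → + 2336 / 1 * D * σ k ≤ κ * (s * (ι R + ι k))
        Dσ≤ k = begin
          + 2336 / 1 * D * σ k       ≤⟨ *-monoʳ (0≤σ k) small-d ⟩
          κ * ι R * σ k              ≡⟨ ℚ.*-assoc κ (ι R) (σ k) ⟩
          κ * (ι R * σ k)            ≤⟨ *-monoˡ 0≤κ (Rσ≤ k) ⟩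
          κ * (s * (ι R + ι k))      ∎
          where open ℚ.≤-Reasoning

        -- At most 2d increments of `S` separate `l` from `k`, and by `S-diff` each is at most k
        -- σ_k.
        S-behind : ∀ k l → k ℕ.≤ 2 ℕ.* d ℕ.+ l → S k ≤ S l + D * (ι k * σ k)
        S-behind k l h = [ below , above ]′ (ℕ.≤-total k l)
          where
          0≤kσ : 0ℚ ≤ ι k * σ k
          0≤kσ = 0≤* (0≤ι k) (0≤σ k)
          below : k ℕ.≤ l → S k ≤ S l + D * (ι k * σ k)
          below k≤l = ℚ.≤-trans (S-mono k≤l) (≤-by (D * (ι k * σ k)) (0≤* 0≤D 0≤kσ) refl)
          above : l ℕ.≤ k → S k ≤ S l + D * (ι k * σ k)
          above l≤k = ℚ.≤-trans
            (subst (λ m → S m ≤ S l + ι (k ℕ.∸ l) * (ι m * σ m)) (ℕ.m∸n+n≡m l≤k) (S-diff (k ℕ.∸ l) l))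
            (ℚ.+-monoʳ-≤ (S l) (*-monoʳ 0≤kσ (ι-mono (ℕ.m≤n+o⇒m∸n≤o k l
              (ℕ.≤-trans h (ℕ.≤-reflexive (ℕ.+-comm (2 ℕ.* d) l)))))))

        -- Sixteen times the right-hand side is κ s (k − R/2)² plus nonnegative terms: A is chosen to
        -- absorb all terms of order R² s, and small-d those in which D occurs.
        quadratic-bound : ∀ k → 0ℚ ≤ A + (- (s * w k) + 1+θ * s * (w k - D * ι k - w (R ℕ.+ R)))
          - + 144 / 1 * (W + D * (ι k * σ k))
        quadratic-bound k = *-cancelˡ (ℚ.positive⁻¹ (+ 16 / 1)) (≤-by t 0≤t (trans
            (cong (λ z → + 16 / 1 * (A + (- (s * w k) + 1+θ * s * (w k - D * ι k - ½ * (z * (1ℚ + z))))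
              - + 144 / 1 * (W + D * (ι k * σ k)))) (ι-+ R R))
            (lemma (ι k) (ι R) s D (σ k) κ)))
          where
          x = ι k
          y = ι R
          a b c t : ℚ
          a = κ * (s * (y + x)) - + 2336 / 1 * D * σ k
          b = κ * y - + 2336 / 1 * D
          c = 1ℚ - + 5 / 1 * κ
          t = + 72 / 73 * (x * a) + + 1 / 73 * (s * x * b)
            + (+ 16 / 1 * c + + 76 / 1 * κ) * (s * (D * x))
            + (+ 16 / 1 * c + + 76 / 1 * κ) * (s * (½ * ((y + y) * (1ℚ + (y + y)))))
            + + 32 / 1 * (s * (y * (y - 1ℚ)))
            + + 1 / 20 * (c * (y * y * s))
            + κ * (s * ((x - ½ * y) * (x - ½ * y)))
            + + 2 / 1 * (κ * (s * x)) + + 1 / 73 * (κ * (s * (x * x)))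
            + + 259199 / 20 * (y * y * s)
          0≤c = 0≤1-5κ
          p : ∀ {q} n .{{_ : ℕ.NonZero n}} m → 0ℚ ≤ q → 0ℚ ≤ (+ m / n) * q
          p n m h = 0≤* (ℚ.nonNegative⁻¹ (+ m / n) {{ℚ.normalize-nonNeg m n}}) h
          0≤e : 0ℚ ≤ + 16 / 1 * c + + 76 / 1 * κ
          0≤e = 0≤+ (p 1 16 0≤c) (p 1 76 0≤κ)
          0≤t : 0ℚ ≤ t
          0≤t = 0≤+ (0≤+ (0≤+ (0≤+ (0≤+ (0≤+ (0≤+ (0≤+ (0≤+
            (p 73 72 (0≤* (0≤ι k) (≤⇒0≤- (Dσ≤ k))))
            (p 73 1 (0≤* (0≤* 0≤s (0≤ι k)) (≤⇒0≤- small-d))))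
            (0≤* 0≤e (0≤* 0≤s (0≤* 0≤D (0≤ι k)))))
            (0≤* 0≤e (0≤* 0≤s (p 2 1 (0≤* (0≤+ (0≤ι R) (0≤ι R)) (ℚ.<⇒≤ (0<2k+1 R)))))))
            (p 1 32 (0≤* 0≤s (0≤* (0≤ι R) (≤⇒0≤- (1≤ι R))))))
            (p 20 1 (0≤* 0≤c 0≤Q)))
            (0≤* 0≤κ (0≤* 0≤s (0≤p² (x - ½ * y)))))
            (p 1 2 (0≤* 0≤κ (0≤* 0≤s (0≤ι k)))))
            (p 73 1 (0≤* 0≤κ (0≤* 0≤s (0≤p² x)))))
            (p 20 259199 0≤Q)
          lemma : ∀ x y s D σ κ →
            + 16 / 1 * (+ 6000 / 1 * (y * y * s) + (- (s * (½ * (x * (1ℚ + x))))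
              + (1ℚ + + 1 / 4 * κ) * s * (½ * (x * (1ℚ + x)) - D * x - ½ * ((y + y) * (1ℚ + (y + y)))))
              - + 144 / 1 * (+ 36 / 1 * (y * y * s) + D * (x * σ)))
            ≡ + 16 / 1 * 0ℚ + (+ 72 / 73 * (x * (κ * (s * (y + x)) - + 2336 / 1 * D * σ)) + + 1 / 73 * (s * x * (κ * y - + 2336 / 1 * D))
            + (+ 16 / 1 * (1ℚ - + 5 / 1 * κ) + + 76 / 1 * κ) * (s * (D * x))
            + (+ 16 / 1 * (1ℚ - + 5 / 1 * κ) + + 76 / 1 * κ) * (s * (½ * ((y + y) * (1ℚ + (y + y)))))
            + + 32 / 1 * (s * (y * (y - 1ℚ)))
            + + 1 / 20 * ((1ℚ - + 5 / 1 * κ) * (y * y * s))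
            + κ * (s * ((x - ½ * y) * (x - ½ * y)))
            + + 2 / 1 * (κ * (s * x)) + + 1 / 73 * (κ * (s * (x * x)))
            + + 259199 / 20 * (y * y * s))
          lemma = solve-∀ ring

        -- One walk follows the other: it is at distance `k` on its `gain` side, the other at
        -- distance `l` on its `pain` side. Naming the level `t` lets the lemma serve for X behind Y
        -- and, with the roles exchanged, for Y behind X.
        behind≥0 : ∀ k l t → k ℕ.≤ 2 ℕ.* d ℕ.+ l → t ≤ S k - S l + W →
          0ℚ ≤ A + (gain k + pain l) + - μ * Φ t
        behind≥0 k l t k≤ t≤ = ℚ.≤-trans (quadratic-bound k) (≤-by
            ((gain k - - (s * w k)) + (pain l - 1+θ * s * (w l - w₂))
              + 1+θ * s * (w l + D * ι k - w k) + (+ 144 / 1 * B - μ * Φ t))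
            (0≤+ (0≤+ (0≤+ (≤⇒0≤- (gain-lower k)) (≤⇒0≤- (pain-lower l)))
              (0≤* (0≤* 0≤1+θ 0≤s) (≤⇒0≤- (w-lipschitz k l (2 ℕ.* d) k≤))))
              (≤⇒0≤- (μΦ≤ 0≤B t≤B)))
            (lemma A (gain k) (pain l) μ (Φ t) (s * w k) (1+θ * s) (w k) (w l) (D * ι k) w₂ B))
          where
          w₂ = w (R ℕ.+ R)
          B = W + D * (ι k * σ k)
          0≤B : 0ℚ ≤ B
          0≤B = 0≤+ 0≤W (0≤* 0≤D (0≤* (0≤ι k) (0≤σ k)))
          lemma₀ : ∀ a b c W → b + c - b + W ≡ W + c
          lemma₀ = solve-∀ ring
          t≤B : t ≤ B
          t≤B = ℚ.≤-trans t≤ (ℚ.≤-trans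
            (ℚ.+-monoˡ-≤ W (ℚ.+-monoˡ-≤ (- S l) (S-behind k l k≤)))
            (ℚ.≤-reflexive (lemma₀ (S k) (S l) (D * (ι k * σ k)) W)))
          lemma : ∀ A g p m Φ sw c wk wl Dk w₂ B → A + (g + p) + - m * Φ
            ≡ A + (- sw + c * (wk - Dk - w₂)) - + 144 / 1 * B
              + ((g - - sw) + (p - c * (wl - w₂)) + c * (wl + Dk - wk) + (+ 144 / 1 * B - m * Φ))
          lemma = solve-∀ ring

        sw≤Q : ∀ {k} → k ℕ.≤ R → s * w k ≤ Q
        sw≤Q {k} k≤R = ℚ.≤-trans (*-monoˡ 0≤s (w-mono k≤R))
            (≤-by (½ * (ι R * (ι R - 1ℚ)) * s)
              (0≤* (0≤* (ℚ.nonNegative⁻¹ ½) (0≤* (0≤ι R) (≤⇒0≤- (1≤ι R)))) 0≤s) (lemma (ι R) s))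
          where
          lemma : ∀ R s → R * R * s ≡ s * (½ * (R * (1ℚ + R))) + ½ * (R * (R - 1ℚ)) * s
          lemma = solve-∀ ring

        -- Both walks have moved towards each other, by at most 2d ≤ R in total, so each `gain` is
        -- at least -Q. As `Φ` costs at most 144 · 38 Q, the constant `A` leaves (6000 - 2 - 5472) Q
        -- = 526 Q.
        approaching≥0 : ∀ k l t → k ℕ.≤ R → l ℕ.≤ R → t ≤ S k + S l + W →
          0ℚ ≤ A + (gain k + gain l) + - μ * Φ t
        approaching≥0 k l t k≤R l≤R t≤ = ≤-by
            ((gain k - - (s * w k)) + (gain l - - (s * w l)) + (Q - s * w k) + (Q - s * w l)
              + (+ 144 / 1 * B - μ * Φ t) + + 526 / 1 * Q)
            (0≤+ (0≤+ (0≤+ (0≤+ (0≤+ (≤⇒0≤- (gain-lower k)) (≤⇒0≤- (gain-lower l)))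
              (≤⇒0≤- (sw≤Q k≤R))) (≤⇒0≤- (sw≤Q l≤R))) (≤⇒0≤- (μΦ≤ 0≤B t≤B)))
              (0≤* (ℚ.nonNegative⁻¹ (+ 526 / 1)) 0≤Q))
            (lemma Q (gain k) (gain l) μ (Φ t) (s * w k) (s * w l))
          where
          B = + 38 / 1 * Q
          0≤B : 0ℚ ≤ B
          0≤B = 0≤* (ℚ.nonNegative⁻¹ (+ 38 / 1)) 0≤Q
          S≤Q : ∀ {k} → k ℕ.≤ R → S k ≤ Q
          S≤Q k≤R = ℚ.≤-trans (S≤ (ℕ.m≤n⇒m≤1+n k≤R)) (sw≤Q k≤R)
          lemma₀ : ∀ Q → Q + Q + + 36 / 1 * Q ≡ + 38 / 1 * Q
          lemma₀ = solve-∀ ring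
          t≤B : t ≤ B
          t≤B = ℚ.≤-trans t≤ (ℚ.≤-trans (ℚ.+-monoˡ-≤ W (ℚ.+-mono-≤ (S≤Q k≤R) (S≤Q l≤R)))
            (ℚ.≤-reflexive (lemma₀ Q)))
          lemma : ∀ Q g h m Φ a b → + 6000 / 1 * Q + (g + h) + - m * Φ
            ≡ 0ℚ + ((g - - a) + (h - - b) + (Q - a) + (Q - b) + (+ 144 / 1 * (+ 38 / 1 * Q) - m * Φ) + + 526 / 1 * Q)
          lemma = solve-∀ ring

        -- Both `pain` terms are nonnegative, and 6000 - 144 · 36 = 816.
        receding≥0 : ∀ k l t → t ≤ W → 0ℚ ≤ A + (pain k + pain l) + - μ * Φ t
        receding≥0 k l t t≤W = ≤-by
            (pain k + pain l + (+ 144 / 1 * W - μ * Φ t) + + 816 / 1 * Q)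
            (0≤+ (0≤+ (0≤+ (0≤pain k) (0≤pain l)) (≤⇒0≤- (μΦ≤ 0≤W t≤W)))
              (0≤* (ℚ.nonNegative⁻¹ (+ 816 / 1)) 0≤Q))
            (lemma Q (pain k) (pain l) μ (Φ t))
          where
          lemma : ∀ Q g h m Φ → + 6000 / 1 * Q + (g + h) + - m * Φ
            ≡ 0ℚ + (g + h + (+ 144 / 1 * (+ 36 / 1 * Q) - m * Φ) + + 816 / 1 * Q)
          lemma = solve-∀ ring

        f≥0 : ∀ x y j → Distance x y j → 0ℚ ≤ f x y
        f≥0 (+ k) (+ l) j dist = behind≥0 k l (level (+ k) (+ l))
          (ℕ.≤-trans (ℕ.m≤m+n k (2 ℕ.* j)) (ℕ.≤-reflexive (trans (distance-++ k l j dist) (ℕ.+-comm l (2 ℕ.* d)))))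
          ℚ.≤-refl
        f≥0 (+ k) -[1+ l ] j dist = approaching≥0 k (suc l) (level (+ k) -[1+ l ])
            (ℕ.≤-trans (ℕ.≤-trans (ℕ.m≤m+n k (2 ℕ.* j)) (ℕ.m≤m+n (k ℕ.+ 2 ℕ.* j) (suc l))) sum≤R)
            (ℕ.≤-trans (ℕ.m≤n+m (suc l) (k ℕ.+ 2 ℕ.* j)) sum≤R)
            (ℚ.≤-reflexive (lemma (S k) (S (suc l)) W))
          where
          sum≤R : k ℕ.+ 2 ℕ.* j ℕ.+ suc l ℕ.≤ R
          sum≤R = ℕ.≤-trans (ℕ.≤-reflexive (distance-+- k l j dist)) 2d≤R
          lemma : ∀ a b W → a - - b + W ≡ a + b + W
          lemma = solve-∀ ring
        f≥0 -[1+ k ] (+ l) j dist = receding≥0 (suc k) l (level -[1+ k ] (+ l))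
            (≤-by (S (suc k) + S l) (0≤+ (0≤S (suc k)) (0≤S l)) (lemma (S (suc k)) (S l) W))
          where
          lemma : ∀ a b W → W ≡ - a - b + W + (a + b)
          lemma = solve-∀ ring
        f≥0 -[1+ k ] -[1+ l ] j dist = subst (λ z → 0ℚ ≤ A + z + - μ * Φ (level -[1+ k ] -[1+ l ]))
            (ℚ.+-comm (gain (suc l)) (pain (suc k)))
            (behind≥0 (suc l) (suc k) (level -[1+ k ] -[1+ l ])
              (ℕ.≤-trans (ℕ.m≤m+n (suc l) (2 ℕ.* j))
                (ℕ.≤-reflexive (trans (distance--- k l j dist) (ℕ.+-comm (suc k) (2 ℕ.* d)))))
              (ℚ.≤-reflexive (lemma (S (suc k)) (S (suc l)) W)))
          where
          lemma : ∀ a b W → - a - - b + W ≡ b - a + W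
          lemma = solve-∀ ring

        f-origin : f (+ 0) (+ 0) ≤ A
        f-origin = ≤-by (μ * Φ (level (+ 0) (+ 0))) (0≤* 0≤μ (0≤Φ (level (+ 0) (+ 0))))
            (lemma A ε ρ μ (Φ (level (+ 0) (+ 0))))
          where
          lemma : ∀ A e ρ m Φ → A ≡ A + ((e * (½ * (0ℚ * (1ℚ + 0ℚ))) + - 1ℚ * 0ℚ) + (e * (½ * (0ℚ * (1ℚ + 0ℚ))) + ρ * 0ℚ))
            + - m * Φ + m * Φ
          lemma = solve-∀ ring

        0≤δ+δ : 0ℚ ≤ δ + δ
        0≤δ+δ = 0≤+ (0≤* 0≤ε 0≤κ) (0≤* 0≤ε 0≤κ)

        meeting-time : ∀ n → (δ + δ) * 𝔼min n (+ 0) (+ 0) ≤ A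
        meeting-time n = ℚ.≤-trans (foster f (δ + δ) 0≤δ+δ f≥0 drift-f n (+ 0) (+ 0) d refl) f-origin

    -- An upper bound for powers of σ

    module Growth (j : ℕ) (5jκ≤1 : + 5 / 1 * (ι j * κ) ≤ 1ℚ) where

      -- With k = i + 1, `σ-rec` gives k (k + 1 + κ)(σ_k - σ_(k-1)) = κ (2k + 1) σ_k. It remains to
      -- multiply by j and use 5jκ ≤ 1 and 2k + 1 ≤ 5k.
      σ-growth-upper : ∀ i → ι j * (ι (suc (suc i)) * (σ (suc i) - σ i)) ≤ σ (suc i)
      σ-growth-upper i = *-cancelˡ (0<* (ℚ.positive⁻¹ (+ 5 / 1)) (0<1+ (0≤ι i))) (begin
          + 5 / 1 * k * (ι j * ((1ℚ + k) * (q - p)))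
            ≤⟨ ≤-by (+ 5 / 1 * (ι j * (κ * (k * (q - p)))))
                 (0≤* (ℚ.nonNegative⁻¹ (+ 5 / 1)) (0≤* (0≤ι j) (0≤* 0≤κ (0≤* (0≤ι (suc i)) (≤⇒0≤- (σ-step i))))))
                 (lemma₁ k (ι j) κ p q) ⟩
          + 5 / 1 * (ι j * ((1ℚ + k + κ) * k * q - (1ℚ + k + κ) * k * p))
            ≡⟨ cong (λ z → + 5 / 1 * (ι j * ((1ℚ + k + κ) * k * q - z))) (σ-rec i) ⟨
          + 5 / 1 * (ι j * ((1ℚ + k + κ) * k * q - (k - κ) * (1ℚ + k) * q))
            ≡⟨ lemma₂ k (ι j) κ q ⟩
          + 5 / 1 * (ι j * κ) * ((1ℚ + (k + k)) * q)
            ≤⟨ *-monoʳ (0≤* (ℚ.<⇒≤ (0<2k+1 (suc i))) (0≤σ (suc i))) 5jκ≤1 ⟩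
          1ℚ * ((1ℚ + (k + k)) * q)
            ≤⟨ ≤-by ((+ 2 / 1 + + 3 / 1 * ι i) * q)
                 (0≤* (0≤+ (ℚ.nonNegative⁻¹ (+ 2 / 1)) (0≤* (ℚ.nonNegative⁻¹ (+ 3 / 1)) (0≤ι i))) (0≤σ (suc i)))
                 (lemma₃ (ι i) q) ⟩
          + 5 / 1 * k * q ∎)
        where
        open ℚ.≤-Reasoning
        k = ι (suc i)
        q = σ (suc i)
        p = σ i
        lemma₁ : ∀ k j κ p q → + 5 / 1 * (j * ((1ℚ + k + κ) * k * q - (1ℚ + k + κ) * k * p))
          ≡ + 5 / 1 * k * (j * ((1ℚ + k) * (q - p))) + + 5 / 1 * (j * (κ * (k * (q - p))))
        lemma₁ = solve-∀ ring
        lemma₂ : ∀ k j κ q → + 5 / 1 * (j * ((1ℚ + k + κ) * k * q - (k - κ) * (1ℚ + k) * q))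
          ≡ + 5 / 1 * (j * κ) * ((1ℚ + (k + k)) * q)
        lemma₂ = solve-∀ ring
        lemma₃ : ∀ i q → + 5 / 1 * (1ℚ + i) * q
          ≡ 1ℚ * ((1ℚ + ((1ℚ + i) + (1ℚ + i))) * q) + (+ 2 / 1 + + 3 / 1 * i) * q
        lemma₃ = solve-∀ ring

      -- By Bernoulli's inequality and `σ-growth-upper`, (σ_(k-1) / σ_k)^j ≥ 1 - 1/(k + 1). Hence
      -- the j-th power gains at most the factor (k + 1)/k at step k, and the product telescopes.
      σ^j≤ : ∀ k → σ k ^ j ≤ ι (suc k)
      σ^j≤ zero = ℚ.≤-reflexive (1^ j)
        where
        1^ : ∀ n → 1ℚ ^ n ≡ 1ℚ
        1^ zero    = refl
        1^ (suc n) = trans (ℚ.*-identityˡ (1ℚ ^ n)) (1^ n)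
      σ^j≤ (suc i) = *-cancelˡ (0<* (0<σ (suc i)) (0<1+ (0≤ι i))) (begin
          q * k * q ^ j
            ≤⟨ ≤-by (q ^ j * (q - ι j * ((1ℚ + k) * (q - p))))
                 (0≤* (0≤^ j (0≤σ (suc i))) (≤⇒0≤- (σ-growth-upper i))) (lemma₁ k (ι j) p q (q ^ j)) ⟩
          (1ℚ + k) * (q ^ j * (q - ι j * (q - p)))
            ≤⟨ *-monoˡ (0≤ι (suc (suc i))) (bernoulli j (0≤σ i) (σ-step i)) ⟩
          (1ℚ + k) * (p ^ j * q)
            ≤⟨ *-monoˡ (0≤ι (suc (suc i))) (*-monoʳ (0≤σ (suc i)) (σ^j≤ i)) ⟩
          (1ℚ + k) * (k * q)
            ≡⟨ lemma₂ k q ⟩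
          q * k * (1ℚ + k) ∎)
        where
        open ℚ.≤-Reasoning
        k = ι (suc i)
        q = σ (suc i)
        p = σ i
        lemma₁ : ∀ k j p q Q → (1ℚ + k) * (Q * (q - j * (q - p)))
          ≡ q * k * Q + Q * (q - j * ((1ℚ + k) * (q - p)))
        lemma₁ = solve-∀ ring
        lemma₂ : ∀ k q → (1ℚ + k) * (k * q) ≡ q * k * (1ℚ + k)
        lemma₂ = solve-∀ ring

    -- The strategy and its expectations as real numbers

    strategy : Strategy
    strategy = record
      { a    = λ i → fromℚ (α i)
      ; 0≤a  = λ i ε 0<ε → 0 , λ _ _ → 0≤+ (0≤α i) (ℚ.<⇒≤ 0<ε)
      ; a≤1  = λ i ε 0<ε → 0 , λ _ _ → ≤-by ((1ℚ - α i) + ε) (0≤+ (0≤1-α i) (ℚ.<⇒≤ 0<ε)) (lemma (α i) ε)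
      ; a₀≈½ = half , half
      }
      where
      lemma : ∀ p e → 1ℚ + e ≡ p + ((1ℚ - p) + e)
      lemma = solve-∀ ring
      half : fromℚ ½ Defs.≤ fromℚ ½
      half ε 0<ε = 0 , λ _ _ → ≤-by ε (ℚ.<⇒≤ 0<ε) refl

    seq-stepProb : ∀ x t m → seq (stepProb strategy x t) m ≡ P x t
    seq-stepProb (+ k)    right m = refl
    seq-stepProb (+ k)    left  m = refl
    seq-stepProb -[1+ i ] right m = refl
    seq-stepProb -[1+ i ] left  m = refl

    -- Factoring the first step probability out of each branch turns the weighted sum into the
    -- recursion that defines `𝔼`.
    ∑-weighted : ∀ {n} x (g : Path n → ℚ) m →
      ∑ℚ (λ ω → seq (pathProb strategy x ω) m * g ω) ≡ 𝔼 x g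
    ∑-weighted {zero}  x g m = ℚ.*-identityˡ (g [])
    ∑-weighted {suc n} x g m = cong₂ _+_ (branch right) (branch left)
      where
      branch : ∀ t → ∑ℚ (λ ω → seq (pathProb strategy x (t ∷ ω)) m * g (t ∷ ω))
                   ≡ P x t * 𝔼 (move t x) (λ ω → g (t ∷ ω))
      branch t = trans
        (∑ℚ-cong λ ω → ℚ.*-assoc (seq (stepProb strategy x t) m) (seq (pathProb strategy (move t x) ω) m) (g (t ∷ ω)))
        (trans (∑ℚ-scale (seq (stepProb strategy x t) m) (λ ω → seq (pathProb strategy (move t x) ω) m * g (t ∷ ω)))
          (cong₂ _*_ (seq-stepProb x t m) (∑-weighted (move t x) (λ ω → g (t ∷ ω)) m)))

    module _ (d : ℕ) where

      open Meeting d

      -- All reals involved are given by constant sequences, so every approximation `m` is the same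
      -- exact rational mean.
      seq-𝔼min𝒯 : ∀ n m → seq (𝔼min𝒯 strategy d n) m ≡ 𝔼min n (+ 0) (+ 0)
      seq-𝔼min𝒯 n m = trans (seq-∑ outer m) (trans
          (∑ℚ-cong λ ω → trans (seq-∑ (inner ω) m) (trans
            (∑ℚ-cong λ ω′ → trans (ℚ.*-assoc (p ω) (p ω′) (+ min𝒯 d (+ 0) (+ 0) ω ω′ / 1))
              (cong (λ z → p ω * (p ω′ * z)) (ι≡/1 (min𝒯 d (+ 0) (+ 0) ω ω′))))
            (trans (∑ℚ-scale (p ω) (λ ω′ → p ω′ * ι (min𝒯 d (+ 0) (+ 0) ω ω′)))
              (cong (p ω *_) (∑-weighted (+ 0) (λ ω′ → ι (min𝒯 d (+ 0) (+ 0) ω ω′)) m)))))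
          (∑-weighted (+ 0) (λ ω → 𝔼 {n} (+ 0) λ ω′ → ι (min𝒯 d (+ 0) (+ 0) ω ω′)) m))
        where
        p : Path n → ℚ
        p ω = seq (pathProb strategy (+ 0) ω) m
        inner : Path n → Path n → ℝ
        inner ω ω′ = pathProb strategy (+ 0) ω Defs.* pathProb strategy (+ 0) ω′
          Defs.* fromℕ (min𝒯 d (+ 0) (+ 0) ω ω′)
        outer : Path n → ℝ
        outer ω = ∑ (inner ω)

    -- From the scale R = C d to the real power of d

    module Bound (j-1 : ℕ) (5jκ≤1 : + 5 / 1 * (ι (suc j-1) * κ) ≤ 1ℚ)
      (C : ℕ) (2≤C : 2 ℕ.≤ C) (C-large : + 4672 / 1 ≤ κ * ι C) where

      open Growth (suc j-1) 5jκ≤1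
      j : ℕ
      j = suc j-1

      -- This is δ + δ of `Lyapunov`, which is the same at all scales and can therefore enter a
      -- constant independent of `d`.
      rate : ℚ
      rate = + 1 / 32 * κ * κ + + 1 / 32 * κ * κ

      0<rate : 0ℚ < rate
      0<rate = ℚ.+-mono-< 0<δ 0<δ
        where
        0<δ : 0ℚ < + 1 / 32 * κ * κ
        0<δ = 0<* (0<* (ℚ.positive⁻¹ (+ 1 / 32)) 0<κ) 0<κ

      c : ℚ
      c = inv rate 0<rate * (+ 6000 / 1 * (ι C * ι C * ι (suc C)))

      0≤c : 0ℚ ≤ c
      0≤c = 0≤* (ℚ.<⇒≤ (0<inv rate 0<rate))
        (0≤* (ℚ.nonNegative⁻¹ (+ 6000 / 1)) (0≤* (0≤* (0≤ι C) (0≤ι C)) (0≤ι (suc C))))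

      module _ (d : ℕ) {{d≢0 : ℕ.NonZero d}} where

        open Meeting d

        mean-bound : ∀ n → rate * 𝔼min n (+ 0) (+ 0) ≤ + 6000 / 1 * (ι (C ℕ.* d) * ι (C ℕ.* d) * σ (C ℕ.* d))
        mean-bound = Lyapunov.Potential.meeting-time (C ℕ.* d)
            {{ℕ.m*n≢0 C d {{ℕ.>-nonZero (ℕ.<-≤-trans (ℕ.s≤s ℕ.z≤n) 2≤C)}}}} d (ℕ.*-monoˡ-≤ d 2≤C) small-d
          where
          lemma : ∀ d → + 2336 / 1 * ((1ℚ + (1ℚ + 0ℚ)) * d) ≡ + 4672 / 1 * d
          lemma = solve-∀ ring
          open ℚ.≤-Reasoning
          small-d : + 2336 / 1 * ι (2 ℕ.* d) ≤ κ * ι (C ℕ.* d)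
          small-d = begin
            + 2336 / 1 * ι (2 ℕ.* d)       ≡⟨ trans (cong (+ 2336 / 1 *_) (ι-* 2 d)) (lemma (ι d)) ⟩
            + 4672 / 1 * ι d               ≤⟨ *-monoʳ (0≤ι d) C-large ⟩
            κ * ι C * ι d                  ≡⟨ trans (ℚ.*-assoc κ (ι C) (ι d)) (cong (κ *_) (sym (ι-* C d))) ⟩
            κ * ι (C ℕ.* d)                ∎

        -- After passing to j-th powers, σ^j ≤ C d + 1 ≤ (C + 1) d: beyond d^(2j) only one more
        -- factor `d` is needed, which the hypothesis supplies.
        scale-bound : ∀ N l → N ℕ.^ j ℕ.* (d ℕ.^ j ℕ.* d ℕ.^ j ℕ.* d) ℕ.≤ suc l ℕ.^ j →
          ι N * (ι d * ι d * σ (C ℕ.* d)) ≤ ι (suc C) * ι (suc l)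
        scale-bound N l h = ^-cancel j-1 (0≤* (0≤ι (suc C)) (0≤ι (suc l))) (begin
            (ι N * (ι d * ι d * σR)) ^ j
              ≡⟨ trans (^-distrib-* (ι N) (ι d * ι d * σR) j) (cong (ι N ^ j *_)
                   (trans (^-distrib-* (ι d * ι d) σR j) (cong (_* σR ^ j) (^-distrib-* (ι d) (ι d) j)))) ⟩
            ι N ^ j * (ι d ^ j * ι d ^ j * σR ^ j)
              ≤⟨ *-monoˡ (0≤^ j (0≤ι N)) (*-monoˡ (0≤* (0≤^ j (0≤ι d)) (0≤^ j (0≤ι d)))
                   (ℚ.≤-trans (σ^j≤ (C ℕ.* d)) scale)) ⟩
            ι N ^ j * (ι d ^ j * ι d ^ j * (ι (suc C) * ι d))
              ≡⟨ lemma (ι N ^ j) (ι d ^ j) (ι (suc C)) (ι d) ⟩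
            ι (suc C) * (ι N ^ j * (ι d ^ j * ι d ^ j * ι d))
              ≡⟨ cong (ι (suc C) *_) powers ⟨
            ι (suc C) * ι (N ℕ.^ j ℕ.* (d ℕ.^ j ℕ.* d ℕ.^ j ℕ.* d))
              ≤⟨ *-monoˡ (0≤ι (suc C)) (ι-mono h) ⟩
            ι (suc C) * ι (suc l ℕ.^ j)
              ≡⟨ cong (ι (suc C) *_) (ι-^ (suc l) j) ⟩
            ι (suc C) * ι (suc l) ^ j
              ≤⟨ *-monoʳ (0≤^ j (0≤ι (suc l))) C≤C^j ⟩
            ι (suc C) ^ j * ι (suc l) ^ j
              ≡⟨ ^-distrib-* (ι (suc C)) (ι (suc l)) j ⟨
            (ι (suc C) * ι (suc l)) ^ j ∎)
          where
          open ℚ.≤-Reasoning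
          σR = σ (C ℕ.* d)
          scale : ι (suc (C ℕ.* d)) ≤ ι (suc C) * ι d
          scale = ℚ.≤-trans (ι-mono (ℕ.+-monoˡ-≤ (C ℕ.* d) (ℕ.>-nonZero⁻¹ d))) (ℚ.≤-reflexive (ι-* (suc C) d))
          lemma : ∀ a b c d → a * (b * b * (c * d)) ≡ c * (a * (b * b * d))
          lemma = solve-∀ ring
          powers : ι (N ℕ.^ j ℕ.* (d ℕ.^ j ℕ.* d ℕ.^ j ℕ.* d)) ≡ ι N ^ j * (ι d ^ j * ι d ^ j * ι d)
          powers = trans (ι-* (N ℕ.^ j) (d ℕ.^ j ℕ.* d ℕ.^ j ℕ.* d)) (cong₂ _*_ (ι-^ N j)
            (trans (ι-* (d ℕ.^ j ℕ.* d ℕ.^ j) d) (cong (_* ι d)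
              (trans (ι-* (d ℕ.^ j) (d ℕ.^ j)) (cong₂ _*_ (ι-^ d j) (ι-^ d j))))))
          C≤C^j : ι (suc C) ≤ ι (suc C) ^ j
          C≤C^j = ℚ.≤-trans (ℚ.≤-reflexive (sym (ℚ.*-identityʳ (ι (suc C)))))
            (*-monoˡ (0≤ι (suc C)) (1≤^ j-1))
            where
            1≤^ : ∀ n → 1ℚ ≤ ι (suc C) ^ n
            1≤^ zero    = ℚ.≤-refl
            1≤^ (suc n) = ℚ.≤-trans (1≤ι (suc C)) (ℚ.≤-trans (ℚ.≤-reflexive (sym (ℚ.*-identityʳ (ι (suc C)))))
              (*-monoˡ (0≤ι (suc C)) (1≤^ n)))

        -- The root is known only up to l + 1. The additional 1 costs `c`, which is at most N e once
        -- N is large.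
        root-bound : ∀ n N l e → N ℕ.^ j ℕ.* (d ℕ.^ j ℕ.* d ℕ.^ j ℕ.* d) ℕ.≤ suc l ℕ.^ j →
          c ≤ ι N * e → ι N * 𝔼min n (+ 0) (+ 0) ≤ c * ι l + ι N * e
        root-bound n N l e h c≤ = begin
            ι N * E₀
              ≡⟨ lemma₁ (ι N) E₀ ⟩
            ι N * (1ℚ * E₀)
              ≡⟨ cong (λ z → ι N * (z * E₀)) (*-inv rate 0<rate) ⟨
            ι N * (rate * i * E₀)
              ≡⟨ lemma₂ (ι N) rate i E₀ ⟩
            ι N * i * (rate * E₀)
              ≤⟨ *-monoˡ (0≤* (0≤ι N) 0≤i) (mean-bound n) ⟩
            ι N * i * (+ 6000 / 1 * (ι (C ℕ.* d) * ι (C ℕ.* d) * σR))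
              ≡⟨ cong (λ z → ι N * i * (+ 6000 / 1 * (z * z * σR))) (ι-* C d) ⟩
            ι N * i * (+ 6000 / 1 * (ι C * ι d * (ι C * ι d) * σR))
              ≡⟨ lemma₃ (ι N) i (ι C) (ι d) σR ⟩
            i * (+ 6000 / 1 * (ι C * ι C)) * (ι N * (ι d * ι d * σR))
              ≤⟨ *-monoˡ (0≤* 0≤i (0≤* (ℚ.nonNegative⁻¹ (+ 6000 / 1)) (0≤* (0≤ι C) (0≤ι C)))) (scale-bound N l h) ⟩
            i * (+ 6000 / 1 * (ι C * ι C)) * (ι (suc C) * ι (suc l))
              ≡⟨ lemma₄ i (ι C) (ι (suc C)) (ι l) ⟩
            c * ι l + c
              ≤⟨ ℚ.+-monoʳ-≤ (c * ι l) c≤ ⟩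
            c * ι l + ι N * e ∎
          where
          open ℚ.≤-Reasoning
          E₀ = 𝔼min n (+ 0) (+ 0)
          σR = σ (C ℕ.* d)
          i = inv rate 0<rate
          0≤i = ℚ.<⇒≤ (0<inv rate 0<rate)
          lemma₁ : ∀ a b → a * b ≡ a * (1ℚ * b)
          lemma₁ = solve-∀ ring
          lemma₂ : ∀ N rate i E → N * (rate * i * E) ≡ N * i * (rate * E)
          lemma₂ = solve-∀ ring
          lemma₃ : ∀ N i C d s → N * i * (+ 6000 / 1 * (C * d * (C * d) * s))
            ≡ i * (+ 6000 / 1 * (C * C)) * (N * (d * d * s))
          lemma₃ = solve-∀ ring
          lemma₄ : ∀ i C C₁ l → i * (+ 6000 / 1 * (C * C)) * (C₁ * (1ℚ + l))
            ≡ i * (+ 6000 / 1 * (C * C * C₁)) * l + i * (+ 6000 / 1 * (C * C * C₁))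
          lemma₄ = solve-∀ ring

        power-bound : ∀ (r : ℕ → ℚ) n m e →
          suc m ℕ.* (2 ℕ.* j ℕ.+ 1) ℕ.≤ scaledFloor (suc m) (r m) ℕ.* j → c ≤ ι (suc m) * e →
          𝔼min n (+ 0) (+ 0) ≤ c * powSeq d r m + e
        power-bound r n m e h c≤ = *-cancelˡ (0<1+ (0≤ι m)) (ℚ.≤-trans
            (root-bound n (suc m) l e (powRoot-lower d r m j h) c≤)
            (ℚ.≤-reflexive (trans (cong (λ z → c * z + ι (suc m) * e) (sym (/-*-ι l m)))
              (lemma c (+ l / suc m) (ι (suc m)) e))))
          where
          l = powRoot d r m
          lemma : ∀ c q N e → c * (q * N) + N * e ≡ N * (c * q + e)
          lemma = solve-∀ ring

  -- Choice of the parameters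

  theorem : (η : ℝ) (0<η : 0ℝ Defs.< η) →
    Σ[ 𝒶 ∈ Strategy ] Σ[ C ∈ ℝ ]
      ((d : ℕ) .{{_ : ℕ.NonZero d}} → 𝔼𝒯 𝒶 d ≤∞ C Defs.* pow d (2ℝ Defs.+ η) (0<⇒0≤2+ η 0<η))
  theorem η 0<η@(e₀ , 0<e₀ , N₁ , e₀≤η) = Chain.strategy κ 0<κ 5κ≤1 , fromℚ c , bound
    where
    v-1 v j M C : ℕ
    -- `v` is the denominator of `e₀`, so that 1/v ≤ e₀, and `e₀` is eventually a lower bound of the
    -- approximations of η.
    v-1 = ℕ.pred (↧ₙ e₀)
    v = suc v-1
    j = 2 ℕ.* v
    M = 5 ℕ.* j
    -- As 4672 = 2 · 2336 and κ = 1/M, this is the value at which `small-d` holds for R = C d.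
    C = 4672 ℕ.* M
    0<M : 0ℚ < ι M
    0<M = ℚ.<-≤-trans (ℚ.positive⁻¹ 1ℚ) (1≤ι M)
    κ : ℚ
    κ = inv (ι M) 0<M
    0<κ : 0ℚ < κ
    0<κ = 0<inv (ι M) 0<M
    5jκ≡1 : + 5 / 1 * (ι j * κ) ≡ 1ℚ
    5jκ≡1 = trans (sym (ℚ.*-assoc (+ 5 / 1) (ι j) κ)) (trans
      (cong (_* κ) (sym (ι-* 5 j))) (*-inv (ι M) 0<M))
    5jκ≤1 : + 5 / 1 * (ι j * κ) ≤ 1ℚ
    5jκ≤1 = ℚ.≤-reflexive 5jκ≡1
    5κ≤1 : + 5 / 1 * κ ≤ 1ℚ
    5κ≤1 = ℚ.≤-trans (*-monoˡ (ℚ.nonNegative⁻¹ (+ 5 / 1)) (ℚ.≤-trans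
      (ℚ.≤-reflexive (sym (ℚ.*-identityˡ κ))) (*-monoʳ (ℚ.<⇒≤ 0<κ) (1≤ι j)))) 5jκ≤1
    2≤C : 2 ℕ.≤ C
    2≤C = ℕ.≤-trans (ℕ.≤ᵇ⇒≤ 2 4672 _) (ℕ.m≤m*n 4672 M)
    C-large : + 4672 / 1 ≤ κ * ι C
    C-large = ℚ.≤-reflexive (sym (trans (cong (κ *_) (ι-* 4672 M)) (trans (lemma κ (ι 4672) (ι M))
        (trans (cong (ι 4672 *_) (*-inv (ι M) 0<M)) (trans (ℚ.*-identityʳ (ι 4672)) (sym (ι≡/1 4672)))))))
      where
      lemma : ∀ a b c → a * (b * c) ≡ b * (c * a)
      lemma = solve-∀ ring
    open Chain.Bound κ 0<κ 5κ≤1 (ℕ.pred j) 5jκ≤1 C 2≤C C-large hiding (j)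
    r : ℕ → ℚ
    r = seq (2ℝ Defs.+ η)
    r-lower : ∀ m → N₁ ℕ.≤ m → + 2 / 1 + + 1 / v ≤ r m
    r-lower m N₁≤m = ℚ.+-monoʳ-≤ (+ 2 / 1) (ℚ.≤-trans (1/↧≤ e₀ 0<e₀)
      (ℚ.≤-trans (ℚ.≤-reflexive (sym (ℚ.+-identityˡ e₀))) (e₀≤η m N₁≤m)))
    bound : (d : ℕ) .{{_ : ℕ.NonZero d}} → 𝔼𝒯 (Chain.strategy κ 0<κ 5κ≤1) d
      ≤∞ fromℚ c Defs.* pow d (2ℝ Defs.+ η) (0<⇒0≤2+ η 0<η)
    -- Matching on `suc` provides the instance for `power-bound`, the given one being irrelevant.
    -- The index `m` has to be large in three respects: `N₁` for the lower bound of η, `j` for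
    -- rounding the exponent and `K` for rounding the root.
    bound d@(suc _) n e 0<e = N₁ ℕ.+ (j ℕ.+ K) , λ m N≤m →
        subst (_≤ c * powSeq d r m + e) (sym (Chain.seq-𝔼min𝒯 κ 0<κ 5κ≤1 d n m))
          (power-bound d r n m e
            (scaledFloor-linear (r m) v m (r-lower m (ℕ.≤-trans (ℕ.m≤m+n N₁ (j ℕ.+ K)) N≤m))
              (ℕ.≤-trans (ℕ.≤-trans (ℕ.m≤m+n j K) (ℕ.m≤n+m (j ℕ.+ K) N₁)) N≤m))
            (ℚ.≤-trans (archimedean c e 0<e) (*-monoʳ (ℚ.<⇒≤ 0<e)
              (ι-mono (ℕ.m≤n⇒m≤1+n (ℕ.≤-trans (ℕ.≤-trans (ℕ.m≤n+m K j) (ℕ.m≤n+m (j ℕ.+ K) N₁)) N≤m))))))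
      where
      K : ℕ
      K = num⁺ c ℕ.* ↧ₙ e

open import Defs
open import Data.Nat using (ℕ; NonZero)
open import Data.Product using (Σ-syntax)

theorem3 : (η : ℝ) (0<η : 0ℝ < η) →
    Σ[ 𝒶 ∈ Strategy ] Σ[ C ∈ ℝ ]
    ((d : ℕ) .{{_ : NonZero d}} → 𝔼𝒯 𝒶 d ≤∞ C * pow d (2ℝ + η) (0<⇒0≤2+ η 0<η))
theorem3 = Rendezvous.theorem
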